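{- Let $k\ge 2$ be a fixed integer and let $n_1,\ldots,n_k$ be positive integers with $n_k=\min_{1\le i\le k} n_i$. Let $G\sim\mathcal{T}(n_1,\ldots,n_k)$. Then, with probability $1-o(1)$ as $n_k\to\infty$, it holds that $f_k(G)=s(G)-k+1$.
   Context: $\mathcal{T}(n_1,\ldots,n_k)$ denotes the probability space of $k$-partite tournaments obtained from the complete $k$-partite graph with vertex classes $V_1,\ldots,V_k$, $|V_i|=n_i$, by orienting each edge independently and uniformly at random. For a $k$-partite tournament $G$, $s(G)$ denotes the size of its smallest vertex class (so $s(G)=n_k$ here). A feedback arc set of a directed graph $G$ is a set of edges meeting every directed cycle of $G$ (viewed as a spanning subgraph of $G$). For an oriented graph $G$, $f_k(G)$ is the maximum integer $t$ such that every feedback arc set of $G$ contains $t$ pairwise vertex-disjoint copies of the transitive tournament on $k$ vertices (i.e. of an acyclic $k$-clique). -}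

module Defs where

open import Data.Bool using (Bool; true; false; if_then_else_)
open import Data.Fin using (Fin; zero; suc; toℕ; fromℕ; inject≤; _<_; _<?_)
open import Data.Fin.Properties using (_≟_; any?; all?; injective⇒≤; inject≤-injective)
open import Data.Fin.Subset using (Subset; _∈_)
open import Data.Fin.Subset.Properties using (_∈?_; anySubset?)
open import Data.Integer as ℤ using (ℤ; +_; -[1+_])
open import Data.List using (List; []; _∷_; length; filter; map; concatMap; allFin; cartesianProduct; cartesianProductWith)
import Data.List as List
open import Data.Nat using (ℕ; zero; suc; _≤_; _⊓_; _^_)
open import Data.Nat.DivMod using (_mod_)
open import Data.Nat.Properties using (allUpTo?; ≰⇒>; m^n≢0; _≤?_; 1+n≰n)
open import Data.Product using (Σ-syntax; ∃; ∃-syntax; _×_; _,_; proj₁; proj₂; swap)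
open import Data.Product.Properties using (≡-dec)
open import Data.Rational as ℚ using (ℚ)
open import Data.Vec using (Vec; []; _∷_; lookup; tabulate)
open import Data.Vec.Functional using (foldr; tail)
open import Data.Vec.Properties using (lookup∘tabulate)
open import Function using (_∘_)
open import Level using (0ℓ)
open import Relation.Binary.Definitions using (DecidableEquality)
open import Relation.Binary.PropositionalEquality using (_≡_; _≢_; refl; sym; cong; subst)
open import Relation.Nullary using (Dec; yes; no; ¬_; contradiction)
open import Relation.Nullary.Decidable using (map′; ¬?; _×-dec_; _→-dec_; decidable-stable)
open import Relation.Unary using (Pred; Decidable)

-- Arcs are ordered pairs (source , target), indexed by Fin size, so that a
-- set of arcs (equivalently, a spanning subgraph) is a Subset size.
record Digraph (V : Set) : Set where
  field
    size : ℕ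
    arc  : Fin size → V × V

  source target : Fin size → V
  source e = proj₁ (arc e)
  target e = proj₂ (arc e)

cyclicSuc : ∀ {l} → Fin (suc l) → Fin (suc l)
cyclicSuc {l} i = suc (toℕ i) mod suc l

module _ {V : Set} (G : Digraph V) where
  open Digraph G

  -- The sources of the arcs of c are exactly the vertices of the cycle.
  IsCycle : ∀ {l} → Vec (Fin size) (suc l) → Set
  IsCycle c =
      (∀ i → target (lookup c i) ≡ source (lookup c (cyclicSuc i)))
    × (∀ i j → source (lookup c i) ≡ source (lookup c j) → i ≡ j)

  IsFeedbackArcSet : Subset size → Set
  IsFeedbackArcSet F =
    ∀ {l} (c : Vec (Fin size) (suc l)) → IsCycle c → ∃[ i ] lookup c i ∈ F

  HasArc : Subset size → V → V → Set
  HasArc F u v = ∃[ e ] e ∈ F × arc e ≡ (u , v)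

  -- A copy of the transitive tournament on k vertices in the spanning
  -- subgraph with arc set F, its vertices listed in transitive order.
  IsTransitiveClique : ∀ {k} → Subset size → Vec V k → Set
  IsTransitiveClique F vs =
      (∀ i j → lookup vs i ≡ lookup vs j → i ≡ j)
    × (∀ i j → i < j → HasArc F (lookup vs i) (lookup vs j))

  Disjoint : ∀ {k} → Vec V k → Vec V k → Set
  Disjoint us vs = ∀ i j → lookup us i ≢ lookup vs j

  ContainsDisjointCliques : ℕ → Subset size → ℕ → Set
  ContainsDisjointCliques k F t = Σ[ cs ∈ Vec (Vec V k) t ]
      (∀ a → IsTransitiveClique F (lookup cs a))
    × (∀ a b → a ≢ b → Disjoint (lookup cs a) (lookup cs b))

  EveryFASContains : ℕ → ℕ → Set
  EveryFASContains k t = ∀ F → IsFeedbackArcSet F → ContainsDisjointCliques k F t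

IsMaximum : (ℕ → Set) → ℕ → Set
IsMaximum P t = P t × (∀ t′ → P t′ → t′ ≤ t)

-- f_k(G) = z. The value is compared in ℤ because s(G) - k + 1 may be negative.
f[_,_]≡_ : {V : Set} → ℕ → Digraph V → ℤ → Set
f[ k , G ]≡ z = ∃[ t ] + t ≡ z × IsMaximum (EveryFASContains G k) t

module _ {k : ℕ} (n : Fin k → ℕ) where

  Vertex : Set
  Vertex = Σ[ i ∈ Fin k ] Fin (n i)

  vertices : List Vertex
  vertices = concatMap (λ i → map (i ,_) (allFin (n i))) (allFin k)

  -- The strict order on class indices lists each edge {u , v} once.
  edges : List (Vertex × Vertex)
  edges = filter (λ (u , v) → proj₁ u <? proj₁ v) (cartesianProduct vertices vertices)

  Orientation : Set
  Orientation = Vec Bool (length edges)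

  tournament : Orientation → Digraph Vertex
  tournament ω = record
    { size = length edges
    ; arc  = λ e → let uv = List.lookup edges e in
                   if lookup ω e then uv else swap uv
    }

lastIndex : ∀ {k} → 2 ≤ k → Fin k
lastIndex {suc k} _ = fromℕ k

-- s(G) for a k-partite tournament G with class sizes n.
smallestClassSize : ∀ {k} → 2 ≤ k → (Fin k → ℕ) → ℕ
smallestClassSize {suc k} _ n = foldr _⊓_ (n zero) (tail n)

outcomes : ∀ m → List (Vec Bool m)
outcomes zero    = [] ∷ []
outcomes (suc m) = cartesianProductWith _∷_ (true ∷ false ∷ []) (outcomes m)

-- Independent fair orientations of m edges: the uniform measure on Vec Bool m.
Pr : ∀ {m} (A : Pred (Vec Bool m) 0ℓ) → Decidable A → ℚ
Pr {m} A A? = ((+ length (filter A? (outcomes m))) ℚ./ (2 ^ m)) {{m^n≢0 2 m}}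

Exhaustible : Set → Set₁
Exhaustible A = ∀ {P : Pred A 0ℓ} → Decidable P → Dec (∃ P)

forall? : ∀ {A} → Exhaustible A → ∀ {P : Pred A 0ℓ} → Decidable P → Dec (∀ x → P x)
forall? ex P? = map′
  (λ ¬∃ x → decidable-stable (P? x) λ ¬p → ¬∃ (x , ¬p))
  (λ ∀p (x , ¬p) → ¬p (∀p x))
  (¬? (ex λ x → ¬? (P? x)))

exhaustVec : ∀ {A} → Exhaustible A → ∀ m → Exhaustible (Vec A m)
exhaustVec ex zero    P? = map′ ([] ,_) (λ { ([] , p) → p }) (P? [])
exhaustVec ex (suc m) P? = map′
  (λ (x , xs , p) → x ∷ xs , p)
  (λ { (x ∷ xs , p) → x , xs , p })
  (ex λ x → exhaustVec ex m λ xs → P? (x ∷ xs))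

exhaustVertex : ∀ {k} (n : Fin k → ℕ) → Exhaustible (Vertex n)
exhaustVertex n P? = map′
  (λ (i , a , p) → (i , a) , p)
  (λ ((i , a) , p) → i , a , p)
  (any? λ i → any? λ a → P? (i , a))

module _ {V : Set} (_≟ⱽ_ : DecidableEquality V) (exV : Exhaustible V) (G : Digraph V) where
  open Digraph G

  isCycle? : ∀ {l} → Decidable (IsCycle G {l})
  isCycle? c =
    (all? λ i → target (lookup c i) ≟ⱽ source (lookup c (cyclicSuc i)))
    ×-dec
    (all? λ i → all? λ j → (source (lookup c i) ≟ⱽ source (lookup c j)) →-dec (i ≟ j))

  isFeedbackArcSet? : Decidable (IsFeedbackArcSet G)
  isFeedbackArcSet? F = map′
    (λ h c cyc → h (injective⇒≤ λ {i} {j} eq → proj₂ cyc i j (cong source eq)) c cyc)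
    (λ h {_} _ → h)
    (allUpTo? (λ l → forall? (exhaustVec any? (suc l)) λ c →
      isCycle? c →-dec any? λ i → lookup c i ∈? F) size)

  hasArc? : ∀ F u v → Dec (HasArc G F u v)
  hasArc? F u v = any? λ e → (e ∈? F) ×-dec ≡-dec _≟ⱽ_ _≟ⱽ_ (arc e) (u , v)

  isTransitiveClique? : ∀ {k} F → Decidable (IsTransitiveClique G {k} F)
  isTransitiveClique? F vs =
    (all? λ i → all? λ j → (lookup vs i ≟ⱽ lookup vs j) →-dec (i ≟ j))
    ×-dec
    (all? λ i → all? λ j → (i <? j) →-dec hasArc? F (lookup vs i) (lookup vs j))

  containsDisjointCliques? : ∀ k F → Decidable (ContainsDisjointCliques G k F)
  containsDisjointCliques? k F t = exhaustVec (exhaustVec exV k) t λ cs →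
    (all? λ a → isTransitiveClique? F (lookup cs a))
    ×-dec
    (all? λ a → all? λ b → ¬? (a ≟ b) →-dec
      (all? λ i → all? λ j → ¬? (lookup (lookup cs a) i ≟ⱽ lookup (lookup cs b) j)))

  everyFASContains? : ∀ k → Decidable (EveryFASContains G k)
  everyFASContains? k t = forall? anySubset? λ F →
    isFeedbackArcSet? F →-dec containsDisjointCliques? k F t

  everyFASContains-≤ : ∀ {k t t′} → t ≤ t′ → EveryFASContains G k t′ → EveryFASContains G k t
  everyFASContains-≤ {k} {t} t≤t′ h F fas = shrink (h F fas)
    where
    shrink : ContainsDisjointCliques G k F _ → ContainsDisjointCliques G k F t
    shrink (cs , clique , disjoint) = tabulate g
      , (λ a → subst (IsTransitiveClique G F) (sym (lookup∘tabulate g a)) (clique (ι a)))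
      , (λ a b a≢b → subst (λ us → Disjoint G us (lookup (tabulate g) b)) (sym (lookup∘tabulate g a))
                     (subst (Disjoint G (g a)) (sym (lookup∘tabulate g b))
                       (disjoint (ι a) (ι b) (a≢b ∘ inject≤-injective t≤t′ t≤t′ a b))))
      where
      ι : Fin t → Fin _
      ι a = inject≤ a t≤t′
      g : Fin t → Vec V k
      g a = lookup cs (ι a)

  isMaximum? : ∀ k → Decidable (IsMaximum (EveryFASContains G k))
  isMaximum? k t = map′
    (λ (p , ¬p) → p , λ t′ p′ → decidable-stable (t′ ≤? t) λ t′≰t →
      ¬p (everyFASContains-≤ (≰⇒> t′≰t) p′))
    (λ (p , max) → p , λ p′ → contradiction (max (suc t) p′) 1+n≰n)
    (everyFASContains? k t ×-dec ¬? (everyFASContains? k (suc t)))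

  hasValue? : ∀ k → Decidable (f[ k , G ]≡_)
  hasValue? k (+ t)    = map′ (λ m → t , refl , m) (λ { (_ , refl , m) → m }) (isMaximum? k t)
  hasValue? k -[1+ _ ] = no λ { (_ , () , _) }

f≡? : ∀ {k} (n : Fin k → ℕ) (ω : Orientation n) j → Decidable (f[ j , tournament n ω ]≡_)
f≡? n ω = hasValue? (≡-dec _≟_ _≟_) (exhaustVertex n) (tournament n ω)

{-# OPTIONS --safe #-}
-- Upper bound. Choose distinct vertices x₁, …, xₖ₋₁ of the last class, and put every vertex of class i < k below or above
-- the last class according to the direction of its arc with xᵢ. The arcs that do not climb form a feedback arc set without
-- arcs between xᵢ and class i, so no xᵢ lies in one of its k-cliques.
--
-- Lower bound. The complement of a feedback arc set F is acyclic, so the vertices have an injective rank which decreases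
-- along it; F contains every arc along which the rank increases, and the ends of such arcs are called adjacent. Keep s
-- vertices of each class. Outside an event of small probability, whatever the rank:
-- (mixing) among many vertices u of class i and many disjoint k-tuples t, some u is adjacent to all entries of some t
-- outside class i. Otherwise, after splitting the ranks at suitable thresholds, all pairs (u , t) from large subfamilies
-- would miss one pattern of directions, which is too unlikely for the number of subfamilies.
-- (connecting) for x ≢ x′ in one class there are many y with x → y → x′ in each other class, and such a y is adjacent to
-- x or to x′ if x has the smaller rank. Hence at most one vertex of a class has low degree towards a given other class.
-- Now discard k − 1 vertices of each class, among them those of low degree. By mixing, large sets of vertices contain
-- transversal cliques. Choose such cliques (tiles) greedily, some reserved for each class; cover the few vertices that
-- could replace their class-mate in few of the reserved tiles, using their degrees; continue greedily until few vertices
-- remain. Leftovers u₁, …, uₖ are absorbed at once: find a clique c₁, …, cₖ with cᵢ in a tile where uᵢ can replace it.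
module Submission where

open import Data.Bool as Bool using (Bool; true; false; not; if_then_else_; _∧_; _∨_)
open import Data.Bool.ListAction using () renaming (any to anyᵇ)
import Data.Bool.Properties as Boolₚ
open import Data.Empty using (⊥-elim)
open import Data.Fin as Fin using (Fin; zero; suc; toℕ; fromℕ; fromℕ<; inject≤; punchIn; combine; remQuot)
open import Data.Fin.Induction using (<-weakInduction)
import Data.Fin.Properties as Finₚ
open import Data.Fin.Subset using (Subset) renaming (_∈_ to _∈ₛ_; _∉_ to _∉ₛ_)
open import Data.Fin.Subset.Properties using () renaming (_∈?_ to _∈ₛ?_)
open import Data.Integer as ℤ using (ℤ; 1ℤ)
import Data.Integer.Properties as ℤₚ
import Data.Integer.Tactic.RingSolver as ℤ-Solver
open import Data.List as List using (List; []; _∷_; _++_; length; map; filter; concatMap; concat; replicate; allFin; take; drop)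
open import Data.List.Membership.Propositional using (_∈_; _∉_; find; lose)
import Data.List.Membership.Propositional.Properties as ∈ₚ
import Data.List.Properties as Listₚ
open import Data.List.Relation.Binary.Disjoint.Propositional using () renaming (Disjoint to DisjointLists)
open import Data.List.Relation.Binary.Permutation.Propositional using (_↭_; ↭-sym; ↭-trans; ↭-refl; ↭-prep; ↭-swap; ↭-reflexive; ↭⇒↭ₛ; module PermutationReasoning)
import Data.List.Relation.Binary.Permutation.Propositional.Properties as ↭ₚ
import Data.List.Relation.Binary.Permutation.Setoid.Properties as ↭ₛₚ
open import Data.List.Relation.Unary.All as All using (All; []; _∷_)
import Data.List.Relation.Unary.All.Properties as Allₚ
open import Data.List.Relation.Unary.AllPairs as AllPairs using (AllPairs; []; _∷_)
import Data.List.Relation.Unary.AllPairs.Properties as AllPairsₚ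
open import Data.List.Relation.Unary.Any as Any using (Any; here; there)
import Data.List.Relation.Unary.Any.Properties as Anyₚ
import Data.List.Relation.Unary.Sorted.TotalOrder.Properties as Sortedₚ
open import Data.List.Relation.Unary.Unique.Propositional using (Unique)
import Data.List.Relation.Unary.Unique.Propositional.Properties as Uniqueₚ
import Data.List.Sort as Sort
open import Data.Nat as ℕ using (ℕ; zero; suc; _+_; _*_; _∸_; _^_; _≤_; _<_; z≤n; s≤s; NonZero)
open import Data.Nat.DivMod using (_%_; m<n⇒m%n≡m; n%n≡0)
open import Data.Nat.Induction using (<-rec)
import Data.Nat.Properties as ℕₚ
open import Data.Nat.Tactic.RingSolver using (solve-∀)
open import Data.Product using (Σ; ∃; ∃₂; ∃-syntax; _×_; _,_; proj₁; proj₂; swap)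
open import Data.Product.Properties using (≡-dec)
open import Data.Rational as ℚ using (ℚ; 0ℚ; 1ℚ; mkℚ)
import Data.Rational.Properties as ℚₚ
open import Data.Rational.Unnormalised as ℚᵘ using (mkℚᵘ)
import Data.Rational.Unnormalised.Properties as ℚᵘₚ
open import Data.Sum using (_⊎_; inj₁; inj₂; [_,_]′)
open import Data.Vec as Vec using (Vec; []; _∷_; lookup; tabulate)
open import Data.Vec.Functional using (updateAt; foldr)
import Data.Vec.Functional.Properties as VFₚ
import Data.Vec.Properties as Vecₚ
open import Defs
open import Function using (_∘_; id; const; flip)
open import Level using (0ℓ)
open import Relation.Binary.Bundles using (DecTotalOrder)
import Relation.Binary.Construct.On as On
open import Relation.Binary.Definitions using (DecidableEquality; tri<; tri≈; tri>)
open import Relation.Binary.PropositionalEquality using (_≡_; _≢_; refl; sym; trans; cong; cong₂; subst; subst₂; setoid; module ≡-Reasoning)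
open import Relation.Nullary using (Dec; yes; no; does; ¬_; contradiction)
open import Relation.Nullary.Decidable using (¬?; _×-dec_; _→-dec_; _⊎-dec_; decidable-stable; dec-true; dec-false)
open import Relation.Unary using (Pred; Decidable)

-- Lists

length-allFin : ∀ n → length (allFin n) ≡ n
length-allFin n = Listₚ.length-tabulate id

m+n≤o⇒n≤o∸m : ∀ m {n o} → m + n ≤ o → n ≤ o ∸ m
m+n≤o⇒n≤o∸m m {n} le = ℕₚ.m+n≤o⇒m≤o∸n n (ℕₚ.≤-trans (ℕₚ.≤-reflexive (ℕₚ.+-comm n m)) le)

module _ {A : Set} where

  ∈⇒↭ : ∀ {x : A} {xs} → x ∈ xs → ∃ λ ys → xs ↭ x ∷ ys
  ∈⇒↭ x∈xs with ys , zs , refl ← ∈ₚ.∈-∃++ x∈xs = ys ++ zs , ↭ₚ.shift _ ys zs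

  Unique-resp-↭ : ∀ {xs ys : List A} → xs ↭ ys → Unique xs → Unique ys
  Unique-resp-↭ p = ↭ₛₚ.Unique-resp-↭ (setoid A) (↭⇒↭ₛ p)

  Unique-++ʳ : ∀ xs {ys : List A} → Unique (xs ++ ys) → Unique ys
  Unique-++ʳ []       u       = u
  Unique-++ʳ (_ ∷ xs) (_ ∷ u) = Unique-++ʳ xs u

  Unique-++ˡ : ∀ {xs ys : List A} → Unique (xs ++ ys) → Unique xs
  Unique-++ˡ {xs} {ys} u = Unique-++ʳ ys (Unique-resp-↭ (↭ₚ.++-comm xs ys) u)

  Unique-⊆-length : ∀ {xs ys : List A} → Unique xs → (∀ {x} → x ∈ xs → x ∈ ys) → length xs ≤ length ys
  Unique-⊆-length []       _   = z≤n
  Unique-⊆-length {x ∷ xs} {ys} u@(_ ∷ u′) sub with ys′ , p ← ∈⇒↭ (sub (here refl)) =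
    ℕₚ.≤-trans (s≤s (Unique-⊆-length u′ sub′)) (ℕₚ.≤-reflexive (sym (↭ₚ.↭-length p)))
    where
    sub′ : ∀ {y} → y ∈ xs → y ∈ ys′
    sub′ y∈xs with ↭ₚ.∈-resp-↭ p (sub (there y∈xs))
    ... | here refl   = contradiction y∈xs (Uniqueₚ.Unique[x∷xs]⇒x∉xs u)
    ... | there y∈ys′ = y∈ys′

  lookup-injective : ∀ {xs : List A} → Unique xs → ∀ {i j} → List.lookup xs i ≡ List.lookup xs j → i ≡ j
  lookup-injective {_ ∷ _} u {zero}  {zero}  eq = refl
  lookup-injective {_ ∷ _} u {zero}  {suc j} eq =
    contradiction (subst (_∈ _) (sym eq) (∈ₚ.∈-lookup j)) (Uniqueₚ.Unique[x∷xs]⇒x∉xs u)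
  lookup-injective {_ ∷ _} u {suc i} {zero}  eq =
    contradiction (subst (_∈ _) eq (∈ₚ.∈-lookup i)) (Uniqueₚ.Unique[x∷xs]⇒x∉xs u)
  lookup-injective {_ ∷ _} (_ ∷ u) {suc i} {suc j} eq = cong suc (lookup-injective u eq)

  module _ {B : Set} (f : A → B) where

    Unique-map-filter : ∀ {P : Pred A 0ℓ} (P? : Decidable P) {xs} → Unique (map f xs) → Unique (map f (filter P? xs))
    Unique-map-filter P? = AllPairsₚ.map⁺ ∘ AllPairsₚ.filter⁺ P? ∘ AllPairsₚ.map⁻

    Unique-map-injective : ∀ {xs x y} → Unique (map f xs) → x ∈ xs → y ∈ xs → f x ≡ f y → x ≡ y
    Unique-map-injective u       (here refl) (here refl) _  = refl
    Unique-map-injective (h ∷ _) (here refl) (there y∈)  eq = contradiction eq (All.lookup h (∈ₚ.∈-map⁺ f y∈))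
    Unique-map-injective (h ∷ _) (there x∈)  (here refl) eq = contradiction (sym eq) (All.lookup h (∈ₚ.∈-map⁺ f x∈))
    Unique-map-injective (_ ∷ u) (there x∈)  (there y∈)  eq = Unique-map-injective u x∈ y∈ eq

  count : ∀ {P : Pred A 0ℓ} → Decidable P → List A → ℕ
  count P? xs = length (filter P? xs)

  module _ {P : Pred A 0ℓ} (P? : Decidable P) where

    count-++ : ∀ xs ys → count P? (xs ++ ys) ≡ count P? xs + count P? ys
    count-++ xs ys = trans (cong length (Listₚ.filter-++ P? xs ys)) (Listₚ.length-++ (filter P? xs))

    count-↭ : ∀ {xs ys} → xs ↭ ys → count P? xs ≡ count P? ys
    count-↭ p = ↭ₚ.↭-length (↭ₚ.filter-↭ P? p)

    count-≤-length : ∀ xs → count P? xs ≤ length xs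
    count-≤-length = Listₚ.length-filter P?

    count-++-≥ʳ : ∀ xs ys → count P? ys ≤ count P? (xs ++ ys)
    count-++-≥ʳ xs ys = ℕₚ.≤-trans (ℕₚ.m≤n+m _ (count P? xs)) (ℕₚ.≤-reflexive (sym (count-++ xs ys)))

    filter-partition : ∀ xs → filter P? xs ++ filter (¬? ∘ P?) xs ↭ xs
    filter-partition []       = ↭-refl
    filter-partition (x ∷ xs) with P? x
    ... | yes _ = ↭-prep x (filter-partition xs)
    ... | no  _ = ↭-trans (↭ₚ.shift x (filter P? xs) _) (↭-prep x (filter-partition xs))

    count-partition : ∀ xs → count P? xs + count (¬? ∘ P?) xs ≡ length xs
    count-partition xs = trans (sym (Listₚ.length-++ (filter P? xs))) (↭ₚ.↭-length (filter-partition xs))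

  module _ {P Q R : Pred A 0ℓ} (P? : Decidable P) (Q? : Decidable Q) (R? : Decidable R) where

    count-∪ : (∀ {x} → P x → Q x ⊎ R x) → ∀ xs → count P? xs ≤ count Q? xs + count R? xs
    count-∪ h []       = z≤n
    count-∪ h (x ∷ xs) with P? x | Q? x | R? x
    ... | yes p | no ¬q | no ¬r = ⊥-elim ([ ¬q , ¬r ]′ (h p))
    ... | yes p | yes q | yes r = s≤s (ℕₚ.≤-trans (count-∪ h xs) (ℕₚ.+-monoʳ-≤ (count Q? xs) (ℕₚ.n≤1+n _)))
    ... | yes p | yes q | no  r = s≤s (count-∪ h xs)
    ... | yes p | no  q | yes r = ℕₚ.≤-trans (s≤s (count-∪ h xs)) (ℕₚ.≤-reflexive (sym (ℕₚ.+-suc (count Q? xs) _)))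
    ... | no  p | yes q | yes r = ℕₚ.≤-trans (count-∪ h xs) (ℕₚ.m≤n⇒m≤1+n (ℕₚ.+-monoʳ-≤ (count Q? xs) (ℕₚ.n≤1+n _)))
    ... | no  p | yes q | no  r = ℕₚ.m≤n⇒m≤1+n (count-∪ h xs)
    ... | no  p | no  q | yes r = ℕₚ.≤-trans (count-∪ h xs) (ℕₚ.+-monoʳ-≤ (count Q? xs) (ℕₚ.n≤1+n _))
    ... | no  p | no  q | no  r = count-∪ h xs

  count-mono : ∀ {P Q : Pred A 0ℓ} (P? : Decidable P) (Q? : Decidable Q) →
               (∀ {x} → P x → Q x) → ∀ xs → count P? xs ≤ count Q? xs
  count-mono P? Q? h []       = z≤n
  count-mono P? Q? h (x ∷ xs) with P? x | Q? x
  ... | yes p | yes q = s≤s (count-mono P? Q? h xs)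
  ... | yes p | no ¬q = contradiction (h p) ¬q
  ... | no  p | yes q = ℕₚ.m≤n⇒m≤1+n (count-mono P? Q? h xs)
  ... | no  p | no  q = count-mono P? Q? h xs

count-map : ∀ {A B : Set} (f : A → B) {P : Pred B 0ℓ} (P? : Decidable P) xs →
            count P? (map f xs) ≡ count (P? ∘ f) xs
count-map f P? []       = refl
count-map f P? (x ∷ xs) with P? (f x)
... | yes _ = cong suc (count-map f P? xs)
... | no  _ = count-map f P? xs

count-filter-≤ : ∀ {A : Set} {P Q : Pred A 0ℓ} (P? : Decidable P) (Q? : Decidable Q) xs →
                 count P? (filter Q? xs) ≤ count P? xs
count-filter-≤ P? Q? []       = z≤n
count-filter-≤ P? Q? (x ∷ xs) with Q? x | P? x in eq
... | yes _ | yes _ rewrite eq = s≤s (count-filter-≤ P? Q? xs)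
... | yes _ | no  _ rewrite eq = count-filter-≤ P? Q? xs
... | no  _ | yes _ = ℕₚ.m≤n⇒m≤1+n (count-filter-≤ P? Q? xs)
... | no  _ | no  _ = count-filter-≤ P? Q? xs

-- A union bound for counting.
count-Any-≤ : ∀ {A B : Set} {P : A → Pred B 0ℓ} (P? : ∀ x → Decidable (P x)) {b} xs ys →
              (∀ {x} → x ∈ xs → count (P? x) ys ≤ b) →
              count (λ y → Any.any? (λ x → P? x y) xs) ys ≤ length xs * b
count-Any-≤ P? []       ys _ = ℕₚ.≤-reflexive (cong length (Listₚ.filter-none _ {ys} (All.universal (λ _ ()) ys)))
count-Any-≤ P? (x ∷ xs) ys h = ℕₚ.≤-trans
  (count-∪ _ (P? x) (λ y → Any.any? (λ x → P? x y) xs) (λ { (here p) → inj₁ p ; (there p) → inj₂ p }) ys)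
  (ℕₚ.+-mono-≤ (h (here refl)) (count-Any-≤ P? xs ys (h ∘ there)))

length-concatMap-≤ : ∀ {A B : Set} (f : A → List B) b xs → (∀ x → length (f x) ≤ b) → length (concatMap f xs) ≤ length xs * b
length-concatMap-≤ f b []       h = z≤n
length-concatMap-≤ f b (x ∷ xs) h = ℕₚ.≤-trans (ℕₚ.≤-reflexive (Listₚ.length-++ (f x)))
  (ℕₚ.+-mono-≤ (h x) (length-concatMap-≤ f b xs h))

count-≡-≤1 : ∀ {A : Set} {n} (f : A → Fin n) y {xs} → Unique (map f xs) → count (λ x → f x Finₚ.≟ y) xs ≤ 1
count-≡-≤1 f y {xs} u = subst (_≤ 1) (Listₚ.length-map f ys) (Unique-⊆-length {ys = y ∷ []} (Unique-map-filter f (λ x → f x Finₚ.≟ y) u) only-y)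
  where
  ys = filter (λ x → f x Finₚ.≟ y) xs
  only-y : ∀ {z} → z ∈ map f ys → z ∈ y ∷ []
  only-y z∈ with x , x∈ , refl ← ∈ₚ.∈-map⁻ f z∈ = here (proj₂ (∈ₚ.∈-filter⁻ (λ x → f x Finₚ.≟ y) {xs = xs} x∈))

-- The use is a column of tiles of which a single one is altered: `zs` is what the columns before
-- and after have in common.
map-exchange : ∀ {A B : Set} (f g : A → B) {xs e} → Unique xs → e ∈ xs → (∀ {x} → x ∈ xs → x ≢ e → g x ≡ f x) →
               ∃ λ zs → map f xs ↭ f e ∷ zs × map g xs ↭ g e ∷ zs
map-exchange f g {xs} {e} xs! e∈ same with ys , p ← ∈⇒↭ e∈ =
  map f ys , ↭ₚ.map⁺ f p , ↭-trans (↭ₚ.map⁺ g p) (↭-reflexive (cong (g e ∷_) (Listₚ.map-cong-local (All.tabulate λ x∈ →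
    same (↭ₚ.∈-resp-↭ (↭-sym p) (there x∈)) λ { refl → Uniqueₚ.Unique[x∷xs]⇒x∉xs (Unique-resp-↭ p xs!) x∈ }))))

∈-replicate-count : ∀ {k} τ (i : Fin k) → τ ≤ count (Finₚ._≟ i) (concat (replicate τ (allFin k)))
∈-replicate-count zero    i = z≤n
∈-replicate-count (suc τ) i = ℕₚ.≤-trans
  (ℕₚ.+-mono-≤ (Listₚ.filter-some (Finₚ._≟ i) (Any.map sym (∈ₚ.∈-allFin i))) (∈-replicate-count τ i))
  (ℕₚ.≤-reflexive (sym (count-++ (Finₚ._≟ i) (allFin _) _)))

length-replicate-allFin : ∀ k τ → length (concat (replicate τ (allFin k))) ≡ τ * k
length-replicate-allFin k zero    = refl
length-replicate-allFin k (suc τ) = trans (Listₚ.length-++ (allFin k))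
  (cong₂ _+_ (length-allFin k) (length-replicate-allFin k τ))

∈-take⁻ : ∀ {A : Set} n (xs : List A) {x} → x ∈ take n xs → x ∈ xs
∈-take⁻ (suc n) (_ ∷ _)  (here eq)  = here eq
∈-take⁻ (suc n) (_ ∷ xs) (there x∈) = there (∈-take⁻ n xs x∈)

-- Disjoint cliques in k-partite graphs

Tuple : ℕ → ℕ → Set
Tuple k s = Fin k → Fin s

column : ∀ {k s} → Fin k → List (Tuple k s) → List (Fin s)
column j = map (λ t → t j)

-- `cliqueBound` leaves one clique after `k` rounds of matching that lose `M` tuples each.
-- `tileGroupSize` is a number of tiles per class with which fewer than `M` vertices of the class
-- have less than `2 * cliqueBound k M` tiles to enter.
cliqueBound tileGroupSize : ℕ → ℕ → ℕ
cliqueBound k M   = suc (k * M)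
tileGroupSize k M = M * (cliqueBound k M + cliqueBound k M) + M

module Tiling {k s : ℕ} (Adj : Fin k → Fin s → Fin k → Fin s → Set)
  (Adj? : ∀ i x j y → Dec (Adj i x j y))
  (Adj-sym : ∀ {i x j y} → Adj i x j y → Adj j y i x) where

  IsClique : Tuple k s → Set
  IsClique t = ∀ i j → i ≢ j → Adj i (t i) j (t j)

  IsPartialClique : ℕ → Tuple k s → Set
  IsPartialClique p t = ∀ i j → toℕ i < p → toℕ j < p → i ≢ j → Adj i (t i) j (t j)

  Fits : Fin k → Fin s → Tuple k s → Set
  Fits i u t = ∀ j → j ≢ i → Adj i u j (t j)

  Fits? : ∀ i u t → Dec (Fits i u t)
  Fits? i u t = Finₚ.all? λ j → ¬? (j Finₚ.≟ i) →-dec Adj? i u j (t j)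

  replace : Tuple k s → Fin k → Fin s → Tuple k s
  replace t i u = updateAt t i (const u)

  replace-clique : ∀ {i u t} → IsClique t → Fits i u t → IsClique (replace t i u)
  replace-clique {i} {u} {t} clique fits j l j≢l with j Finₚ.≟ i | l Finₚ.≟ i
  ... | yes refl | yes refl = contradiction refl j≢l
  ... | yes refl | no l≢i   = subst₂ (λ x y → Adj i x l y)
    (sym (VFₚ.updateAt-updates i t)) (sym (VFₚ.updateAt-minimal l i t l≢i)) (fits l l≢i)
  ... | no j≢i   | yes refl = Adj-sym (subst₂ (λ x y → Adj i x j y)
    (sym (VFₚ.updateAt-updates i t)) (sym (VFₚ.updateAt-minimal j i t j≢i)) (fits j j≢i))
  ... | no j≢i   | no l≢i   = subst₂ (λ x y → Adj j x l y)
    (sym (VFₚ.updateAt-minimal j i t j≢i)) (sym (VFₚ.updateAt-minimal l i t l≢i)) (clique j l j≢l)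

  -- The form in which mixing is used once the rank is fixed. The entries of the tuples at `i` are
  -- left free, because `u` is going to replace them.
  Swappable : ℕ → Set
  Swappable M = ∀ i us ts → Unique us → M ≤ length us →
    (∀ j → j ≢ i → Unique (column j ts)) → M ≤ length ts →
    ∃₂ λ u t → u ∈ us × t ∈ ts × Fits i u t

  module _ {M : ℕ} (swappable : Swappable M) where

    -- Greedy matching: while both lists keep `M` members, `Swappable` yields another pair, which is
    -- then removed from them.
    match : ∀ i x us ts → Unique us → x + M ≤ length us →
      (∀ j → j ≢ i → Unique (column j ts)) → x + M ≤ length ts →
      ∃ λ ts′ → length ts′ ≡ x × (∀ j → Unique (column j ts′)) ×
        (∀ {t′} → t′ ∈ ts′ → t′ i ∈ us × ∃ λ t → t ∈ ts × Fits i (t′ i) t × (∀ j → j ≢ i → t′ j ≡ t j))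
    match i zero    us ts _ _ _ _ = [] , refl , (λ _ → []) , λ ()
    match i (suc x) us ts us! x≤us ts! x≤ts
      with u , t , u∈us , t∈ts , fits ← swappable i us ts us! (ℕₚ.m+n≤o⇒n≤o (suc x) x≤us) ts! (ℕₚ.m+n≤o⇒n≤o (suc x) x≤ts)
      with us₁ , us↭ ← ∈⇒↭ u∈us | ts₁ , ts↭ ← ∈⇒↭ t∈ts = extended
      where
      us₁! : Unique (u ∷ us₁)
      us₁! = Unique-resp-↭ us↭ us!
      ts₁! : ∀ j → j ≢ i → Unique (t j ∷ column j ts₁)
      ts₁! j j≢i = Unique-resp-↭ (↭ₚ.map⁺ _ ts↭) (ts! j j≢i)
      rest : ∃ _
      rest = match i x us₁ ts₁ (AllPairs.tail us₁!) (ℕₚ.≤-pred (subst (suc x + M ≤_) (↭ₚ.↭-length us↭) x≤us))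
        (λ j j≢i → AllPairs.tail (ts₁! j j≢i)) (ℕₚ.≤-pred (subst (suc x + M ≤_) (↭ₚ.↭-length ts↭) x≤ts))
      ts₂ : List (Tuple k s)
      ts₂ = proj₁ rest
      from : ∀ {t′} → t′ ∈ ts₂ → t′ i ∈ us₁ × ∃ λ t → t ∈ ts₁ × Fits i (t′ i) t × (∀ j → j ≢ i → t′ j ≡ t j)
      from = proj₂ (proj₂ (proj₂ rest))
      new : Tuple k s
      new = replace t i u
      fresh : ∀ j → new j ∉ column j ts₂
      fresh j new∈ with t′ , t′∈ , eq ← ∈ₚ.∈-map⁻ _ new∈ with from t′∈ | j Finₚ.≟ i
      ... | t′i∈ , _ | yes refl = Uniqueₚ.Unique[x∷xs]⇒x∉xs us₁!
        (subst (_∈ us₁) (trans (sym eq) (VFₚ.updateAt-updates i t)) t′i∈)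
      ... | _ , t″ , t″∈ , _ , same | no j≢i = Uniqueₚ.Unique[x∷xs]⇒x∉xs (ts₁! j j≢i)
        (subst (_∈ column j ts₁) (trans (sym (trans eq (same j j≢i))) (VFₚ.updateAt-minimal j i t j≢i)) (∈ₚ.∈-map⁺ _ t″∈))
      extended : ∃ _
      extended = new ∷ ts₂ , cong suc (proj₁ (proj₂ rest))
        , (λ j → Allₚ.¬Any⇒All¬ _ (fresh j) ∷ proj₁ (proj₂ (proj₂ rest)) j)
        , λ where
            (here refl) → subst (_∈ us) (sym (VFₚ.updateAt-updates i t)) u∈us , t , t∈ts
              , subst (λ v → Fits i v t) (sym (VFₚ.updateAt-updates i t)) fits , λ j j≢i → VFₚ.updateAt-minimal j i t j≢i
            (there t′∈) → let t′i∈ , t″ , t″∈ , rest = from t′∈ in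
              ↭ₚ.∈-resp-↭ (↭-sym us↭) (there t′i∈) , t″ , ↭ₚ.∈-resp-↭ (↭-sym ts↭) (there t″∈) , rest

    -- The cliques grow by one class per round: vertices of the next class are matched with tuples
    -- that are cliques on the classes before it, and take over their entries there. A round costs
    -- `M` tuples, whence `p * M`.
    partialCliques : (A : Fin k → List (Fin s)) → (∀ j → Unique (A j)) →
      ∀ p → p ≤ k → ∀ x → (∀ j → x + p * M ≤ length (A j)) →
      ∃ λ ts → length ts ≡ x × (∀ j → Unique (column j ts)) ×
        (∀ {t} → t ∈ ts → (∀ j → t j ∈ A j) × IsPartialClique p t)
    partialCliques A A! zero p≤k x x≤A = List.tabulate tuple , Listₚ.length-tabulate tuple
      , (λ j → subst Unique (sym (Listₚ.map-tabulate tuple (λ t → t j)))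
          (Uniqueₚ.tabulate⁺ (λ eq → Finₚ.inject≤-injective _ _ _ _ (lookup-injective (A! j) eq))))
      , λ t∈ → let a , eq = ∈ₚ.∈-tabulate⁻ t∈ in
          (λ j → subst (λ t → t j ∈ A j) (sym eq) (∈ₚ.∈-lookup (inject≤ a (x≤ j)))) , λ _ _ ()
      where
      x≤ : ∀ j → x ≤ length (A j)
      x≤ j = ℕₚ.m+n≤o⇒m≤o x (x≤A j)
      tuple : Fin x → Tuple k s
      tuple a j = List.lookup (A j) (inject≤ a (x≤ j))
    partialCliques A A! (suc p) p<k x x≤A
      with ts , len , ts! , from ← partialCliques A A! p (ℕₚ.<⇒≤ p<k) (x + M)
        (λ j → subst (_≤ length (A j)) (sym (ℕₚ.+-assoc x M (p * M))) (x≤A j))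
      with ts′ , len′ , ts′! , from′ ← match (fromℕ< p<k) x (A (fromℕ< p<k)) ts (A! _)
        (ℕₚ.≤-trans (ℕₚ.+-monoʳ-≤ x (ℕₚ.m≤m+n M (p * M))) (x≤A _)) (λ j _ → ts! j) (ℕₚ.≤-reflexive (sym len))
      = ts′ , len′ , ts′! , λ t′∈ → inA t′∈ , partial t′∈
      where
      i : Fin k
      i = fromℕ< p<k
      inA : ∀ {t′} → t′ ∈ ts′ → ∀ j → t′ j ∈ A j
      inA t′∈ j with t′i∈ , t , t∈ , _ , same ← from′ t′∈ with j Finₚ.≟ i
      ... | yes refl = t′i∈
      ... | no j≢i   = subst (_∈ A j) (sym (same j j≢i)) (proj₁ (from t∈) j)
      below : ∀ {j} → j ≢ i → toℕ j < suc p → toℕ j < p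
      below {j} j≢i j<1+p = ℕₚ.≤∧≢⇒< (ℕₚ.≤-pred j<1+p)
        λ eq → j≢i (Finₚ.toℕ-injective (trans eq (sym (Finₚ.toℕ-fromℕ< p<k))))
      partial : ∀ {t′} → t′ ∈ ts′ → IsPartialClique (suc p) t′
      partial {t′} t′∈ j l j< l< j≢l with _ , t , t∈ , fits , same ← from′ t′∈ with j Finₚ.≟ i | l Finₚ.≟ i
      ... | yes refl | yes refl = contradiction refl j≢l
      ... | yes refl | no l≢i = subst (Adj i (t′ i) l) (sym (same l l≢i)) (fits l l≢i)
      ... | no j≢i | yes refl = Adj-sym (subst (Adj i (t′ i) j) (sym (same j j≢i)) (fits j j≢i))
      ... | no j≢i | no l≢i = subst₂ (λ x y → Adj j x l y) (sym (same j j≢i)) (sym (same l l≢i))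
        (proj₂ (from t∈) j l (below j≢i j<) (below l≢i l<) j≢l)

    cliqueSize : ℕ
    cliqueSize = cliqueBound k M

    abstract
      transversalClique : (A : Fin k → List (Fin s)) → (∀ j → Unique (A j)) → (∀ j → cliqueSize ≤ length (A j)) →
        ∃ λ c → IsClique c × (∀ j → c j ∈ A j)
      transversalClique A A! Q≤A with partialCliques A A! k ℕₚ.≤-refl 1 Q≤A
      ... | c ∷ _ , _ , _ , from = c
        , (λ i j i≢j → proj₂ (from (here refl)) i j (Finₚ.toℕ<n i) (Finₚ.toℕ<n j) i≢j) , proj₁ (from (here refl))

    -- The tag is part of the relation so that the tiles altered on behalf of different classes in
    -- one exchange are different tiles.
    Supports : Fin k → Fin s → Fin k × Tuple k s → Set
    Supports i u (tag , t) = tag ≡ i × Fits i u t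

    Supports? : ∀ i u → Decidable (Supports i u)
    Supports? i u (tag , t) = (tag Finₚ.≟ i) ×-dec Fits? i u t

    tagged? : ∀ i → Decidable (λ (e : Fin k × Tuple k s) → proj₁ e ≡ i)
    tagged? i e = proj₁ e Finₚ.≟ i

    abstract
      -- `M` vertices with fewer than `b` supporting tiles each would together be supported by at
      -- most `M * b` tiles. The other tiles with tag `i`, at least `M` in number, would support
      -- none of them, against `Swappable`.
      fewUnsupported : ∀ b es i → (∀ j → Unique (column j (map proj₂ es))) → M * b + M ≤ count (tagged? i) es →
        count (λ u → count (Supports? i u) es ℕₚ.<? b) (allFin s) < M
      fewUnsupported b es i es! many = ℕₚ.≰⇒> λ M≤ → let
          us-length = trans (Listₚ.length-take M poor) (ℕₚ.m≤n⇒m⊓n≡m M≤)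
          unsupported-length = ℕₚ.+-cancelˡ-≤ (M * b) M (length unsupported) (begin
            M * b + M                                                ≤⟨ many ⟩
            length es₀                                               ≡⟨ count-partition supported? es₀ ⟨
            count supported? es₀ + length unsupported                ≤⟨ ℕₚ.+-monoˡ-≤ _ (count-Any-≤ (Supports? i) us es₀ poor-count) ⟩
            length us * b + length unsupported                       ≡⟨ cong (λ n → n * b + length unsupported) us-length ⟩
            M * b + length unsupported                               ∎)
          u , t , u∈us , t∈ , fits = swappable i us (map proj₂ unsupported) (Uniqueₚ.take⁺ M (Uniqueₚ.filter⁺ _ (Uniqueₚ.allFin⁺ s)))
            (ℕₚ.≤-reflexive (sym us-length)) (λ j _ → unsupported! j)
            (subst (M ≤_) (sym (Listₚ.length-map proj₂ unsupported)) unsupported-length)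
          e , e∈ , t≡ = ∈ₚ.∈-map⁻ proj₂ t∈
          e∈es₀ , ¬supported = ∈ₚ.∈-filter⁻ (¬? ∘ supported?) {xs = es₀} e∈
          _ , tag≡ = ∈ₚ.∈-filter⁻ (tagged? i) {xs = es} e∈es₀
        in ¬supported (Any.map (λ { {v} refl → tag≡ , subst (Fits i v) t≡ fits }) u∈us)
        where
        open ℕₚ.≤-Reasoning
        poor us : List (Fin s)
        poor = filter (λ u → count (Supports? i u) es ℕₚ.<? b) (allFin s)
        us = take M poor
        es₀ unsupported : List (Fin k × Tuple k s)
        es₀ = filter (tagged? i) es
        supported? : Decidable (λ e → Any (λ u → Supports i u e) us)
        supported? e = Any.any? (λ u → Supports? i u e) us
        unsupported = filter (¬? ∘ supported?) es₀
        unsupported! : ∀ j → Unique (column j (map proj₂ unsupported))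
        unsupported! j = subst Unique (Listₚ.map-∘ unsupported)
          (Unique-map-filter _ (¬? ∘ supported?) (Unique-map-filter _ (tagged? i) (subst Unique (sym (Listₚ.map-∘ es)) (es! j))))
        poor-count : ∀ {u} → u ∈ us → count (Supports? i u) es₀ ≤ b
        poor-count {u} u∈ = ℕₚ.≤-trans (count-filter-≤ (Supports? i u) (tagged? i) es)
          (ℕₚ.<⇒≤ (proj₂ (∈ₚ.∈-filter⁻ (λ u → count (Supports? i u) es ℕₚ.<? b) {xs = allFin s}
            (∈-take⁻ M poor u∈))))

    -- One half of `support` serves to find the clique of an exchange; the other half pays for the
    -- tiles lost to earlier exchanges, of which there are fewer than `cliqueSize`.
    support tileGroup : ℕ
    support   = cliqueSize + cliqueSize
    tileGroup = tileGroupSize k M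

    module _ (miss : Fin k → List (Fin s)) where

      -- A tile is tagged with the class whose leftover vertices it is meant to absorb.
      record State (r : ℕ) : Set where
        field
          tiles       : List (Fin k × Tuple k s)
          rest        : Fin k → List (Fin s)
          rest-length : ∀ j → length (rest j) ≡ r
          cliques     : ∀ {e} → e ∈ tiles → IsClique (proj₂ e)
          cover       : ∀ j → miss j ++ column j (map proj₂ tiles) ++ rest j ↭ allFin s

        cover! : ∀ j → Unique (miss j ++ column j (map proj₂ tiles) ++ rest j)
        cover! j = Unique-resp-↭ (↭-sym (cover j)) (Uniqueₚ.allFin⁺ s)

        tiles! : ∀ j → Unique (column j (map proj₂ tiles))
        tiles! j = Unique-++ˡ (Unique-++ʳ (miss j) (cover! j))

        rest! : ∀ j → Unique (rest j)
        rest! j = Unique-++ʳ (column j (map proj₂ tiles)) (Unique-++ʳ (miss j) (cover! j))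

      open State

      -- Tiles are added and never altered along `≼`, so the support of a vertex cannot drop.
      _≼_ : ∀ {r r′} → State r → State r′ → Set
      st ≼ st′ = (∃ λ new → tiles st′ ≡ new ++ tiles st) × (∀ j {x} → x ∈ rest st′ j → x ∈ rest st j)

      ≼-refl : ∀ {r} {st : State r} → st ≼ st
      ≼-refl = ([] , refl) , λ _ → id

      ≼-trans : ∀ {r r′ r″} {st : State r} {st′ : State r′} {st″ : State r″} → st ≼ st′ → st′ ≼ st″ → st ≼ st″
      ≼-trans {st = st} ((new , eq) , sub) ((new′ , eq′) , sub′) =
        (new′ ++ new , trans eq′ (trans (cong (new′ ++_) eq) (sym (Listₚ.++-assoc new′ new (tiles st)))))
        , λ j → sub j ∘ sub′ j

      abstract
        extend : ∀ {r} (st : State (suc r)) tag {c} → IsClique c → (∀ j → c j ∈ rest st j) →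
          Σ (State r) λ st′ → tiles st′ ≡ (tag , c) ∷ tiles st × st ≼ st′ × (∀ j → rest st j ↭ c j ∷ rest st′ j)
        extend st tag {c} clique c∈ = record
            { tiles       = (tag , c) ∷ tiles st
            ; rest        = λ j → proj₁ (∈⇒↭ (c∈ j))
            ; rest-length = λ j → ℕₚ.suc-injective (trans (sym (↭ₚ.↭-length (split j))) (rest-length st j))
            ; cliques     = λ { (here refl) → clique ; (there e∈) → cliques st e∈ }
            ; cover       = λ j → ↭-trans (↭ₚ.++⁺ˡ (miss j) (↭-trans
                (↭-sym (↭ₚ.shift (c j) (column j (map proj₂ (tiles st))) _)) (↭ₚ.++⁺ˡ _ (↭-sym (split j))))) (cover st j)
            }
          , refl , ((((tag , c) ∷ []) , refl) , λ j x∈ → ↭ₚ.∈-resp-↭ (↭-sym (split j)) (there x∈)) , split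
          where
          split : ∀ j → rest st j ↭ c j ∷ proj₁ (∈⇒↭ (c∈ j))
          split j = proj₂ (∈⇒↭ (c∈ j))

      abstract
        -- The last of these tiles is taken out of `suc r` vertices per class, hence the hypothesis
        -- on `cliqueSize`.
        greedy : ∀ tags {r} (st : State (length tags + r)) → cliqueSize ≤ suc r →
          Σ (State r) λ st′ → map proj₁ (tiles st′) ↭ tags ++ map proj₁ (tiles st)
        greedy []           st Q≤ = st , ↭-refl
        greedy (tag ∷ tags) {r} st Q≤
          with c , clique , c∈ ← transversalClique (rest st) (rest! st) (λ j → subst (cliqueSize ≤_) (sym (rest-length st j))
            (ℕₚ.≤-trans Q≤ (s≤s (ℕₚ.m≤n+m r (length tags)))))
          with st₁ , eq , _ ← extend st tag clique c∈
          with st₂ , tags↭ ← greedy tags st₁ Q≤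
          = st₂ , ↭-trans tags↭ (↭-trans (↭-reflexive (cong (λ es → tags ++ map proj₁ es) eq)) (↭ₚ.shift tag tags _))

      abstract
        fill : Fin k → ∀ r (st : State r) → ∃ λ r′ → r′ < cliqueSize × Σ (State r′) λ st′ → st ≼ st′
        fill tag zero    st = zero , s≤s z≤n , st , ≼-refl {st = st}
        fill tag (suc r) st with cliqueSize ℕₚ.≤? suc r
        ... | no ≰  = suc r , ℕₚ.≰⇒> ≰ , st , ≼-refl {st = st}
        ... | yes Q≤
          with c , clique , c∈ ← transversalClique (rest st) (rest! st) (λ j → subst (cliqueSize ≤_) (sym (rest-length st j)) Q≤)
          with st₁ , _ , st≼ , _ ← extend st tag clique c∈
          with r′ , r′< , st₂ , st₁≼ ← fill tag r st₁
          = r′ , r′< , st₂ , ≼-trans {st = st} {st₁} {st₂} st≼ st₁≼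

      module _ {d δ : ℕ} (miss-length : ∀ j → length (miss j) ≡ d)
        (degree : ∀ i u → u ∉ miss i → ∀ j → j ≢ i → δ ≤ count (Adj? i u j) (allFin s))
        (Q≤s : cliqueSize ≤ s) where

        -- A neighbour of `u` in class `j` is discarded, or the entry of a tile (one per tile), or
        -- still remaining.
        rest-degree : ∀ {r} (st : State r) {i u} → u ∈ rest st i → ∀ j → j ≢ i →
          δ ≤ d + (length (tiles st) + count (Adj? i u j) (rest st j))
        rest-degree st {i} {u} u∈ j j≢i = begin
          δ                                                              ≤⟨ degree i u u∉miss j j≢i ⟩
          count A? (allFin s)                                            ≡⟨ count-↭ A? (cover st j) ⟨
          count A? (miss j ++ col ++ rest st j)                          ≡⟨ count-++ A? (miss j) _ ⟩
          count A? (miss j) + count A? (col ++ rest st j)                ≡⟨ cong (count A? (miss j) +_) (count-++ A? col _) ⟩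
          count A? (miss j) + (count A? col + count A? (rest st j))      ≤⟨ ℕₚ.+-mono-≤
            (ℕₚ.≤-trans (count-≤-length A? (miss j)) (ℕₚ.≤-reflexive (miss-length j)))
            (ℕₚ.+-monoˡ-≤ _ (ℕₚ.≤-trans (count-≤-length A? col) (ℕₚ.≤-reflexive col-length))) ⟩
          d + (length (tiles st) + count A? (rest st j))                 ∎
          where
          open ℕₚ.≤-Reasoning
          A? : Decidable (Adj i u j)
          A? = Adj? i u j
          col : List (Fin s)
          col = column j (map proj₂ (tiles st))
          col-length : length col ≡ length (tiles st)
          col-length = trans (Listₚ.length-map _ (map proj₂ (tiles st))) (Listₚ.length-map proj₂ (tiles st))
          u∉miss : u ∉ miss i
          u∉miss u∈miss = disjoint (miss i) (cover! st i) u∈miss (∈ₚ.∈-++⁺ʳ _ u∈)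
            where
            disjoint : ∀ {A : Set} (xs : List A) {ys x} → Unique (xs ++ ys) → x ∈ xs → x ∉ ys
            disjoint (x ∷ xs) u (here refl) x∈ys = Uniqueₚ.Unique[x∷xs]⇒x∉xs u (∈ₚ.∈-++⁺ʳ xs x∈ys)
            disjoint (_ ∷ xs) (_ ∷ u) (there x∈) x∈ys = disjoint xs u x∈ x∈ys

        abstract
          -- A transversal clique within the neighbourhoods of `u` stays a clique when its vertex of
          -- class `i` is replaced by `u`.
          cliqueThrough : ∀ {r} (st : State r) {i u} → u ∈ rest st i →
            (∀ j → j ≢ i → cliqueSize ≤ count (Adj? i u j) (rest st j)) → ∃ λ c → IsClique c × c i ≡ u × (∀ j → c j ∈ rest st j)
          cliqueThrough st {i} {u} u∈ many = let
              c , clique , c∈ = transversalClique (λ j → candidates j (j Finₚ.≟ i))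
                (λ j → candidates! j (j Finₚ.≟ i)) (λ j → candidates-length j (j Finₚ.≟ i))
            in replace c i u
            , replace-clique clique (λ j j≢i → proj₂ (candidate j (j Finₚ.≟ i) j≢i (c∈ j)))
            , VFₚ.updateAt-updates i c
            , λ j → inRest c j (j Finₚ.≟ i) (c∈ j)
            where
            candidates : ∀ j → Dec (j ≡ i) → List (Fin s)
            -- The entry of class `i` is overwritten by `u`, so any long list will do there.
            candidates j (yes _) = allFin s
            candidates j (no  _) = filter (Adj? i u j) (rest st j)
            candidates! : ∀ j j≟i → Unique (candidates j j≟i)
            candidates! j (yes _) = Uniqueₚ.allFin⁺ s
            candidates! j (no  _) = Uniqueₚ.filter⁺ _ (rest! st j)
            candidates-length : ∀ j j≟i → cliqueSize ≤ length (candidates j j≟i)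
            candidates-length j (yes _)  = subst (cliqueSize ≤_) (sym (Listₚ.length-tabulate id)) Q≤s
            candidates-length j (no j≢i) = many j j≢i
            candidate : ∀ j j≟i → j ≢ i → ∀ {x} → x ∈ candidates j j≟i → x ∈ rest st j × Adj i u j x
            candidate j (yes j≡i) j≢i _  = contradiction j≡i j≢i
            candidate j (no _)    _   x∈ = ∈ₚ.∈-filter⁻ (Adj? i u j) x∈
            inRest : ∀ c j j≟i → c j ∈ candidates j j≟i → replace c i u j ∈ rest st j
            inRest c j (yes refl) _  = subst (_∈ rest st i) (sym (VFₚ.updateAt-updates i c)) u∈
            inRest c j (no j≢i)   c∈ = subst (_∈ rest st j) (sym (VFₚ.updateAt-minimal j i c j≢i)) (proj₁ (candidate j (no j≢i) j≢i c∈))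

        abstract
          -- A vertex of the list that is still uncovered receives a tile of its own. Every new tile
          -- shortens the list, so the sum in the budget does not grow, and by `rest-degree` the
          -- vertex has `cliqueSize` remaining neighbours in each other class.
          absorb : ∀ us {r} (st : State r) → d + (length (tiles st) + (length us + cliqueSize)) ≤ δ →
            ∃ λ r′ → Σ (State r′) λ st′ → st ≼ st′ × (∀ {i u} → (i , u) ∈ us → u ∉ rest st′ i)
          absorb []             st _ = _ , st , ≼-refl {st = st} , λ ()
          absorb ((i , u) ∷ us) {r} st budget with Any.any? (u Finₚ.≟_) (rest st i)
          ... | no u∉
            with r′ , st′ , st≼ , gone ← absorb us st (ℕₚ.≤-trans (ℕₚ.+-monoʳ-≤ d (ℕₚ.+-monoʳ-≤ _ (ℕₚ.n≤1+n _))) budget)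
            = r′ , st′ , st≼ , λ { (here refl) u∈ → u∉ (proj₂ st≼ i u∈) ; (there b∈) → gone b∈ }
          absorb ((i , u) ∷ us) {zero} st budget | yes u∈ = contradiction (rest-length st i) (ℕₚ.>⇒≢ (∈ₚ.∈-length u∈))
          absorb ((i , u) ∷ us) {suc r} st budget | yes u∈
            with c , clique , ci≡u , c∈ ← cliqueThrough st u∈ (λ j j≢i → ℕₚ.≤-trans (ℕₚ.m≤n+m _ (suc (length us)))
              (ℕₚ.+-cancelˡ-≤ (length (tiles st)) _ _ (ℕₚ.+-cancelˡ-≤ d _ _ (ℕₚ.≤-trans budget (rest-degree st u∈ j j≢i)))))
            with st₁ , eq , st≼ , split ← extend st i clique c∈
            with r′ , st′ , st₁≼ , gone ← absorb us st₁ (ℕₚ.≤-trans (ℕₚ.≤-reflexive (cong (d +_)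
              (trans (cong (λ es → length es + (length us + cliqueSize)) eq) (sym (ℕₚ.+-suc _ _))))) budget)
            = r′ , st′ , ≼-trans {st = st} {st₁} {st′} st≼ st₁≼
            , λ { (here refl) u∈′ → Uniqueₚ.Unique[x∷xs]⇒x∉xs (Unique-resp-↭ (split i) (rest! st i))
                    (subst (_∈ rest st₁ i) (sym ci≡u) (proj₂ st₁≼ i u∈′))
                ; (there b∈) → gone b∈ }

      module Exchange (es : List (Fin k × Tuple k s)) (es! : ∀ j → Unique (column j (map proj₂ es)))
        (es-cliques : ∀ {e} → e ∈ es → IsClique (proj₂ e)) (u c : Tuple k s)
        (supporter : ∀ i → ∃ λ e → e ∈ es × proj₂ e i ≡ c i × Supports i (u i) e) where

        entry : Fin k → Fin k × Tuple k s → Fin s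
        entry i e = proj₂ e i

        entry! : ∀ i → Unique (map (entry i) es)
        entry! i = subst Unique (sym (Listₚ.map-∘ es)) (es! i)

        isSupporter : ∀ i {e} → e ∈ es → entry i e ≡ c i → e ≡ proj₁ (supporter i)
        isSupporter i e∈ eq = let e′ , e′∈ , eq′ , _ = supporter i in
          Unique-map-injective (entry i) (entry! i) e∈ e′∈ (trans eq (sym eq′))

        swapBy : ∀ {tag t} → Dec (t tag ≡ c tag) → Tuple k s
        swapBy {tag} {t} (yes _) = replace t tag (u tag)
        swapBy {tag} {t} (no _)  = t

        -- A tile can change only at the class of its tag. As columns have no repetitions, the tiles
        -- with `t tag ≡ c tag` are exactly the chosen supporters.
        swapped : Fin k × Tuple k s → Fin k × Tuple k s
        swapped (tag , t) = tag , swapBy {tag} {t} (t tag Finₚ.≟ c tag)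

        swapped-clique : ∀ {e} → e ∈ map swapped es → IsClique (proj₂ e)
        swapped-clique e∈ with (tag , t) , e∈es , refl ← ∈ₚ.∈-map⁻ swapped e∈ with t tag Finₚ.≟ c tag
        ... | yes eq = replace-clique (es-cliques e∈es)
          (proj₂ (subst (Supports tag (u tag)) (sym (isSupporter tag e∈es eq)) (proj₂ (proj₂ (proj₂ (supporter tag))))))
        ... | no _   = es-cliques e∈es

        swapped-off : ∀ j {e} → e ∈ es → e ≢ proj₁ (supporter j) → entry j (swapped e) ≡ entry j e
        swapped-off j {tag , t} e∈ e≢ with t tag Finₚ.≟ c tag
        ... | no _   = refl
        ... | yes eq = VFₚ.updateAt-minimal j tag t λ { refl → e≢ (isSupporter tag e∈ eq) }

        swapped-on : ∀ j {e} → proj₁ e ≡ j → entry j e ≡ c j → entry j (swapped e) ≡ u j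
        swapped-on j {_ , t} refl eq with t j Finₚ.≟ c j
        ... | yes _ = VFₚ.updateAt-updates j t
        ... | no ≢  = contradiction eq ≢

        -- In class `j` only the supporter tagged `j` differs, where `u j` stands in place of `c j`.
        -- The freed vertex `c j` goes to the new tile.
        swapped-column : ∀ j → c j ∷ column j (map proj₂ (map swapped es)) ↭ u j ∷ column j (map proj₂ es)
        swapped-column j with e , e∈ , entry≡ , tag≡ , _ ← supporter j | off ← (λ {x} → swapped-off j {x})
          with zs , before , after ← map-exchange (entry j) (entry j ∘ swapped) (Uniqueₚ.map⁻ (entry! j)) e∈ off = begin
          c j ∷ column j (map proj₂ (map swapped es))
            ≡⟨ cong (c j ∷_) (trans (sym (Listₚ.map-∘ (map swapped es))) (sym (Listₚ.map-∘ es))) ⟩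
          c j ∷ map (entry j ∘ swapped) es     ↭⟨ ↭-prep (c j) after ⟩
          c j ∷ entry j (swapped e) ∷ zs       ≡⟨ cong₂ (λ x y → x ∷ y ∷ zs) (sym entry≡) (swapped-on j {e} tag≡ entry≡) ⟩
          entry j e ∷ u j ∷ zs                 ↭⟨ ↭-swap _ _ ↭-refl ⟩
          u j ∷ entry j e ∷ zs                 ↭⟨ ↭-prep (u j) before ⟨
          u j ∷ map (entry j) es               ≡⟨ cong (u j ∷_) (Listₚ.map-∘ es) ⟩
          u j ∷ column j (map proj₂ es)        ∎
          where open PermutationReasoning

        swapped-supports : ∀ i v {e} → Supports i v e → entry i e ≡ c i ⊎ Supports i v (swapped e)
        swapped-supports i v {tag , t} (refl , fits) with t tag Finₚ.≟ c tag
        ... | yes eq = inj₁ eq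
        ... | no _   = inj₂ (refl , fits)

        -- A tile tagged `i` changes only if its entry in class `i` is `c i`, which happens for at
        -- most one tile.
        swapped-count : ∀ i v → count (Supports? i v) es ≤ suc (count (Supports? i v) (map swapped es))
        swapped-count i v = ℕₚ.≤-trans
          (count-∪ (Supports? i v) (λ e → entry i e Finₚ.≟ c i) (Supports? i v ∘ swapped) (λ {e} → swapped-supports i v {e}) es)
          (ℕₚ.+-mono-≤ (count-≡-≤1 (entry i) (c i) (entry! i)) (ℕₚ.≤-reflexive (sym (count-map swapped (Supports? i v) es))))

      leftovers : ∀ {r} (st : State (suc r)) → ∃₂ λ u (rest′ : Fin k → List (Fin s)) → ∀ i → rest st i ≡ u i ∷ rest′ i
      leftovers st = (λ i → proj₁ (split i)) , (λ i → proj₁ (proj₂ (split i))) , λ i → proj₂ (proj₂ (split i))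
        where
        uncons : ∀ {A : Set} {n} (xs : List A) → length xs ≡ suc n → ∃₂ λ x ys → xs ≡ x ∷ ys
        uncons (x ∷ xs) _ = x , xs , refl
        split : ∀ i → ∃₂ λ x ys → rest st i ≡ x ∷ ys
        split i = uncons (rest st i) (rest-length st i)

      abstract
        supportedClique : ∀ {r} (st : State r) (u : Tuple k s) → (∀ i → cliqueSize ≤ count (Supports? i (u i)) (tiles st)) →
          ∃ λ c → IsClique c × (∀ i → ∃ λ e → e ∈ tiles st × proj₂ e i ≡ c i × Supports i (u i) e)
        supportedClique st u many = let
            c , clique , c∈ = transversalClique (λ i → map (λ e → proj₂ e i) (filter (Supports? i (u i)) (tiles st)))
              (λ i → Unique-map-filter _ (Supports? i (u i)) (subst Unique (sym (Listₚ.map-∘ (tiles st))) (tiles! st i)))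
              (λ i → subst (cliqueSize ≤_) (sym (Listₚ.length-map _ (filter (Supports? i (u i)) (tiles st)))) (many i))
          in c , clique , λ i → supporter i (c∈ i)
          where
          supporter : ∀ i {x} → x ∈ map (λ e → proj₂ e i) (filter (Supports? i (u i)) (tiles st)) →
            ∃ λ e → e ∈ tiles st × proj₂ e i ≡ x × Supports i (u i) e
          supporter i x∈ with e , e∈ , x≡ ← ∈ₚ.∈-map⁻ _ x∈
            with e∈tiles , supports ← ∈ₚ.∈-filter⁻ (Supports? i (u i)) {xs = tiles st} e∈ = e , e∈tiles , sym x≡ , supports

      -- One leftover vertex u i per class: the clique c consists of vertices which the leftovers can replace in their tiles.
      abstract
        exchange : ∀ {r} (st : State (suc r)) → (∀ {i u} → u ∈ rest st i → cliqueSize ≤ count (Supports? i u) (tiles st)) →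
          Fin k → Σ (State r) λ st′ → (∀ j {x} → x ∈ rest st′ j → x ∈ rest st j) ×
            (∀ i v → count (Supports? i v) (tiles st) ≤ suc (count (Supports? i v) (tiles st′)))
        exchange st rich tag₀ with u , rest′ , split ← leftovers st
          with c , clique , supporter ← supportedClique st u (λ i → rich (subst (u i ∈_) (sym (split i)) (here refl)))
          = record
            { tiles       = (tag₀ , c) ∷ map swapped (tiles st)
            ; rest        = rest′
            ; rest-length = λ j → ℕₚ.suc-injective (trans (sym (cong length (split j))) (rest-length st j))
            ; cliques     = λ { (here refl) → clique ; (there e∈) → swapped-clique e∈ }
            ; cover       = λ j → ↭-trans (↭ₚ.++⁺ˡ (miss j) (↭-trans (↭ₚ.++⁺ʳ (rest′ j) (swapped-column j))
                (↭-trans (↭-sym (↭ₚ.shift (u j) _ (rest′ j))) (↭ₚ.++⁺ˡ _ (↭-reflexive (sym (split j))))))) (cover st j)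
            }
          , (λ j x∈ → subst (_ ∈_) (sym (split j)) (there x∈))
          , λ i v → ℕₚ.≤-trans (swapped-count i v) (s≤s (count-++-≥ʳ (Supports? i v) ((tag₀ , c) ∷ []) _))
          where open Exchange (tiles st) (tiles! st) (cliques st) u c supporter

      -- There are `r` exchanges to come, each costing a vertex at most one supporting tile, so the
      -- surplus `r` over `cliqueSize` lasts to the end.
      finish : Fin k → ∀ r (st : State r) →
        (∀ {i u} → u ∈ rest st i → cliqueSize + r ≤ count (Supports? i u) (tiles st)) → State 0
      finish tag zero    st rich = st
      finish tag (suc r) st rich
        with st′ , sub , loss ← exchange st (λ u∈ → ℕₚ.≤-trans (ℕₚ.m≤m+n _ _) (rich u∈)) tag
        = finish tag r st′ λ {i} {u} u∈ → ℕₚ.≤-pred (ℕₚ.≤-trans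
            (ℕₚ.≤-trans (ℕₚ.≤-reflexive (sym (ℕₚ.+-suc cliqueSize r))) (rich (sub i u∈))) (loss i u))

      tags : List (Fin k)
      tags = concat (replicate tileGroup (allFin k))

      tags-length : length tags ≡ tileGroup * k
      tags-length = length-replicate-allFin k tileGroup

      tagged-count : ∀ {r} (st : State r) → map proj₁ (tiles st) ↭ tags → ∀ i → tileGroup ≤ count (tagged? i) (tiles st)
      tagged-count st tags↭ i = begin
        tileGroup                                   ≤⟨ ∈-replicate-count tileGroup i ⟩
        count (Finₚ._≟ i) tags                      ≡⟨ count-↭ (Finₚ._≟ i) tags↭ ⟨
        count (Finₚ._≟ i) (map proj₁ (tiles st))    ≡⟨ count-map proj₁ (Finₚ._≟ i) (tiles st) ⟩
        count (tagged? i) (tiles st)                ∎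
        where open ℕₚ.≤-Reasoning

      poor? : ∀ {r} (st : State r) i → Decidable (λ u → count (Supports? i u) (tiles st) < support)
      poor? st i u = count (Supports? i u) (tiles st) ℕₚ.<? support

      poor : ∀ {r} → State r → Fin k → List (Fin k × Fin s)
      poor st i = map (i ,_) (filter (poor? st i) (allFin s))

      poor-length : ∀ {r} (st : State r) → (∀ i → tileGroup ≤ count (tagged? i) (tiles st)) →
        length (concatMap (poor st) (allFin k)) ≤ k * M
      poor-length st many = ℕₚ.≤-trans (length-concatMap-≤ (poor st) M (allFin k) λ i → ℕₚ.≤-trans
          (ℕₚ.≤-reflexive (Listₚ.length-map (i ,_) (filter (poor? st i) (allFin s))))
          (ℕₚ.<⇒≤ (fewUnsupported support (tiles st) i (tiles! st) (many i))))
        (ℕₚ.≤-reflexive (cong (_* M) (length-allFin k)))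

      -- Vertices short of support in `st` no longer remain in `st′`, and the others keep their
      -- supporting tiles.
      support-≼ : ∀ {r r′} (st : State r) (st′ : State r′) → st ≼ st′ →
        (∀ {i u} → (i , u) ∈ concatMap (poor st) (allFin k) → u ∉ rest st′ i) →
        ∀ {i u} → u ∈ rest st′ i → support ≤ count (Supports? i u) (tiles st′)
      support-≼ st st′ ((new , eq) , _) gone {i} {u} u∈ = ℕₚ.≤-trans (ℕₚ.≮⇒≥ λ is-poor → gone
          (∈ₚ.∈-concat⁺′ (∈ₚ.∈-map⁺ (i ,_) (∈ₚ.∈-filter⁺ (poor? st i) (∈ₚ.∈-allFin u) is-poor)) (∈ₚ.∈-map⁺ (poor st) (∈ₚ.∈-allFin i))) u∈)
        (ℕₚ.≤-trans (count-++-≥ʳ (Supports? i u) new (tiles st)) (ℕₚ.≤-reflexive (cong (count (Supports? i u)) (sym eq))))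

      -- Counted in the single class `j`: nothing remains there, so the discarded vertices and one
      -- entry per tile exhaust it.
      complete-length : Fin k → ∀ {d} → (∀ j → length (miss j) ≡ d) → (st : State 0) → length (map proj₂ (tiles st)) ≡ s ∸ d
      complete-length j {d} miss-length st = begin
        length (map proj₂ (tiles st))                      ≡⟨ Listₚ.length-map _ (map proj₂ (tiles st)) ⟨
        length col                                         ≡⟨ ℕₚ.m+n∸m≡n d _ ⟨
        d + length col ∸ d                                 ≡⟨ cong (_∸ d) total ⟩
        s ∸ d                                              ∎
        where
        open ≡-Reasoning
        col : List (Fin s)
        col = column j (map proj₂ (tiles st))
        rest-empty : ∀ {xs : List (Fin s)} → length xs ≡ 0 → xs ≡ []
        rest-empty {[]} _ = refl
        total : d + length col ≡ s
        total = begin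
          d + length col                                   ≡⟨ cong₂ _+_ (miss-length j) (cong length (Listₚ.++-identityʳ col)) ⟨
          length (miss j) + length (col ++ [])             ≡⟨ Listₚ.length-++ (miss j) ⟨
          length (miss j ++ col ++ [])                     ≡⟨ cong (λ xs → length (miss j ++ col ++ xs)) (rest-empty (rest-length st j)) ⟨
          length (miss j ++ col ++ rest st j)              ≡⟨ ↭ₚ.↭-length (cover st j) ⟩
          length (allFin s)                                ≡⟨ Listₚ.length-tabulate id ⟩
          s                                                ∎

      kept-length : ∀ {d} (kept : Fin k → List (Fin s)) → (∀ j → length (miss j) ≡ d) →
        (∀ j → miss j ++ kept j ↭ allFin s) → ∀ j → length (kept j) ≡ s ∸ d
      kept-length {d} kept miss-length split j = begin
        length (kept j)                          ≡⟨ ℕₚ.m+n∸m≡n d _ ⟨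
        d + length (kept j) ∸ d                  ≡⟨ cong (λ n → n + length (kept j) ∸ d) (miss-length j) ⟨
        length (miss j) + length (kept j) ∸ d    ≡⟨ cong (_∸ d) (Listₚ.length-++ (miss j)) ⟨
        length (miss j ++ kept j) ∸ d            ≡⟨ cong (_∸ d) (↭ₚ.↭-length (split j)) ⟩
        length (allFin s) ∸ d                    ≡⟨ cong (_∸ d) (length-allFin _) ⟩
        s ∸ d                                    ∎
        where open ≡-Reasoning

      kept-size : ∀ {d} → d + (tileGroup * k + cliqueSize) ≤ s → s ∸ d ≡ length tags + (s ∸ d ∸ tileGroup * k)
      kept-size {d} room = trans (sym (ℕₚ.m+[n∸m]≡n (ℕₚ.≤-trans (ℕₚ.m≤m+n (tileGroup * k) cliqueSize) (m+n≤o⇒n≤o∸m d room))))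
        (cong (_+ (s ∸ d ∸ tileGroup * k)) (sym tags-length))

      tiling : Fin k → ∀ {d δ} (kept : Fin k → List (Fin s)) → (∀ j → length (miss j) ≡ d) →
        (∀ j → miss j ++ kept j ↭ allFin s) →
        (∀ i u → u ∉ miss i → ∀ j → j ≢ i → δ ≤ count (Adj? i u j) (allFin s)) →
        d + (tileGroup * k + (k * M + cliqueSize)) ≤ δ → d + (tileGroup * k + cliqueSize) ≤ s →
        ∃ λ ts → length ts ≡ s ∸ d × (∀ {t} → t ∈ ts → IsClique t) × (∀ j → Unique (column j ts))
      tiling i₀ {d} kept miss-length split degree budget room
        -- First, `tileGroup` tiles are reserved for every class.
        with st₁ , tags↭′ ← greedy tags {s ∸ d ∸ tileGroup * k} (record
               { tiles = [] ; rest = kept ; rest-length = λ j → trans (kept-length kept miss-length split j) (kept-size {d} room)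
               ; cliques = λ () ; cover = split })
               (ℕₚ.m≤n⇒m≤1+n (m+n≤o⇒n≤o∸m (tileGroup * k) (m+n≤o⇒n≤o∸m d room)))
        with tags↭ ← ↭-trans tags↭′ (↭-reflexive (Listₚ.++-identityʳ tags))
        -- Vertices short of support get tiles of their own. The budget accounts for the
        -- `tileGroup * k` tiles made so far and for at most `k * M` such vertices.
        with _ , st₂ , st₁≼st₂ , gone ← absorb miss-length degree (ℕₚ.m+n≤o⇒n≤o (tileGroup * k) (ℕₚ.m+n≤o⇒n≤o d room))
               (concatMap (poor st₁) (allFin k)) st₁
               (ℕₚ.≤-trans (ℕₚ.+-monoʳ-≤ d (ℕₚ.+-mono-≤
                 (ℕₚ.≤-reflexive (trans (sym (Listₚ.length-map proj₁ (tiles st₁))) (trans (↭ₚ.↭-length tags↭) tags-length)))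
                 (ℕₚ.+-monoˡ-≤ cliqueSize (poor-length st₁ (tagged-count st₁ tags↭))))) budget)
        -- Fewer than `cliqueSize` vertices per class survive this phase, so the surviving vertices
        -- have the support `cliqueSize + r` that `finish` demands.
        with r , r< , st₃ , st₂≼st₃ ← fill i₀ _ st₂
        with st₄ ← finish i₀ r st₃ (λ u∈ → ℕₚ.≤-trans (ℕₚ.+-monoʳ-≤ cliqueSize (ℕₚ.<⇒≤ r<))
               (support-≼ st₁ st₃ (≼-trans {st = st₁} {st₂} {st₃} st₁≼st₂ st₂≼st₃) (λ b∈ → gone b∈ ∘ proj₂ st₂≼st₃ _) u∈))
        = map proj₂ (tiles st₄) , complete-length i₀ miss-length st₄
        , (λ t∈ → let e , e∈ , eq = ∈ₚ.∈-map⁻ proj₂ t∈ in subst IsClique (sym eq) (cliques st₄ e∈)) , tiles! st₄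

-- Tournaments with a ranking of the vertices

module _ {A B : Set} (f : A → ℕ) (g : B → ℕ) where

  Ordered : Bool → A → B → Set
  Ordered true  x y = f x ≤ g y
  Ordered false x y = g y ≤ f x

  record Separated (m : ℕ) (xs : List A) (ys : List B) : Set₁ where
    field
      {P} : Pred A 0ℓ
      {Q} : Pred B 0ℓ
      P?  : Decidable P
      Q?  : Decidable Q
      P-size  : m ≤ count P? xs
      Q-size  : m ≤ count Q? ys
      side    : Bool
      ordered : ∀ {x y} → P x → Q y → Ordered side x y

  -- Both lists are cut at a common threshold, the cost being half of their guaranteed lengths.
  separate : ∀ m xs ys → m + m ≤ length xs → m + m ≤ length ys → Separated m xs ys
  -- At the threshold `top` all of `xs` is counted, which starts the descent.
  separate m xs ys xs-size ys-size = from top (inj₁ (ℕₚ.≤-trans (ℕₚ.m≤m+n m m) (ℕₚ.≤-trans xs-size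
    (ℕₚ.≤-reflexive (cong length (sym (Listₚ.filter-all (λ x → f x ℕₚ.≤? top) {xs} (All.tabulate bounded))))))))
    where
    top : ℕ
    top = List.foldr (λ x t → f x ℕ.⊔ t) 0 xs
    bounded : ∀ {x} → x ∈ xs → f x ≤ top
    bounded = go xs
      where
      go : ∀ xs {x} → x ∈ xs → f x ≤ List.foldr (λ x t → f x ℕ.⊔ t) 0 xs
      go (x ∷ xs) (here refl) = ℕₚ.m≤m⊔n (f x) _
      go (x ∷ xs) (there x∈)  = ℕₚ.≤-trans (go xs x∈) (ℕₚ.m≤n⊔m (f x) _)
    Reached : ℕ → Set
    Reached t = m ≤ count (λ x → f x ℕₚ.≤? t) xs ⊎ m ≤ count (λ y → g y ℕₚ.≤? t) ys
    reached? : ∀ t → Dec (Reached t)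
    reached? t = (m ℕₚ.≤? _) ⊎-dec (m ℕₚ.≤? _)
    above : ∀ {C : Set} (h : C → ℕ) t zs → m + m ≤ length zs → count (λ z → h z ℕₚ.≤? t) zs < m →
      m ≤ count (λ z → suc t ℕₚ.≤? h z) zs
    above h t zs size few = ℕₚ.+-cancelˡ-≤ m _ _ (begin
      m + m                                                                     ≤⟨ size ⟩
      length zs                                                                 ≡⟨ count-partition (λ z → h z ℕₚ.≤? t) zs ⟨
      count (λ z → h z ℕₚ.≤? t) zs + count (λ z → ¬? (h z ℕₚ.≤? t)) zs          ≤⟨ ℕₚ.+-mono-≤ (ℕₚ.<⇒≤ few)
        (count-mono (λ z → ¬? (h z ℕₚ.≤? t)) (λ z → suc t ℕₚ.≤? h z) ℕₚ.≰⇒> zs) ⟩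
      m + count (λ z → suc t ℕₚ.≤? h z) zs                                      ∎)
      where open ℕₚ.≤-Reasoning
    all-above-0 : ∀ {C : Set} (h : C → ℕ) zs → m + m ≤ length zs → m ≤ count (λ z → 0 ℕₚ.≤? h z) zs
    all-above-0 h zs size = ℕₚ.≤-trans (ℕₚ.m≤m+n m m) (ℕₚ.≤-trans size
      (ℕₚ.≤-reflexive (cong length (sym (Listₚ.filter-all (λ z → 0 ℕₚ.≤? h z) {zs} (All.universal (λ _ → z≤n) zs))))))
    -- At the least threshold reached by one of the lists, the other one has m elements above it.
    from : ∀ t → Reached t → Separated m xs ys
    from zero (inj₁ p) = record { P? = λ x → f x ℕₚ.≤? 0 ; Q? = λ y → 0 ℕₚ.≤? g y ; P-size = p
      ; Q-size = all-above-0 g ys ys-size ; side = true ; ordered = ℕₚ.≤-trans }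
    from zero (inj₂ q) = record { P? = λ x → 0 ℕₚ.≤? f x ; Q? = λ y → g y ℕₚ.≤? 0 ; P-size = all-above-0 f xs xs-size
      ; Q-size = q ; side = false ; ordered = flip ℕₚ.≤-trans }
    from (suc t) r with reached? t
    ... | yes r′ = from t r′
    from (suc t) (inj₁ p) | no ¬r = record { P? = λ x → f x ℕₚ.≤? suc t ; Q? = λ y → suc t ℕₚ.≤? g y ; P-size = p
      ; Q-size = above g t ys ys-size (ℕₚ.≰⇒> (¬r ∘ inj₂)) ; side = true ; ordered = ℕₚ.≤-trans }
    from (suc t) (inj₂ q) | no ¬r = record { P? = λ x → suc t ℕₚ.≤? f x ; Q? = λ y → g y ℕₚ.≤? suc t
      ; P-size = above f t xs xs-size (ℕₚ.≰⇒> (¬r ∘ inj₁)) ; Q-size = q ; side = false ; ordered = flip ℕₚ.≤-trans }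

Unique-map-local : ∀ {A B : Set} (f : A → B) {xs} → Unique xs →
  (∀ {x y} → x ∈ xs → y ∈ xs → f x ≡ f y → x ≡ y) → Unique (map f xs)
Unique-map-local f []       inj = []
Unique-map-local f (x∉ ∷ u) inj =
  Allₚ.map⁺ (All.tabulate λ y∈ eq → All.lookup x∉ y∈ (inj (here refl) (there y∈) eq)) ∷
  Unique-map-local f u (λ x∈ y∈ → inj (there x∈) (there y∈))

∈-take-++⁺ : ∀ {A : Set} n (xs : List A) {ys x} → length xs ≤ n → x ∈ xs → x ∈ take n (xs ++ ys)
∈-take-++⁺ (suc n) (_ ∷ _)  _         (here eq)  = here eq
∈-take-++⁺ (suc n) (_ ∷ xs) (s≤s len) (there x∈) = there (∈-take-++⁺ n xs len x∈)

module _ {k s : ℕ} (Arc : Fin k → Fin s → Fin k → Fin s → Set) where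

  Directed : Bool → Fin k → Fin s → Fin k → Fin s → Set
  Directed true  i x j y = Arc i x j y
  Directed false i x j y = Arc j y i x

  -- No rank occurs here. Quantifying over the directions `σ` makes the property depend on the
  -- orientation alone, so a union bound can ensure it before the feedback arc set is chosen.
  Mixing : ℕ → Set
  Mixing m = ∀ i (B : Fin m → Fin s) (T : Fin m → Tuple k s) (σ : Fin k → Bool) →
    (∀ {a b} → B a ≡ B b → a ≡ b) → (∀ {j} → j ≢ i → ∀ {a b} → T a j ≡ T b j → a ≡ b) →
    ∃₂ λ a b → ∀ j → j ≢ i → Directed (σ j) i (B a) j (T b j)

  -- One middle vertex in every block replaces a count of middle vertices: disjoint blocks give `d`
  -- different ones, and the failure of a single block is an intersection of independent events.
  Connecting : ∀ {d β} → (Fin d → Fin β → Fin s) → Set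
  Connecting {d} block = ∀ i j x x′ → i ≢ j → x ≢ x′ → ∀ (b : Fin d) → ∃ λ l → Arc i x j (block b l) × Arc j (block b l) i x′

module RankedTournament {k s : ℕ} (Arc : Fin k → Fin s → Fin k → Fin s → Set)
  (Arc? : ∀ i x j y → Dec (Arc i x j y))
  (ρ : Fin k → Fin s → ℕ) (ρ-injective : ∀ {i x j y} → ρ i x ≡ ρ j y → i ≡ j) where

  Adj : Fin k → Fin s → Fin k → Fin s → Set
  Adj i x j y = (Arc i x j y × ρ i x < ρ j y) ⊎ (Arc j y i x × ρ j y < ρ i x)

  Adj? : ∀ i x j y → Dec (Adj i x j y)
  Adj? i x j y = (Arc? i x j y ×-dec (ρ i x ℕₚ.<? ρ j y)) ⊎-dec (Arc? j y i x ×-dec (ρ j y ℕₚ.<? ρ i x))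

  Adj-sym : ∀ {i x j y} → Adj i x j y → Adj j y i x
  Adj-sym = [ inj₂ , inj₁ ]′

  open Tiling Adj Adj? Adj-sym

  -- Ranks of vertices in different classes differ, so the weak inequality is strict.
  directed⇒Adj : ∀ σ {i x j y} → i ≢ j → Ordered (ρ i) (ρ j) σ x y → Directed Arc σ i x j y → Adj i x j y
  directed⇒Adj true  i≢j ≤ arc = inj₁ (arc , ℕₚ.≤∧≢⇒< ≤ (i≢j ∘ ρ-injective))
  directed⇒Adj false i≢j ≤ arc = inj₂ (arc , ℕₚ.≤∧≢⇒< ≤ (i≢j ∘ sym ∘ ρ-injective))

  double : ∀ a m → a * m + a * m ≡ (2 * a) * m
  double = solve-∀

  -- One application of `separate` per class of `js`, each halving both families. Passing to
  -- subfamilies preserves the orders found before.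
  separateAll : ∀ m i js us ts → Unique us → (∀ j → j ≢ i → Unique (column j ts)) →
    2 ^ length js * m ≤ length us → 2 ^ length js * m ≤ length ts →
    ∃₂ λ us′ ts′ → Unique us′ × (∀ j → j ≢ i → Unique (column j ts′)) × m ≤ length us′ × m ≤ length ts′ ×
      (∀ {u} → u ∈ us′ → u ∈ us) × (∀ {t} → t ∈ ts′ → t ∈ ts) ×
      ∃ λ (σ : Fin k → Bool) → ∀ {j u t} → j ∈ js → u ∈ us′ → t ∈ ts′ → Ordered (ρ i) (ρ j) (σ j) u (t j)
  separateAll m i []       us ts us! ts! m≤us m≤ts = us , ts , us! , ts!
    , ℕₚ.≤-trans (ℕₚ.m≤m+n m 0) m≤us , ℕₚ.≤-trans (ℕₚ.m≤m+n m 0) m≤ts , id , id , (λ _ → true) , λ ()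
  separateAll m i (j ∷ js) us ts us! ts! m≤us m≤ts
    with sep ← separate (ρ i) (λ t → ρ j (t j)) (2 ^ length js * m) us ts
      (ℕₚ.≤-trans (ℕₚ.≤-reflexive (double (2 ^ length js) m)) m≤us) (ℕₚ.≤-trans (ℕₚ.≤-reflexive (double (2 ^ length js) m)) m≤ts)
    with us′ , ts′ , us′! , ts′! , us′-size , ts′-size , us′⊆ , ts′⊆ , σ , ord ←
      separateAll m i js (filter (Separated.P? sep) us) (filter (Separated.Q? sep) ts)
        (Uniqueₚ.filter⁺ (Separated.P? sep) us!) (λ l l≢i → Unique-map-filter _ (Separated.Q? sep) (ts! l l≢i))
        (Separated.P-size sep) (Separated.Q-size sep)
    = us′ , ts′ , us′! , ts′! , us′-size , ts′-size
    , (λ u∈ → proj₁ (∈ₚ.∈-filter⁻ P? {xs = us} (us′⊆ u∈))) , (λ t∈ → proj₁ (∈ₚ.∈-filter⁻ Q? {xs = ts} (ts′⊆ t∈)))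
    , (λ l → sign σ (l Finₚ.≟ j)) , λ {l} l∈ u∈ t∈ → ordered′ σ l∈ (l Finₚ.≟ j)
        (λ l≡j → headOrdered (proj₂ (∈ₚ.∈-filter⁻ P? {xs = us} (us′⊆ u∈))) (proj₂ (∈ₚ.∈-filter⁻ Q? {xs = ts} (ts′⊆ t∈))))
        (λ l∈js → ord l∈js u∈ t∈)
    where
    open Separated sep renaming (ordered to headOrdered)
    sign : (Fin k → Bool) → ∀ {l} → Dec (l ≡ j) → Bool
    sign σ     (yes _) = side
    sign σ {l} (no _)  = σ l
    ordered′ : ∀ σ {l u t} → l ∈ j ∷ js → (l≟j : Dec (l ≡ j)) →
      (l ≡ j → Ordered (ρ i) (λ t → ρ j (t j)) side u t) → (l ∈ js → Ordered (ρ i) (ρ l) (σ l) u (t l)) →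
      Ordered (ρ i) (ρ l) (sign σ l≟j) u (t l)
    ordered′ σ l∈ (yes refl) head tail = coerce side (head refl)
      where
      coerce : ∀ b {u t} → Ordered (ρ i) (λ (t : Tuple k s) → ρ j (t j)) b u t → Ordered (ρ i) (ρ j) b u (t j)
      coerce true  = id
      coerce false = id
    ordered′ σ (here l≡j) (no l≢j) head tail = contradiction l≡j l≢j
    ordered′ σ (there l∈) (no l≢j) head tail = tail l∈

  map-lookup-injective : ∀ j (ts : List (Tuple k s)) → Unique (column j ts) →
    ∀ {a b} → List.lookup ts a j ≡ List.lookup ts b j → a ≡ b
  map-lookup-injective j ts ts! eq = lookup-injective (Uniqueₚ.map⁻ ts!)
    (Unique-map-injective (λ t → t j) ts! (∈ₚ.∈-lookup _) (∈ₚ.∈-lookup _) eq)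

  -- After separation the rank compares every `u` with every `t j` in the same way, for each `j`.
  -- This determines the pattern `σ` of rising arcs, and `Mixing` realises it.
  mixing⇒swappable : ∀ {m} → Mixing Arc m → Swappable (2 ^ k * m)
  mixing⇒swappable {m} mixing i us ts us! us-size ts! ts-size
    with us′ , ts′ , us′! , ts′! , us′-size , ts′-size , us′⊆ , ts′⊆ , σ , ord ← separateAll m i (allFin k) us ts us! ts!
      (subst (λ n → 2 ^ n * m ≤ length us) (sym (length-allFin k)) us-size)
      (subst (λ n → 2 ^ n * m ≤ length ts) (sym (length-allFin k)) ts-size)
    with a , b , directed ← mixing i (λ a → List.lookup us′ (inject≤ a us′-size)) (λ b → List.lookup ts′ (inject≤ b ts′-size)) σ
      (λ eq → Finₚ.inject≤-injective _ _ _ _ (lookup-injective us′! eq))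
      (λ {j} j≢i eq → Finₚ.inject≤-injective _ _ _ _ (map-lookup-injective j ts′ (ts′! j j≢i) eq))
    = _ , _ , us′⊆ (∈ₚ.∈-lookup _) , ts′⊆ (∈ₚ.∈-lookup _)
    , λ j j≢i → directed⇒Adj (σ j) (j≢i ∘ sym) (ord (∈ₚ.∈-allFin j) (∈ₚ.∈-lookup _) (∈ₚ.∈-lookup _)) (directed j j≢i)

  module _ {δ β : ℕ} (block : Fin (δ + δ) → Fin β → Fin s)
    (block-disjoint : ∀ {a b l l′} → block a l ≡ block b l′ → a ≡ b) (connecting : Connecting Arc block) where

    degree : Fin k → Fin s → Fin k → ℕ
    degree i x j = count (Adj? i x j) (allFin s)

    -- If `y` does not rank above `x`, then it ranks below `x′`, and the arc `y → x′` rises instead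
    -- of `x → y`.
    middle-Adj : ∀ {i j x x′ y} → i ≢ j → ρ i x ≤ ρ i x′ → Arc i x j y → Arc j y i x′ → Adj i x j y ⊎ Adj i x′ j y
    middle-Adj {i} {j} {x} {x′} {y} i≢j ≤ x→y y→x′ with ρ i x ℕₚ.<? ρ j y
    ... | yes < = inj₁ (inj₁ (x→y , <))
    ... | no ≮  = inj₂ (inj₂ (y→x′ , ℕₚ.≤∧≢⇒< (ℕₚ.≤-trans (ℕₚ.≮⇒≥ ≮) ≤) (i≢j ∘ sym ∘ ρ-injective)))

    -- The `δ + δ` disjoint blocks give as many different middle vertices, each adjacent to `x` or
    -- to `x′`.
    degree-sum : ∀ {i j x x′} → i ≢ j → x ≢ x′ → ρ i x ≤ ρ i x′ → δ + δ ≤ degree i x j + degree i x′ j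
    degree-sum {i} {j} {x} {x′} i≢j x≢x′ ρ≤ = begin
      δ + δ                                                       ≡⟨ length-allFin (δ + δ) ⟨
      length (allFin (δ + δ))                                     ≡⟨ Listₚ.length-map mid (allFin (δ + δ)) ⟨
      length (map mid (allFin (δ + δ)))                           ≤⟨ Unique-⊆-length (Uniqueₚ.map⁺ block-disjoint (Uniqueₚ.allFin⁺ (δ + δ))) mid∈ ⟩
      count A? (allFin s)                                         ≤⟨ count-∪ A? (Adj? i x j) (Adj? i x′ j) id (allFin s) ⟩
      degree i x j + degree i x′ j                                ∎
      where
      open ℕₚ.≤-Reasoning
      A? : Decidable (λ y → Adj i x j y ⊎ Adj i x′ j y)
      A? y = Adj? i x j y ⊎-dec Adj? i x′ j y
      mid : Fin (δ + δ) → Fin s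
      mid b = block b (proj₁ (connecting i j x x′ i≢j x≢x′ b))
      mid∈ : ∀ {y} → y ∈ map mid (allFin (δ + δ)) → y ∈ filter A? (allFin s)
      mid∈ y∈ with b , _ , refl ← ∈ₚ.∈-map⁻ mid y∈ = let _ , x→y , y→x′ = connecting i j x x′ i≢j x≢x′ b in
        ∈ₚ.∈-filter⁺ A? (∈ₚ.∈-allFin _) (middle-Adj i≢j ρ≤ x→y y→x′)

    -- Two different vertices of degree below `δ` would violate `degree-sum`, applied with the
    -- lower-ranked one first.
    lowDegree-unique : ∀ {i j x x′} → i ≢ j → degree i x j < δ → degree i x′ j < δ → x ≡ x′
    lowDegree-unique {i} {j} {x} {x′} i≢j x< x′< = decidable-stable (x Finₚ.≟ x′) λ x≢x′ →
      [ (λ ≤ → ℕₚ.<⇒≱ (ℕₚ.+-mono-< x< x′<) (degree-sum i≢j x≢x′ ≤))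
      , (λ ≤ → ℕₚ.<⇒≱ (ℕₚ.+-mono-< x′< x<) (degree-sum i≢j (x≢x′ ∘ sym) ≤)) ]′ (ℕₚ.≤-total (ρ i x) (ρ i x′))

    Deficient : Fin k → Fin s → Set
    Deficient i x = ∃ λ j → j ≢ i × degree i x j < δ

    deficient? : ∀ i → Decidable (Deficient i)
    deficient? i x = Finₚ.any? λ j → ¬? (j Finₚ.≟ i) ×-dec (degree i x j ℕₚ.<? δ)

    -- Sending a deficient vertex to a class towards which its degree is low is injective by
    -- `lowDegree-unique` and omits `i`.
    fewDeficient : ∀ i → count (deficient? i) (allFin s) < k
    fewDeficient i = begin
      suc (length xs)                      ≡⟨ cong suc (Listₚ.length-map witness xs) ⟨
      -- The omitted class `i`, put in front, makes the bound strict.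
      length (i ∷ map witness xs)          ≤⟨ Unique-⊆-length (Allₚ.map⁺ (All.tabulate λ x∈ eq → proj₁ (witness-low x∈) (sym eq)) ∷
        Unique-map-local witness (Uniqueₚ.filter⁺ (deficient? i) (Uniqueₚ.allFin⁺ s)) witness-injective) (λ _ → ∈ₚ.∈-allFin _) ⟩
      length (allFin k)                    ≡⟨ length-allFin k ⟩
      k                                    ∎
      where
      open ℕₚ.≤-Reasoning
      xs : List (Fin s)
      xs = filter (deficient? i) (allFin s)
      witnessOf : ∀ {x} → Dec (Deficient i x) → Fin k
      witnessOf (yes (j , _)) = j
      witnessOf (no _)        = i
      witness : Fin s → Fin k
      witness x = witnessOf (deficient? i x)
      witnessOf-low : ∀ {x} (d : Dec (Deficient i x)) → Deficient i x → witnessOf d ≢ i × degree i x (witnessOf d) < δ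
      witnessOf-low (yes (_ , low)) _ = low
      witnessOf-low (no ¬d)         d = contradiction d ¬d
      witness-low : ∀ {x} → x ∈ xs → witness x ≢ i × degree i x (witness x) < δ
      witness-low {x} x∈ = witnessOf-low (deficient? i x) (proj₂ (∈ₚ.∈-filter⁻ (deficient? i) {xs = allFin s} x∈))
      witness-injective : ∀ {x y} → x ∈ xs → y ∈ xs → witness x ≡ witness y → x ≡ y
      witness-injective {x} {y} x∈ y∈ eq = lowDegree-unique (proj₁ (witness-low x∈) ∘ sym) (proj₂ (witness-low x∈))
        (subst (λ j → degree i y j < δ) (sym eq) (proj₂ (witness-low y∈)))

    -- The deficient vertices come first, so that the first `k ∸ 1` vertices, which are discarded,
    -- include them all.
    partition : Fin k → List (Fin s)
    partition i = filter (deficient? i) (allFin s) ++ filter (¬? ∘ deficient? i) (allFin s)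

    disjointCliques : ∀ {m} (mixing : Mixing Arc m) → let M = 2 ^ k * m ; swap = mixing⇒swappable mixing in
      Fin k → k ∸ 1 + (tileGroup swap * k + (k * M + cliqueSize swap)) ≤ δ → δ ≤ s →
      ∃ λ ts → length ts ≡ s ∸ (k ∸ 1) × (∀ {t} → t ∈ ts → IsClique t) × (∀ j → Unique (column j ts))
    disjointCliques {m} mixing i₀ budget δ≤s = tiling (mixing⇒swappable mixing) miss i₀ kept miss-length split degree-≥ budget
      (ℕₚ.≤-trans (ℕₚ.+-monoʳ-≤ (k ∸ 1) (ℕₚ.+-monoʳ-≤ (T * k) (ℕₚ.m≤n+m Q (k * (2 ^ k * m))))) (ℕₚ.≤-trans budget δ≤s))
      where
      Q T : ℕ
      Q = cliqueSize (mixing⇒swappable mixing)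
      T = tileGroup (mixing⇒swappable mixing)
      miss kept : Fin k → List (Fin s)
      miss i = take (k ∸ 1) (partition i)
      kept i = drop (k ∸ 1) (partition i)
      partition↭ : ∀ i → partition i ↭ allFin s
      partition↭ i = filter-partition (deficient? i) (allFin s)
      split : ∀ i → miss i ++ kept i ↭ allFin s
      split i = ↭-trans (↭-reflexive (Listₚ.take++drop≡id (k ∸ 1) (partition i))) (partition↭ i)
      miss-length : ∀ i → length (miss i) ≡ k ∸ 1
      miss-length i = trans (Listₚ.length-take (k ∸ 1) (partition i)) (ℕₚ.m≤n⇒m⊓n≡m
        (ℕₚ.≤-trans (ℕₚ.≤-trans (ℕₚ.m+n≤o⇒m≤o (k ∸ 1) budget) δ≤s)
          (ℕₚ.≤-reflexive (sym (trans (↭ₚ.↭-length (partition↭ i)) (length-allFin s))))))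
      degree-≥ : ∀ i u → u ∉ miss i → ∀ j → j ≢ i → δ ≤ degree i u j
      degree-≥ i u u∉ j j≢i = ℕₚ.≮⇒≥ λ low → u∉ (∈-take-++⁺ (k ∸ 1) _ (ℕₚ.<⇒≤pred (fewDeficient i))
        (∈ₚ.∈-filter⁺ (deficient? i) (∈ₚ.∈-allFin u) (j , j≢i , low)))

-- Counting bit vectors

-- This is `2 ^ m` times the probability of `p`. With the recursion over the bits, flipping a bit is
-- an exchange of two summands.
size : ∀ {m} → (Vec Bool m → Bool) → ℕ
size {zero}  p = if p [] then 1 else 0
size {suc m} p = size (p ∘ (true ∷_)) + size (p ∘ (false ∷_))

size-cong : ∀ {m} {p q : Vec Bool m → Bool} → (∀ ω → p ω ≡ q ω) → size p ≡ size q
size-cong {zero}  h = cong (if_then 1 else 0) (h [])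
size-cong {suc m} h = cong₂ _+_ (size-cong (h ∘ (true ∷_))) (size-cong (h ∘ (false ∷_)))

size-true : ∀ m → size {m} (const true) ≡ 2 ^ m
size-true zero    = refl
size-true (suc m) = cong₂ _+_ (size-true m) (trans (size-true m) (sym (ℕₚ.+-identityʳ _)))

size-split : ∀ {m} (p q : Vec Bool m → Bool) → size (λ ω → p ω ∧ q ω) + size (λ ω → p ω ∧ not (q ω)) ≡ size p
size-split {zero}  p q with p [] | q []
... | true  | true  = refl
... | true  | false = refl
... | false | _     = refl
size-split {suc m} p q = trans (interchange (size (λ ω → p (true ∷ ω) ∧ q (true ∷ ω))) _ _ _)
  (cong₂ _+_ (size-split (p ∘ (true ∷_)) (q ∘ (true ∷_))) (size-split (p ∘ (false ∷_)) (q ∘ (false ∷_))))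
  where
  interchange : ∀ a b c d → (a + b) + (c + d) ≡ (a + c) + (b + d)
  interchange = solve-∀

size-∨ : ∀ {m} (p q : Vec Bool m → Bool) → size (λ ω → p ω ∨ q ω) ≤ size p + size q
size-∨ {zero}  p q with p [] | q []
... | true  | true  = s≤s z≤n
... | true  | false = s≤s z≤n
... | false | true  = s≤s z≤n
... | false | false = z≤n
size-∨ {suc m} p q = ℕₚ.≤-trans (ℕₚ.+-mono-≤ (size-∨ (p ∘ (true ∷_)) _) (size-∨ (p ∘ (false ∷_)) _))
  (ℕₚ.≤-reflexive (interchange (size (p ∘ (true ∷_))) _ _ _))
  where
  interchange : ∀ a b c d → (a + b) + (c + d) ≡ (a + c) + (b + d)
  interchange = solve-∀

size-false : ∀ m → size {m} (const false) ≡ 0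
size-false zero    = refl
size-false (suc m) = cong₂ _+_ (size-false m) (size-false m)

flipAt : ∀ {m} → Fin m → Vec Bool m → Vec Bool m
flipAt e ω = Vec.updateAt ω e not

size-flip : ∀ {m} (e : Fin m) (p : Vec Bool m → Bool) → size (p ∘ flipAt e) ≡ size p
size-flip zero    p = ℕₚ.+-comm (size (p ∘ (false ∷_))) _
size-flip (suc e) p = cong₂ _+_ (size-flip e (p ∘ (true ∷_))) (size-flip e (p ∘ (false ∷_)))

-- Independence of the bit `e`, expressed as invariance under flipping it.
IgnoresBit : ∀ {m} → Fin m → (Vec Bool m → Bool) → Set
IgnoresBit e p = ∀ ω → p (flipAt e ω) ≡ p ω

bitIs : ∀ {m} → Fin m → Bool → Vec Bool m → Bool
bitIs e b ω = does (lookup ω e Bool.≟ b)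

bitIs-flip : ∀ {m} (e : Fin m) b ω → bitIs e b (flipAt e ω) ≡ not (bitIs e b ω)
bitIs-flip e b ω rewrite Vecₚ.lookup∘updateAt e {not} ω with lookup ω e | b
... | true  | true  = refl
... | true  | false = refl
... | false | true  = refl
... | false | false = refl

bitIs-ignores : ∀ {m} {e e′ : Fin m} b → e ≢ e′ → IgnoresBit e′ (bitIs e b)
bitIs-ignores {e = e} {e′} b e≢e′ ω = cong (λ v → does (v Bool.≟ b)) (Vecₚ.lookup∘updateAt′ e e′ e≢e′ ω)

∧-ignores : ∀ {m} {e : Fin m} {p q} → IgnoresBit e p → IgnoresBit e q → IgnoresBit e (λ ω → p ω ∧ q ω)
∧-ignores p q ω = cong₂ _∧_ (p ω) (q ω)

-- Flipping the bit `e` carries the vectors of `p` with one value of this bit onto those with the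
-- other.
size-half : ∀ {m} (e : Fin m) b {p} → IgnoresBit e p → size (λ ω → p ω ∧ bitIs e b ω) * 2 ≡ size p
size-half e b {p} ign = begin
  size q * 2                                                          ≡⟨ double (size q) ⟩
  size q + size q                                                     ≡⟨ cong (size q +_) (size-flip e q) ⟨
  size q + size (q ∘ flipAt e)                                        ≡⟨ cong (size q +_) (size-cong λ ω → cong₂ _∧_ (ign ω) (bitIs-flip e b ω)) ⟩
  size q + size (λ ω → p ω ∧ not (bitIs e b ω))                       ≡⟨ size-split p (bitIs e b) ⟩
  size p                                                              ∎
  where
  open ≡-Reasoning
  q : Vec Bool _ → Bool
  q ω = p ω ∧ bitIs e b ω
  double : ∀ a → a * 2 ≡ a + a
  double = solve-∀

matches : ∀ {m g} → (Fin g → Fin m) → (Fin g → Bool) → Vec Bool m → Bool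
matches {g = zero}  c b ω = true
matches {g = suc g} c b ω = bitIs (c zero) (b zero) ω ∧ matches (c ∘ suc) (b ∘ suc) ω

matches-ignores : ∀ {m g} {c : Fin g → Fin m} {b e} → (∀ l → c l ≢ e) → IgnoresBit e (matches c b)
matches-ignores {g = zero}  _   ω = refl
matches-ignores {g = suc g} {c} {b} {e} c≢e ω = cong₂ _∧_ (bitIs-ignores (b zero) (c≢e zero) ω) (matches-ignores {c = c ∘ suc} {b ∘ suc} (c≢e ∘ suc) ω)

matches-true : ∀ {m g} (c : Fin g → Fin m) b ω → matches c b ω ≡ true → ∀ l → lookup ω (c l) ≡ b l
matches-true {g = suc g} c b ω eq l with lookup ω (c zero) Bool.≟ b zero
matches-true {g = suc g} c b ω eq zero    | yes p = p
matches-true {g = suc g} c b ω eq (suc l) | yes p = matches-true (c ∘ suc) (b ∘ suc) ω eq l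

-- The prescribed bits are imposed one by one; as `c` is injective, each is independent of those
-- imposed earlier and halves the size.
size-matches : ∀ {m g} (c : Fin g → Fin m) b {p} → (∀ {l l′} → c l ≡ c l′ → l ≡ l′) → (∀ l → IgnoresBit (c l) p) →
  size (λ ω → p ω ∧ matches c b ω) * 2 ^ g ≡ size p
size-matches {g = zero}  c b {p} inj ign = trans (ℕₚ.*-identityʳ _) (size-cong λ ω → Boolₚ.∧-identityʳ (p ω))
size-matches {g = suc g} c b {p} inj ign = begin
  size (λ ω → p ω ∧ matches c b ω) * (2 * 2 ^ g)                                          ≡⟨ cong (_* (2 * 2 ^ g))
    (size-cong λ ω → sym (Boolₚ.∧-assoc (p ω) _ _)) ⟩
  size (λ ω → (p ω ∧ bitIs (c zero) (b zero) ω) ∧ matches (c ∘ suc) (b ∘ suc) ω) * (2 * 2 ^ g)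
    ≡⟨ shuffle (size (λ ω → (p ω ∧ bitIs (c zero) (b zero) ω) ∧ matches (c ∘ suc) (b ∘ suc) ω)) (2 ^ g) ⟩
  size (λ ω → (p ω ∧ bitIs (c zero) (b zero) ω) ∧ matches (c ∘ suc) (b ∘ suc) ω) * 2 ^ g * 2
    ≡⟨ cong (_* 2) (size-matches (c ∘ suc) (b ∘ suc) (Finₚ.suc-injective ∘ inj)
         (λ l → ∧-ignores (ign (suc l)) (bitIs-ignores (b zero) λ eq → Finₚ.0≢1+n (inj eq)))) ⟩
  size (λ ω → p ω ∧ bitIs (c zero) (b zero) ω) * 2                                        ≡⟨ size-half (c zero) (b zero) (ign zero) ⟩
  size p                                                                                  ∎
  where
  open ≡-Reasoning
  shuffle : ∀ a x → a * (2 * x) ≡ a * x * 2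
  shuffle = solve-∀

noneMatches : ∀ {m w g} → (Fin w → Fin g → Fin m) → (Fin w → Fin g → Bool) → Vec Bool m → Bool
noneMatches {w = zero}  c b ω = true
noneMatches {w = suc w} c b ω = noneMatches (c ∘ suc) (b ∘ suc) ω ∧ not (matches (c zero) (b zero) ω)

noneMatches-ignores : ∀ {m w g} {c : Fin w → Fin g → Fin m} {b e} → (∀ a l → c a l ≢ e) → IgnoresBit e (noneMatches c b)
noneMatches-ignores {w = zero}  _   ω = refl
noneMatches-ignores {w = suc w} {c = c} {b} {e} c≢e ω = cong₂ _∧_
  (noneMatches-ignores {c = c ∘ suc} {b ∘ suc} (c≢e ∘ suc) ω) (cong not (matches-ignores {c = c zero} {b zero} (c≢e zero) ω))

noneMatches-false : ∀ {m w g} (c : Fin w → Fin g → Fin m) b ω → noneMatches c b ω ≡ false →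
  ∃ λ a → ∀ l → lookup ω (c a l) ≡ b a l
noneMatches-false {w = suc w} c b ω eq with noneMatches (c ∘ suc) (b ∘ suc) ω in rest | matches (c zero) (b zero) ω in first
... | false | _    = let a , h = noneMatches-false (c ∘ suc) (b ∘ suc) ω rest in suc a , h
... | true  | true = zero , matches-true (c zero) (b zero) ω first

-- The patterns occupy disjoint sets of bits, so they are missed independently, each with
-- probability `y / 2 ^ g`.
size-noneMatches : ∀ {m w g y} (c : Fin w → Fin g → Fin m) b → (∀ {a l a′ l′} → c a l ≡ c a′ l′ → a ≡ a′ × l ≡ l′) →
  2 ^ g ≡ suc y → size (noneMatches c b) * (2 ^ g) ^ w ≡ y ^ w * 2 ^ m
size-noneMatches {m} {zero}  {g} {y} c b inj eq = trans (ℕₚ.*-identityʳ _) (trans (size-true m) (sym (ℕₚ.+-identityʳ _)))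
size-noneMatches {m} {suc w} {g} {y} c b inj eq = begin
  size (noneMatches c b) * (X * X ^ w)       ≡⟨ ℕₚ.*-assoc (size (noneMatches c b)) X _ ⟨
  size (noneMatches c b) * X * X ^ w         ≡⟨ cong (_* X ^ w) step ⟩
  (y * size rest) * X ^ w                    ≡⟨ ℕₚ.*-assoc y (size rest) _ ⟩
  y * (size rest * X ^ w)                    ≡⟨ cong (y *_) (size-noneMatches (c ∘ suc) (b ∘ suc) inj′ eq) ⟩
  y * (y ^ w * 2 ^ m)                        ≡⟨ ℕₚ.*-assoc y (y ^ w) _ ⟨
  y ^ suc w * 2 ^ m                          ∎
  where
  open ≡-Reasoning
  X : ℕ
  X = 2 ^ g
  rest first : Vec Bool m → Bool
  rest  = noneMatches (c ∘ suc) (b ∘ suc)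
  first = matches (c zero) (b zero)
  inj′ : ∀ {a l a′ l′} → c (suc a) l ≡ c (suc a′) l′ → a ≡ a′ × l ≡ l′
  inj′ e with refl , refl ← inj e = refl , refl
  matched : size (λ ω → rest ω ∧ first ω) * X ≡ size rest
  matched = size-matches (c zero) (b zero) (proj₂ ∘ inj) λ l →
    noneMatches-ignores {c = c ∘ suc} {b ∘ suc} λ a l′ e → Finₚ.0≢1+n (sym (proj₁ (inj e)))
  step : size (noneMatches c b) * X ≡ y * size rest
  -- Adding `size rest` on both sides replaces a subtraction.
  step = ℕₚ.+-cancelˡ-≡ (size rest) _ _ (begin
    size rest + size (noneMatches c b) * X                                        ≡⟨ cong (_+ size (noneMatches c b) * X) matched ⟨
    size (λ ω → rest ω ∧ first ω) * X + size (noneMatches c b) * X                ≡⟨ ℕₚ.*-distribʳ-+ X (size (λ ω → rest ω ∧ first ω)) _ ⟨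
    (size (λ ω → rest ω ∧ first ω) + size (noneMatches c b)) * X                  ≡⟨ cong (_* X) (size-split rest first) ⟩
    size rest * X                                                                 ≡⟨ cong (size rest *_) eq ⟩
    size rest * suc y                                                             ≡⟨ ℕₚ.*-comm (size rest) (suc y) ⟩
    size rest + y * size rest                                                     ∎)

-- The union bound, with probability bounds in cross-multiplied form.
size-any : ∀ {A : Set} {m K L} (p : A → Vec Bool m → Bool) xs → (∀ x → size (p x) * K ≤ L) →
  size (λ ω → anyᵇ (λ x → p x ω) xs) * K ≤ length xs * L
size-any {m = m} {K} p []       h = ℕₚ.≤-reflexive (cong (_* K) (size-false m))
size-any {K = K} p (x ∷ xs) h = ℕₚ.≤-trans (ℕₚ.*-monoˡ-≤ K (size-∨ (p x) (λ ω → anyᵇ (λ x → p x ω) xs)))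
  (ℕₚ.≤-trans (ℕₚ.≤-reflexive (ℕₚ.*-distribʳ-+ K (size (p x)) _)) (ℕₚ.+-mono-≤ (h x) (size-any p xs h)))

any-false : ∀ {A : Set} (p : A → Bool) xs → anyᵇ p xs ≡ false → ∀ {x} → x ∈ xs → p x ≡ false
any-false p (x ∷ xs) eq x∈ with p x in px
any-false p (x ∷ xs) eq (here refl) | false = px
any-false p (x ∷ xs) eq (there x∈)  | false = any-false p xs eq x∈

-- The passage from `size` to the filtered list of outcomes in `Pr`; both split on the first bit.
outcomes-≥ : ∀ {m} {A : Pred (Vec Bool m) 0ℓ} (A? : Decidable A) (bad : Vec Bool m → Bool) →
  (∀ ω → bad ω ≡ false → A ω) → 2 ^ m ≤ length (filter A? (outcomes m)) + size bad
outcomes-≥ {zero}  A? bad h with bad [] in eq | A? []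
... | true  | _     = ℕₚ.m≤n+m 1 _
... | false | yes _ = s≤s z≤n
... | false | no ¬a = contradiction (h [] eq) ¬a
outcomes-≥ {suc m} A? bad h = begin
  2 ^ m + (2 ^ m + 0)                       ≡⟨ cong (2 ^ m +_) (ℕₚ.+-identityʳ _) ⟩
  2 ^ m + 2 ^ m                             ≤⟨ ℕₚ.+-mono-≤ (outcomes-≥ (A? ∘ (true ∷_)) (bad ∘ (true ∷_)) (λ ω → h (true ∷ ω)))
                                                 (outcomes-≥ (A? ∘ (false ∷_)) (bad ∘ (false ∷_)) (λ ω → h (false ∷ ω))) ⟩
  (count (A? ∘ (true ∷_)) Ω + size (bad ∘ (true ∷_))) + (count (A? ∘ (false ∷_)) Ω + size (bad ∘ (false ∷_)))
                                            ≡⟨ interchange (count (A? ∘ (true ∷_)) Ω) _ _ _ ⟩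
  (count (A? ∘ (true ∷_)) Ω + (count (A? ∘ (false ∷_)) Ω + 0)) + size bad
                                            ≡⟨ cong (_+ size bad) (cong₂ _+_ (count-map (true ∷_) A? Ω)
                                                 (cong (_+ 0) (count-map (false ∷_) A? Ω))) ⟨
  (count A? (map (true ∷_) Ω) + (count A? (map (false ∷_) Ω) + 0)) + size bad
                                            ≡⟨ cong (_+ size bad) (trans (count-++ A? (map (true ∷_) Ω) _)
                                                 (cong (count A? (map (true ∷_) Ω) +_) (count-++ A? (map (false ∷_) Ω) []))) ⟨
  count A? (outcomes (suc m)) + size bad    ∎
  where
  open ℕₚ.≤-Reasoning
  Ω : List (Vec Bool m)
  Ω = outcomes m
  interchange : ∀ a b c d → (a + b) + (c + d) ≡ (a + (c + 0)) + (b + d)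
  interchange = solve-∀

-- Feedback arc sets and rankings

module _ {V : Set} (_≟ⱽ_ : DecidableEquality V) (G : Digraph V) (F : Subset (Digraph.size G)) (fas : IsFeedbackArcSet G F) where
  open Digraph G renaming (size to arcs)

  module _ (a : ℕ → Fin arcs) (walk : ∀ t → target (a t) ≡ source (a (suc t))) (a∉F : ∀ t → a t ∉ₛ F) where

    -- A shortest return has distinct sources, so it is a cycle avoiding `F`. The index `d` stands
    -- for a return after `suc d` arcs.
    walk-no-return : ∀ d i → source (a i) ≢ source (a (i + suc d))
    walk-no-return = <-rec (λ d → ∀ i → source (a i) ≢ source (a (i + suc d))) step
      where
      step : ∀ d → (∀ {d′} → d′ < d → ∀ i → source (a i) ≢ source (a (i + suc d′))) →
        ∀ i → source (a i) ≢ source (a (i + suc d))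
      step d rec i return = let j , cj∈F = fas c (closed , simple) in
          a∉F (i + toℕ j) (subst (_∈ₛ F) (Vecₚ.lookup∘tabulate arcAt j) cj∈F)
        where
        arcAt : Fin (suc d) → Fin arcs
        arcAt j = a (i + toℕ j)
        c : Vec (Fin arcs) (suc d)
        c = tabulate arcAt
        next : ∀ j → source (a (i + suc (toℕ j))) ≡ source (arcAt (cyclicSuc j))
        next j with ℕₚ.m≤n⇒m<n∨m≡n (Finₚ.toℕ<n j)
        ... | inj₁ j<d = cong (λ t → source (a (i + t)))
          (sym (trans (Finₚ.toℕ-fromℕ< _) (m<n⇒m%n≡m j<d)))
        -- At the last position `cyclicSuc` wraps to zero, and `return` closes the cycle.
        ... | inj₂ j≡d = trans (cong (λ t → source (a (i + t))) j≡d) (trans (sym return) (cong (source ∘ a)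
          (trans (sym (ℕₚ.+-identityʳ i)) (cong (i +_)
            (sym (trans (Finₚ.toℕ-fromℕ< _) (trans (cong (_% suc d) j≡d) (n%n≡0 (suc d)))))))))
        closed : ∀ j → target (lookup c j) ≡ source (lookup c (cyclicSuc j))
        closed j = trans (cong target (Vecₚ.lookup∘tabulate arcAt j)) (trans (walk (i + toℕ j))
          (trans (cong (source ∘ a) (sym (ℕₚ.+-suc i (toℕ j))))
            (trans (next j) (cong source (sym (Vecₚ.lookup∘tabulate arcAt (cyclicSuc j)))))))
        -- A coincidence inside would be a shorter return.
        distinct : ∀ {j l : Fin (suc d)} → toℕ j < toℕ l → source (arcAt j) ≢ source (arcAt l)
        distinct {j} {l} j<l eq = rec {toℕ l ∸ suc (toℕ j)}
          (ℕₚ.≤-trans (ℕₚ.∸-monoˡ-< (Finₚ.toℕ<n l) j<l) (ℕₚ.m∸n≤m d (toℕ j)))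
          (i + toℕ j) (trans eq (cong (source ∘ a) position))
          where
          position : i + toℕ l ≡ i + toℕ j + suc (toℕ l ∸ suc (toℕ j))
          position = trans (cong (i +_) (sym (trans (ℕₚ.+-suc (toℕ j) _) (ℕₚ.m+[n∸m]≡n j<l)))) (sym (ℕₚ.+-assoc i (toℕ j) _))
        simple : ∀ j l → source (lookup c j) ≡ source (lookup c l) → j ≡ l
        simple j l eq with Finₚ.<-cmp j l | trans (sym (cong source (Vecₚ.lookup∘tabulate arcAt j)))
                                              (trans eq (cong source (Vecₚ.lookup∘tabulate arcAt l)))
        ... | tri< j<l _ _ | eq′ = contradiction eq′ (distinct j<l)
        ... | tri≈ _ j≡l _ | _   = j≡l
        ... | tri> _ _ l<j | eq′ = contradiction (sym eq′) (distinct l<j)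

    -- Otherwise two of the first `length S + 1` sources have the same position in `S`, which is a
    -- return.
    walk-escapes : ∀ S → ¬ (∀ t → source (a t) ∈ S)
    walk-escapes S inside with i , j , i<j , eq ← Finₚ.pigeonhole (ℕₚ.n<1+n (length S)) (λ i → Any.index (inside (toℕ i)))
      = walk-no-return (toℕ j ∸ suc (toℕ i)) (toℕ i) (trans (sourceAt (toℕ i)) (trans (cong (List.lookup S) eq)
          (trans (sym (sourceAt (toℕ j))) (cong (source ∘ a) (sym (trans (ℕₚ.+-suc (toℕ i) _) (ℕₚ.m+[n∸m]≡n i<j)))))))
      where
      sourceAt : ∀ t → source (a t) ≡ List.lookup S (Any.index (inside t))
      sourceAt t = Anyₚ.lookup-index (inside t)

  StaysIn : List V → V → Set
  StaysIn S v = ∃ λ e → e ∉ₛ F × source e ≡ v × target e ∈ S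

  staysIn? : ∀ S → Decidable (StaysIn S)
  staysIn? S v = Finₚ.any? λ e → ¬? (e ∈ₛ? F) ×-dec (source e ≟ⱽ v) ×-dec Any.any? (target e ≟ⱽ_) S

  -- Otherwise every vertex of the list has an arc outside `F` back into the list; following such
  -- arcs forever is excluded by `walk-escapes`.
  sink : ∀ v S → ∃ λ u → u ∈ v ∷ S × ¬ StaysIn (v ∷ S) u
  sink v S with Any.any? (¬? ∘ staysIn? (v ∷ S)) (v ∷ S)
  ... | yes found = let u , u∈ , ¬stays = find found in u , u∈ , ¬stays
  ... | no none   = ⊥-elim (walk-escapes (λ t → proj₁ (steps t)) (λ t → sym (proj₁ (proj₂ (proj₂ (stays (target-in t))))))
                      (λ t → proj₁ (proj₂ (steps t))) (v ∷ S) source-in)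
    where
    stays : ∀ {u} → u ∈ v ∷ S → StaysIn (v ∷ S) u
    stays {u} u∈ = decidable-stable (staysIn? (v ∷ S) u) λ ¬stays → none (lose u∈ ¬stays)
    steps : ℕ → ∃ λ e → e ∉ₛ F × target e ∈ v ∷ S
    steps zero    = let e , e∉ , _ , t∈ = stays (here refl) in e , e∉ , t∈
    steps (suc t) = let e , e∉ , _ , t∈ = stays (proj₂ (proj₂ (steps t))) in e , e∉ , t∈
    target-in : ∀ t → target (proj₁ (steps t)) ∈ v ∷ S
    target-in t = proj₂ (proj₂ (steps t))
    source-in : ∀ t → source (proj₁ (steps t)) ∈ v ∷ S
    source-in zero    = subst (_∈ v ∷ S) (sym (proj₁ (proj₂ (proj₂ (stays (here refl)))))) (here refl)
    source-in (suc t) = subst (_∈ v ∷ S) (sym (proj₁ (proj₂ (proj₂ (stays (target-in t)))))) (target-in t)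

  record Ranking (S : List V) : Set where
    field
      rank           : V → ℕ
      rank-injective : ∀ {u v} → u ∈ S → v ∈ S → rank u ≡ rank v → u ≡ v
      rank-decreases : ∀ {e} → e ∉ₛ F → source e ∈ S → target e ∈ S → rank (target e) < rank (source e)

  -- A sink gets rank zero, and the others, ranked recursively, move up by one. The bound `n` on the
  -- length drives the recursion, as `others` is not a structural part of the list.
  ranking : ∀ S → Ranking S
  ranking S = go (length S) S ℕₚ.≤-refl
    where
    go : ∀ n S → length S ≤ n → Ranking S
    go n       []      _        = record { rank = const 0 ; rank-injective = λ () ; rank-decreases = λ _ () }
    go (suc n) (v ∷ S) (s≤s len) with u , u∈ , ¬stays ← sink v S = record
        { rank = rank′ ; rank-injective = λ {x} {y} → injective x y ; rank-decreases = decreases }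
      where
      others : List V
      others = filter (λ w → ¬? (w ≟ⱽ u)) (v ∷ S)
      open Ranking (go n others (ℕₚ.≤-pred (ℕₚ.≤-trans
        (Listₚ.filter-notAll (λ w → ¬? (w ≟ⱽ u)) (v ∷ S) (lose u∈ λ ≢ → ≢ refl)) (s≤s len))))
      other : ∀ {w} → w ∈ v ∷ S → w ≢ u → w ∈ others
      other = ∈ₚ.∈-filter⁺ (λ w → ¬? (w ≟ⱽ u))
      rank′ : V → ℕ
      rank′ w with w ≟ⱽ u
      ... | yes _ = 0
      ... | no  _ = suc (rank w)
      injective : ∀ x y → x ∈ v ∷ S → y ∈ v ∷ S → rank′ x ≡ rank′ y → x ≡ y
      injective x y x∈ y∈ eq with x ≟ⱽ u | y ≟ⱽ u
      ... | yes refl | yes refl = refl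
      ... | no x≢u   | no y≢u   = rank-injective (other x∈ x≢u) (other y∈ y≢u) (ℕₚ.suc-injective eq)
      decreases : ∀ {e} → e ∉ₛ F → source e ∈ v ∷ S → target e ∈ v ∷ S → rank′ (target e) < rank′ (source e)
      decreases {e} e∉ s∈ t∈ with target e ≟ⱽ u | source e ≟ⱽ u
      ... | _     | yes s≡u = contradiction (e , e∉ , s≡u , t∈) ¬stays
      ... | yes _ | no _    = s≤s z≤n
      ... | no t≢ | no s≢   = s≤s (rank-decreases e∉ (other s∈ s≢) (other t∈ t≢))

-- Tournaments as digraphs, and the upper bound

Arc : ∀ {V : Set} → Digraph V → V → V → Set
Arc G u v = ∃ λ e → Digraph.arc G e ≡ (u , v)

Arc? : ∀ {V : Set} → DecidableEquality V → ∀ (G : Digraph V) u v → Dec (Arc G u v)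
Arc? _≟ⱽ_ G u v = Finₚ.any? λ e → ≡-dec _≟ⱽ_ _≟ⱽ_ (Digraph.arc G e) (u , v)

_≟ⱽ_ : ∀ {k} {n : Fin k → ℕ} → DecidableEquality (Vertex n)
_≟ⱽ_ = ≡-dec Finₚ._≟_ Finₚ._≟_

module TournamentModel {k : ℕ} (n : Fin k → ℕ) where

  private
    V : Set
    V = Vertex n

  ∈-vertices : ∀ (u : V) → u ∈ vertices n
  ∈-vertices (i , x) = ∈ₚ.∈-concat⁺′ (∈ₚ.∈-map⁺ (i ,_) (∈ₚ.∈-allFin x)) (∈ₚ.∈-map⁺ _ (∈ₚ.∈-allFin i))

  vertices! : Unique (vertices n)
  vertices! = Uniqueₚ.concat⁺
    (Allₚ.map⁺ (All.universal (λ i → Uniqueₚ.map⁺ (λ { refl → refl }) (Uniqueₚ.allFin⁺ (n i))) (allFin k)))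
    (AllPairsₚ.map⁺ (AllPairs.map disjoint (Uniqueₚ.allFin⁺ k)))
    where
    disjoint : ∀ {i j} → i ≢ j → DisjointLists {A = V} (map (i ,_) (allFin (n i))) (map (j ,_) (allFin (n j)))
    disjoint i≢j (v∈i , v∈j) with _ , _ , refl ← ∈ₚ.∈-map⁻ _ v∈i | _ , _ , eq ← ∈ₚ.∈-map⁻ _ v∈j = i≢j (cong proj₁ eq)

  edges! : Unique (edges n)
  edges! = Uniqueₚ.filter⁺ _ (Uniqueₚ.cartesianProduct⁺ vertices! vertices!)

  edge-ascends : ∀ e → proj₁ (proj₁ (List.lookup (edges n) e)) Fin.< proj₁ (proj₂ (List.lookup (edges n) e))
  edge-ascends e = proj₂ (∈ₚ.∈-filter⁻ (λ (u , v) → proj₁ u Fin.<? proj₁ v) {xs = List.cartesianProduct (vertices n) (vertices n)} (∈ₚ.∈-lookup e))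

  ∈-edges : ∀ {u v : V} → proj₁ u Fin.< proj₁ v → (u , v) ∈ edges n
  ∈-edges u<v = ∈ₚ.∈-filter⁺ _ (∈ₚ.∈-cartesianProduct⁺ (∈-vertices _) (∈-vertices _)) u<v

  edge : (u v : V) → proj₁ u ≢ proj₁ v → Fin (length (edges n))
  edge u v u≢v with Finₚ.<-cmp (proj₁ u) (proj₁ v)
  ... | tri< u<v _ _ = Any.index (∈-edges {u} {v} u<v)
  ... | tri≈ _ u≡v _ = contradiction u≡v u≢v
  ... | tri> _ _ v<u = Any.index (∈-edges {v} {u} v<u)

  -- The value of the bit at `edge u v` that orients it from `u` to `v`: `true` keeps the listed
  -- order, in which the smaller class index comes first.
  ascends : V → V → Bool
  ascends u v = does (proj₁ u Fin.<? proj₁ v)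

  lookup-edge : ∀ u v u≢v →
    (List.lookup (edges n) (edge u v u≢v) ≡ (u , v) × ascends u v ≡ true) ⊎
    (List.lookup (edges n) (edge u v u≢v) ≡ (v , u) × ascends u v ≡ false)
  lookup-edge u v u≢v with Finₚ.<-cmp (proj₁ u) (proj₁ v)
  ... | tri< u<v _ _ = inj₁ (sym (Anyₚ.lookup-index (∈-edges {u} {v} u<v)) , dec-true (proj₁ u Fin.<? proj₁ v) u<v)
  ... | tri≈ _ u≡v _ = contradiction u≡v u≢v
  ... | tri> u≮v _ v<u = inj₂ (sym (Anyₚ.lookup-index (∈-edges {v} {u} v<u)) , dec-false (proj₁ u Fin.<? proj₁ v) u≮v)

  edge-injective : ∀ {u v u≢v u′ v′ u′≢v′} → edge u v u≢v ≡ edge u′ v′ u′≢v′ → (u ≡ u′ × v ≡ v′) ⊎ (u ≡ v′ × v ≡ u′)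
  edge-injective {u} {v} {u≢v} {u′} {v′} {u′≢v′} eq with lookup-edge u v u≢v | lookup-edge u′ v′ u′≢v′ | cong (List.lookup (edges n)) eq
  ... | inj₁ (p , _) | inj₁ (q , _) | eq′ with refl ← trans (sym p) (trans eq′ q) = inj₁ (refl , refl)
  ... | inj₁ (p , _) | inj₂ (q , _) | eq′ with refl ← trans (sym p) (trans eq′ q) = inj₂ (refl , refl)
  ... | inj₂ (p , _) | inj₁ (q , _) | eq′ with refl ← trans (sym p) (trans eq′ q) = inj₂ (refl , refl)
  ... | inj₂ (p , _) | inj₂ (q , _) | eq′ with refl ← trans (sym p) (trans eq′ q) = inj₁ (refl , refl)

  module _ (ω : Orientation n) where

    private
      G : Digraph V
      G = tournament n ω

    open Digraph G using (arc)

    arc-true : ∀ {e u v} → List.lookup (edges n) e ≡ (u , v) → lookup ω e ≡ true → arc e ≡ (u , v)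
    arc-true {e} p q rewrite q = p

    arc-false : ∀ {e u v} → List.lookup (edges n) e ≡ (u , v) → lookup ω e ≡ false → arc e ≡ (v , u)
    arc-false {e} p q rewrite q = cong swap p

    edge-Arc : ∀ {u v u≢v} → lookup ω (edge u v u≢v) ≡ ascends u v → Arc G u v
    edge-Arc {u} {v} {u≢v} eq with lookup-edge u v u≢v
    ... | inj₁ (p , asc)  = _ , arc-true p (trans eq asc)
    ... | inj₂ (p , desc) = _ , arc-false p (trans eq desc)

    edge-Arc-reverse : ∀ {u v u≢v} → lookup ω (edge u v u≢v) ≡ not (ascends u v) → Arc G v u
    edge-Arc-reverse {u} {v} {u≢v} eq with lookup-edge u v u≢v
    ... | inj₁ (p , asc)  = _ , arc-false p (trans eq (cong not asc))
    ... | inj₂ (p , desc) = _ , arc-true p (trans eq (cong not desc))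

    arc-lookup : ∀ {e u v} → arc e ≡ (u , v) →
      (lookup ω e ≡ true × List.lookup (edges n) e ≡ (u , v)) ⊎ (lookup ω e ≡ false × List.lookup (edges n) e ≡ (v , u))
    arc-lookup {e} eq with lookup ω e
    ... | true  = inj₁ (refl , eq)
    ... | false = inj₂ (refl , cong swap eq)

    -- Listed edges ascend in class index, so opposite arcs come from the same listed pair with
    -- different bits; by `edges!` it is listed once and has only one bit.
    Arc-asym : ∀ {u v} → Arc G u v → ¬ Arc G v u
    Arc-asym {u} {v} (e , p) (e′ , q) with arc-lookup {e} p | arc-lookup {e′} q
    ... | inj₁ (_ , p′) | inj₁ (_ , q′) = Finₚ.<-asym (subst (λ (u , v) → proj₁ u Fin.< proj₁ v) p′ (edge-ascends e))
                                                    (subst (λ (u , v) → proj₁ u Fin.< proj₁ v) q′ (edge-ascends e′))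
    ... | inj₂ (_ , p′) | inj₂ (_ , q′) = Finₚ.<-asym (subst (λ (u , v) → proj₁ u Fin.< proj₁ v) p′ (edge-ascends e))
                                                    (subst (λ (u , v) → proj₁ u Fin.< proj₁ v) q′ (edge-ascends e′))
    ... | inj₁ (b , p′) | inj₂ (b′ , q′) with refl ← lookup-injective edges! {e} {e′} (trans p′ (sym q′)) with () ← trans (sym b) b′
    ... | inj₂ (b , p′) | inj₁ (b′ , q′) with refl ← lookup-injective edges! {e} {e′} (trans p′ (sym q′)) with () ← trans (sym b) b′

    Arc-classes : ∀ {u v} → Arc G u v → proj₁ u ≢ proj₁ v
    Arc-classes (e , p) eq with arc-lookup {e} p
    ... | inj₁ (_ , p′) = Finₚ.<-irrefl eq (subst (λ (u , v) → proj₁ u Fin.< proj₁ v) p′ (edge-ascends e))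
    ... | inj₂ (_ , p′) = Finₚ.<-irrefl (sym eq) (subst (λ (u , v) → proj₁ u Fin.< proj₁ v) p′ (edge-ascends e))

dec-true⁻ : ∀ {P : Set} (P? : Dec P) → does P? ≡ true → P
dec-true⁻ (yes p) _ = p

-- A missed value could be punched out, giving an injection into a smaller set.
injective⇒hits : ∀ {k} (f : Fin k → Fin k) → (∀ {a b} → f a ≡ f b → a ≡ b) → ∀ i → ∃ λ a → f a ≡ i
injective⇒hits {suc k} f inj i with Finₚ.any? (λ a → f a Finₚ.≟ i)
... | yes hit = hit
... | no miss = contradiction (Finₚ.injective⇒≤ {f = λ a → Fin.punchOut (λ eq → miss (a , sym eq))}
  (inj ∘ Finₚ.punchOut-injective {i = i} _ _)) ℕₚ.1+n≰n

-- The vertices x of the last class with toℕ x < k lie in no clique of the feedback arc set F below: apex i has no arc of F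
-- to or from class i.
module UpperBound {k : ℕ} (n : Fin (suc k) → ℕ) (room : suc k ≤ n (fromℕ k)) (G : Digraph (Vertex n))
  (Arc-asym : ∀ {u v} → Arc G u v → ¬ Arc G v u) (Arc-classes : ∀ {u v} → Arc G u v → proj₁ u ≢ proj₁ v) where
  open Digraph G using (arc; source; target) renaming (size to arcs)

  last : Fin (suc k)
  last = fromℕ k

  apex : Fin (suc k) → Vertex n
  apex i = last , inject≤ i room

  -- A vertex outside the last class is placed so that its arc with its apex climbs and thus stays
  -- out of `F`. The decisions are arguments so that a later `with` on them computes the height.
  level : ∀ {u} → Dec (proj₁ u ≡ last) → Dec (Arc G u (apex (proj₁ u))) → ℕ
  level (yes _) _       = 1
  level (no _)  (yes _) = 0
  level (no _)  (no _)  = 2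

  height : Vertex n → ℕ
  height u = level (proj₁ u Finₚ.≟ last) (Arc? _≟ⱽ_ G u (apex (proj₁ u)))

  F : Subset arcs
  F = tabulate λ e → does (height (target e) ℕₚ.≤? height (source e))

  ∈F⁺ : ∀ {e} → height (target e) ≤ height (source e) → e ∈ₛ F
  ∈F⁺ {e} h = Vecₚ.lookup⇒[]= e F (trans (Vecₚ.lookup∘tabulate _ e) (dec-true (_ ℕₚ.≤? _) h))

  ∈F⁻ : ∀ {e} → e ∈ₛ F → height (target e) ≤ height (source e)
  ∈F⁻ {e} e∈ = dec-true⁻ (_ ℕₚ.≤? _) (trans (sym (Vecₚ.lookup∘tabulate _ e)) (Vecₚ.[]=⇒lookup e∈))

  -- A cycle without arcs of `F` would climb along each of its arcs, including the one that closes
  -- it.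
  F-feedback : IsFeedbackArcSet G F
  F-feedback {l} c (closed , _) with Finₚ.any? (λ i → lookup c i ∈ₛ? F)
  ... | yes hit = hit
  ... | no miss = contradiction (climbs (fromℕ l)) (ℕₚ.<⇒≱ (subst (λ i → height (source (lookup c (fromℕ l))) < height (source (lookup c i))) wraps (rises (fromℕ l))))
    where
    rises : ∀ i → height (source (lookup c i)) < height (source (lookup c (cyclicSuc i)))
    rises i = subst (λ v → height (source (lookup c i)) < height v) (closed i) (ℕₚ.≰⇒> λ h → miss (i , ∈F⁺ h))
    wraps : cyclicSuc (fromℕ l) ≡ zero
    wraps = Finₚ.toℕ-injective (trans (Finₚ.toℕ-fromℕ< _) (trans (cong (λ t → suc t % suc l) (Finₚ.toℕ-fromℕ l)) (n%n≡0 (suc l))))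
    climbs : ∀ i → height (source (lookup c zero)) ≤ height (source (lookup c i))
    climbs = <-weakInduction _ ℕₚ.≤-refl λ i h → ℕₚ.≤-trans h (ℕₚ.<⇒≤ (subst (λ j → height (source (lookup c (Fin.inject₁ i))) < height (source (lookup c j)))
      (Finₚ.toℕ-injective (trans (Finₚ.toℕ-fromℕ< _) (trans (cong (λ t → suc t % suc l) (Finₚ.toℕ-inject₁ i)) (m<n⇒m%n≡m (s≤s (Finₚ.toℕ<n i))))))
      (rises (Fin.inject₁ i))))

  height-last : ∀ x → height (last , x) ≡ 1
  height-last x with last Finₚ.≟ last
  ... | yes _ = refl
  ... | no ≢  = contradiction refl ≢

  ¬into-apex : ∀ {u} → proj₁ u ≢ last → ¬ HasArc G F u (apex (proj₁ u))
  ¬into-apex {u} u≢ (e , e∈ , eq) with proj₁ u Finₚ.≟ last | Arc? _≟ⱽ_ G u (apex (proj₁ u))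
    | subst₂ (λ x y → height y ≤ height x) (cong proj₁ eq) (cong proj₂ eq) (∈F⁻ e∈)
  ... | yes ≡ | _      | _ = u≢ ≡
  ... | no _  | no ¬a  | _ = ¬a (e , eq)
  ... | no _  | yes _  | h = ℕₚ.1+n≰n (subst (_≤ 0) (height-last _) h)

  ¬from-apex : ∀ {u} → proj₁ u ≢ last → ¬ HasArc G F (apex (proj₁ u)) u
  ¬from-apex {u} u≢ (e , e∈ , eq) with proj₁ u Finₚ.≟ last | Arc? _≟ⱽ_ G u (apex (proj₁ u))
    | subst₂ (λ x y → height y ≤ height x) (cong proj₁ eq) (cong proj₂ eq) (∈F⁻ e∈)
  ... | yes ≡ | _      | _ = u≢ ≡
  ... | no _  | yes a  | _ = Arc-asym a (e , eq)
  ... | no _  | no _   | h = ℕₚ.1+n≰n (subst (2 ≤_) (height-last _) h)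

  module _ (vs : Vec (Vertex n) (suc k)) (clique : IsTransitiveClique G F vs) where

    -- The `suc k` vertices of the clique are pairwise joined by arcs, so they lie in different
    -- classes.
    class-hit : ∀ i → ∃ λ a → proj₁ (lookup vs a) ≡ i
    class-hit = injective⇒hits (proj₁ ∘ lookup vs) λ {a} {b} eq → injective a b eq
      where
      separated : ∀ {a b} → a Fin.< b → proj₁ (lookup vs a) ≢ proj₁ (lookup vs b)
      separated a<b = let e , _ , eq = proj₂ clique _ _ a<b in Arc-classes (e , eq)
      injective : ∀ a b → proj₁ (lookup vs a) ≡ proj₁ (lookup vs b) → a ≡ b
      injective a b eq with Finₚ.<-cmp a b
      ... | tri< a<b _ _ = contradiction eq (separated a<b)
      ... | tri≈ _ a≡b _ = a≡b
      ... | tri> _ _ b<a = contradiction (sym eq) (separated b<a)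

    -- The clique also has a vertex in class `i`, and `F` contains no arc between it and `apex i` in
    -- either direction.
    apex-∉ : ∀ i → i ≢ last → ∀ a → lookup vs a ≢ apex i
    apex-∉ i i≢last a eq with b , refl ← class-hit i with Finₚ.<-cmp a b
    ... | tri< a<b _ _ = ¬from-apex i≢last (subst (λ u → HasArc G F u _) eq (proj₂ clique a b a<b))
    ... | tri≈ _ refl _ = i≢last (cong proj₁ eq)
    ... | tri> _ _ b<a = ¬into-apex i≢last (subst (HasArc G F _) eq (proj₂ clique b a b<a))

    lastVertex : ∃₂ λ a x → lookup vs a ≡ (last , x) × k ≤ toℕ x
    lastVertex = let a , a-last = class-hit last in at a (lookup vs a) refl a-last
      where
      at : ∀ a v → lookup vs a ≡ v → proj₁ v ≡ last → ∃₂ λ a x → lookup vs a ≡ (last , x) × k ≤ toℕ x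
      -- A vertex of the last class with number below `k` is the apex of the class with the same
      -- number, which is not the last one.
      at a (_ , x) eq refl = a , x , eq , ℕₚ.≮⇒≥ λ x<k → apex-∉ (Fin.inject₁ (fromℕ< x<k))
        (λ i≡last → Finₚ.fromℕ≢inject₁ (sym i≡last)) a
        (trans eq (cong (last ,_) (Finₚ.toℕ-injective
          (sym (trans (Finₚ.toℕ-inject≤ _ room) (trans (Finₚ.toℕ-inject₁ _) (Finₚ.toℕ-fromℕ< x<k)))))))

  -- Disjoint cliques take different vertices of the last class, all numbered from `k` on; `slot`
  -- shifts these numbers down by `k`.
  upperBound : ∀ {t} → EveryFASContains G (suc k) t → t ≤ n last ∸ k
  upperBound {t} every = Finₚ.injective⇒≤ {f = slot} λ {a} {b} eq →
      decidable-stable (a Finₚ.≟ b) λ a≢b → proj₂ (proj₂ found) a b a≢b (proj₁ (lastOf a)) (proj₁ (lastOf b)) (same a b eq)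
    where
    found : ContainsDisjointCliques G (suc k) F t
    found = every F F-feedback
    lastOf : ∀ a → ∃₂ λ i x → lookup (lookup (proj₁ found) a) i ≡ (last , x) × k ≤ toℕ x
    lastOf a = lastVertex (lookup (proj₁ found) a) (proj₁ (proj₂ found) a)
    slot : Fin t → Fin (n last ∸ k)
    slot a = let _ , x , _ , k≤x = lastOf a in fromℕ< (ℕₚ.∸-monoˡ-< (Finₚ.toℕ<n x) k≤x)
    same : ∀ a b → slot a ≡ slot b → lookup (lookup (proj₁ found) a) (proj₁ (lastOf a)) ≡ lookup (lookup (proj₁ found) b) (proj₁ (lastOf b))
    same a b eq with _ , x , eqx , k≤x ← lastOf a | _ , y , eqy , k≤y ← lastOf b =
      trans eqx (trans (cong (last ,_) (Finₚ.toℕ-injective (ℕₚ.∸-cancelʳ-≡ k≤x k≤y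
        (trans (sym (Finₚ.toℕ-fromℕ< _)) (trans (cong toℕ eq) (Finₚ.toℕ-fromℕ< _)))))) (sym eqy))

-- The lower bound

module Embedding {k s : ℕ} (n : Fin k → ℕ) (s≤n : ∀ i → s ≤ n i) where

  embed : Fin k → Fin s → Vertex n
  embed i x = i , inject≤ x (s≤n i)

  embed-injective : ∀ {i x j y} → embed i x ≡ embed j y → i ≡ j × x ≡ y
  embed-injective {i} {x} {j} {y} eq with refl ← cong proj₁ eq = refl , Finₚ.toℕ-injective
    (trans (sym (Finₚ.toℕ-inject≤ x (s≤n i))) (trans (cong (toℕ ∘ proj₂) eq) (Finₚ.toℕ-inject≤ y (s≤n i))))

  ArcS : Digraph (Vertex n) → Fin k → Fin s → Fin k → Fin s → Set
  ArcS G i x j y = Arc G (embed i x) (embed j y)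

  ArcS? : ∀ G i x j y → Dec (ArcS G i x j y)
  ArcS? G i x j y = Arc? _≟ⱽ_ G (embed i x) (embed j y)

module LowerBound {k s : ℕ} (n : Fin k → ℕ) (s≤n : ∀ i → s ≤ n i) (G : Digraph (Vertex n))
  (S : List (Vertex n)) (∈-S : ∀ u → u ∈ S) where
  open Embedding n s≤n
  open Digraph G using (arc; source; target) renaming (size to arcs)

  module _ (F : Subset arcs) (fas : IsFeedbackArcSet G F) where

    open Ranking (ranking _≟ⱽ_ G F fas S)

    ρ : Fin k → Fin s → ℕ
    ρ i x = rank (embed i x)

    ρ-injective : ∀ {i x j y} → ρ i x ≡ ρ j y → i ≡ j
    ρ-injective eq = proj₁ (embed-injective (rank-injective (∈-S _) (∈-S _) eq))

    open RankedTournament (ArcS G) (ArcS? G) ρ ρ-injective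
    open Tiling Adj Adj? Adj-sym

    rising⇒HasArc : ∀ {u v} → Arc G u v → rank u < rank v → HasArc G F u v
    rising⇒HasArc (e , eq) u<v = e , decidable-stable (e ∈ₛ? F) (λ e∉F → ℕₚ.<-asym u<v
      (subst₂ (λ u v → rank v < rank u) (cong proj₁ eq) (cong proj₂ eq) (rank-decreases e∉F (∈-S _) (∈-S _)))) , eq

    byRank : DecTotalOrder 0ℓ 0ℓ 0ℓ
    byRank = On.decTotalOrder ℕₚ.≤-decTotalOrder rank

    module Ascending = Sort byRank

    -- Sorting by rank provides the transitive order of the clique.
    corners sorted : Tuple k s → List (Vertex n)
    corners t = map (λ j → embed j (t j)) (allFin k)
    sorted t  = Ascending.sort (corners t)

    sorted-length : ∀ t → k ≡ length (sorted t)
    sorted-length t = sym (trans (↭ₚ.↭-length (Ascending.sort-↭ (corners t)))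
      (trans (Listₚ.length-map _ (allFin k)) (length-allFin k)))

    sorted! : ∀ t → Unique (sorted t)
    sorted! t = Unique-resp-↭ (↭-sym (Ascending.sort-↭ (corners t)))
      (Uniqueₚ.map⁺ (proj₁ ∘ embed-injective) (Uniqueₚ.allFin⁺ k))

    clique : Tuple k s → Vec (Vertex n) k
    clique t = tabulate λ p → List.lookup (sorted t) (Fin.cast (sorted-length t) p)

    clique-lookup : ∀ t p → lookup (clique t) p ≡ List.lookup (sorted t) (Fin.cast (sorted-length t) p)
    clique-lookup t = Vecₚ.lookup∘tabulate _

    clique-corner : ∀ t p → ∃ λ j → lookup (clique t) p ≡ embed j (t j)
    clique-corner t p with j , _ , eq ← ∈ₚ.∈-map⁻ (λ j → embed j (t j)) (↭ₚ.∈-resp-↭ (Ascending.sort-↭ (corners t))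
      (∈ₚ.∈-lookup {xs = sorted t} (Fin.cast (sorted-length t) p))) = j , trans (clique-lookup t p) eq

    clique-injective : ∀ t p q → lookup (clique t) p ≡ lookup (clique t) q → p ≡ q
    clique-injective t p q eq = Finₚ.toℕ-injective (trans (sym (Finₚ.toℕ-cast _ p)) (trans
      (cong toℕ (lookup-injective (sorted! t) (trans (sym (clique-lookup t p)) (trans eq (clique-lookup t q))))) (Finₚ.toℕ-cast _ q)))

    clique-ascends : ∀ t p q → p Fin.< q → rank (lookup (clique t) p) ≤ rank (lookup (clique t) q)
    clique-ascends t p q p<q = subst₂ (λ u v → rank u ≤ rank v) (sym (clique-lookup t p)) (sym (clique-lookup t q))
      (Sortedₚ.lookup-mono-≤ (DecTotalOrder.totalOrder byRank) (Ascending.sort-↗ (corners t))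
        (subst₂ _≤_ (sym (Finₚ.toℕ-cast _ p)) (sym (Finₚ.toℕ-cast _ q)) (ℕₚ.<⇒≤ p<q)))

    clique-transitive : ∀ {t} → IsClique t → IsTransitiveClique G F (clique t)
    clique-transitive {t} adjacent = clique-injective t , hasArc
      where
      hasArc : ∀ p q → p Fin.< q → HasArc G F (lookup (clique t) p) (lookup (clique t) q)
      hasArc p q p<q with clique-corner t p | clique-corner t q | clique-ascends t p q p<q | clique-injective t p q
      ... | i , p≡ | j , q≡ | ascends | injective rewrite p≡ | q≡ with adjacent i j (λ { refl → Finₚ.<⇒≢ p<q (injective refl) })
      ... | inj₁ (i→j , rises) = rising⇒HasArc i→j rises
      ... | inj₂ (_ , falls)   = contradiction ascends (ℕₚ.<⇒≱ falls)

    disjointTransitiveCliques : ∀ ts → (∀ {t} → t ∈ ts → IsClique t) → (∀ j → Unique (column j ts)) →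
      ContainsDisjointCliques G k F (length ts)
    disjointTransitiveCliques ts cliques ts! = tabulate cliqueAt
      , (λ a → subst (IsTransitiveClique G F) (sym (Vecₚ.lookup∘tabulate cliqueAt a)) (clique-transitive (cliques (∈ₚ.∈-lookup a))))
      , λ a b a≢b i j eq → let
            x , x≡ = clique-corner (List.lookup ts a) i
            y , y≡ = clique-corner (List.lookup ts b) j
            same-class , same-vertex = embed-injective (trans (sym x≡) (trans (sym (cong (λ c → lookup c i) (Vecₚ.lookup∘tabulate cliqueAt a)))
              (trans eq (trans (cong (λ c → lookup c j) (Vecₚ.lookup∘tabulate cliqueAt b)) y≡))))
          in a≢b (map-lookup-injective x ts (ts! x) (trans same-vertex (cong (List.lookup ts b) (sym same-class))))
      where
      cliqueAt : Fin (length ts) → Vec (Vertex n) k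
      cliqueAt a = clique (List.lookup ts a)

    packing : ∀ {t} → (∃ λ ts → length ts ≡ t × (∀ {t} → t ∈ ts → IsClique t) × (∀ j → Unique (column j ts))) →
      ContainsDisjointCliques G k F t
    packing (ts , refl , cliques , ts!) = disjointTransitiveCliques ts cliques ts!

  -- Only the rank depends on `F`; `Mixing` and `Connecting` concern the orientation, so one good
  -- event serves every feedback arc set.
  lowerBound : ∀ {δ β m} (block : Fin (δ + δ) → Fin β → Fin s) → (∀ {a b l l′} → block a l ≡ block b l′ → a ≡ b) →
    Mixing (ArcS G) m → Connecting (ArcS G) block → Fin k →
    k ∸ 1 + (tileGroupSize k (2 ^ k * m) * k + (k * (2 ^ k * m) + cliqueBound k (2 ^ k * m))) ≤ δ → δ ≤ s →
    EveryFASContains G k (s ∸ (k ∸ 1))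
  lowerBound block block-disjoint mixing connecting i₀ budget δ≤s F fas =
    packing F fas (RankedTournament.disjointCliques (ArcS G) (ArcS? G) (ρ F fas) (ρ-injective F fas)
      block block-disjoint connecting mixing i₀ budget δ≤s)

-- The union bound

length-cartesianProductWith : ∀ {A B C : Set} (f : A → B → C) xs ys →
  length (List.cartesianProductWith f xs ys) ≡ length xs * length ys
length-cartesianProductWith f []       ys = refl
length-cartesianProductWith f (x ∷ xs) ys = trans (Listₚ.length-++ (map (f x) ys))
  (cong₂ _+_ (Listₚ.length-map (f x) ys) (length-cartesianProductWith f xs ys))

-- The index sets of the union bound. Events are indexed by vectors in place of functions, which
-- makes the indices enumerable.
record Listing (A : Set) (a : ℕ) : Set where
  field
    elements        : List A
    complete        : ∀ x → x ∈ elements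
    elements-length : length elements ≡ a

open Listing

fins : ∀ a → Listing (Fin a) a
fins a = record { elements = allFin a ; complete = ∈ₚ.∈-allFin ; elements-length = length-allFin a }

bools : Listing Bool 2
bools = record { elements = true ∷ false ∷ [] ; complete = λ { true → here refl ; false → there (here refl) } ; elements-length = refl }

pairs : ∀ {A B a b} → Listing A a → Listing B b → Listing (A × B) (a * b)
pairs xs ys = record
  { elements        = List.cartesianProduct (elements xs) (elements ys)
  ; complete        = λ (x , y) → ∈ₚ.∈-cartesianProduct⁺ (complete xs x) (complete ys y)
  ; elements-length = trans (length-cartesianProductWith _,_ (elements xs) (elements ys)) (cong₂ _*_ (elements-length xs) (elements-length ys))
  }

vecs : ∀ {A a} → Listing A a → ∀ m → Listing (Vec A m) (a ^ m)
vecs xs zero    = record { elements = [] ∷ [] ; complete = λ { [] → here refl } ; elements-length = refl }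
vecs xs (suc m) = record
  { elements        = List.cartesianProductWith _∷_ (elements xs) (elements (vecs xs m))
  ; complete        = λ { (x ∷ v) → ∈ₚ.∈-cartesianProductWith⁺ _∷_ (complete xs x) (complete (vecs xs m) v) }
  ; elements-length = trans (length-cartesianProductWith _∷_ (elements xs) (elements (vecs xs m)))
      (cong₂ _*_ (elements-length xs) (elements-length (vecs xs m)))
  }

module Events {k s E : ℕ} (edge : (i : Fin (suc k)) → Fin s → (j : Fin (suc k)) → Fin s → i ≢ j → Fin E)
  (edge-injective : ∀ {i x j y i≢j i′ x′ j′ y′ i′≢j′} → edge i x j y i≢j ≡ edge i′ x′ j′ y′ i′≢j′ →
    ((i ≡ i′ × x ≡ x′) × (j ≡ j′ × y ≡ y′)) ⊎ ((i ≡ j′ × x ≡ y′) × (j ≡ i′ × y ≡ x′)))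
  (sign : Fin (suc k) → Fin (suc k) → Bool)
  (ArcS : Vec Bool E → Fin (suc k) → Fin s → Fin (suc k) → Fin s → Set)
  (edge-arc : ∀ {ω i x j y i≢j} → lookup ω (edge i x j y i≢j) ≡ sign i j → ArcS ω i x j y)
  (edge-arc-reverse : ∀ {ω i x j y i≢j} → lookup ω (edge i x j y i≢j) ≡ not (sign i j) → ArcS ω j y i x) where

  -- A pattern (i , B , T , σ) is avoided if there are no a and b for which all the arcs between B a and the entries of T b
  -- outside class i have the directions σ; a link (i , j , x , x′ , b) is missed if x → y → x′ for no y in block b of class j.
  ifProper : ∀ {P : Set} → Dec P → (P → Vec Bool E → Bool) → Vec Bool E → Bool
  ifProper (yes p) f = f p
  ifProper (no _)  f = const false

  -- An improper index gives the empty event, so the union may run over a full product.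
  size-ifProper : ∀ {P : Set} (P? : Dec P) {f K L} → (∀ p → size (f p) * K ≡ L) → size (ifProper P? f) * K ≤ L
  size-ifProper (yes p) h = ℕₚ.≤-reflexive (h p)
  size-ifProper (no _) {K = K} h = ℕₚ.≤-trans (ℕₚ.≤-reflexive (cong (_* K) (size-false E))) z≤n

  ifProper-false : ∀ {P : Set} (P? : Dec P) {f ω} → ifProper P? f ω ≡ false → P → ∃ λ p → f p ω ≡ false
  ifProper-false (yes p) eq _ = p , eq
  ifProper-false (no ¬p) _  p = contradiction p ¬p

  module _ (m : ℕ) where

    Pattern : Set
    Pattern = Fin (suc k) × Vec (Fin s) m × Vec (Vec (Fin s) (suc k)) m × Vec Bool (suc k)

    patterns : Listing Pattern (suc k * (s ^ m * ((s ^ suc k) ^ m * 2 ^ suc k)))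
    patterns = pairs (fins (suc k)) (pairs (vecs (fins s) m) (pairs (vecs (vecs (fins s) (suc k)) m) (vecs bools (suc k))))

    Distinct : Pattern → Set
    Distinct (i , B , T , σ) = (∀ a b → lookup B a ≡ lookup B b → a ≡ b) ×
      (∀ j → j ≢ i → ∀ a b → lookup (lookup T a) j ≡ lookup (lookup T b) j → a ≡ b)

    distinct? : ∀ π → Dec (Distinct π)
    distinct? (i , B , T , σ) = (Finₚ.all? λ a → Finₚ.all? λ b → (lookup B a Finₚ.≟ lookup B b) →-dec (a Finₚ.≟ b)) ×-dec
      (Finₚ.all? λ j → ¬? (j Finₚ.≟ i) →-dec Finₚ.all? λ a → Finₚ.all? λ b →
        (lookup (lookup T a) j Finₚ.≟ lookup (lookup T b) j) →-dec (a Finₚ.≟ b))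

    patternEdge : Pattern → Fin (m * m) → Fin k → Fin E
    patternEdge (i , B , T , σ) p l = let a , b = remQuot {m} m p in
      edge i (lookup B a) (punchIn i l) (lookup (lookup T b) (punchIn i l)) (Finₚ.punchInᵢ≢i i l ∘ sym)

    directedSign : Bool → Fin (suc k) → Fin (suc k) → Bool
    directedSign true  i j = sign i j
    directedSign false i j = not (sign i j)

    patternSign : Pattern → Fin (m * m) → Fin k → Bool
    patternSign (i , B , T , σ) p l = directedSign (lookup σ (punchIn i l)) i (punchIn i l)

    -- The first end determines `a`, the second the class and `b`. The ends cannot be interchanged,
    -- as the second one is never in class `i`.
    patternEdge-injective : ∀ π → Distinct π → ∀ {p l p′ l′} → patternEdge π p l ≡ patternEdge π p′ l′ → p ≡ p′ × l ≡ l′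
    patternEdge-injective π@(i , B , T , σ) (B! , T!) {p} {l} {p′} {l′} eq with edge-injective eq
    ... | inj₂ ((i≡ , _) , _) = contradiction (sym i≡) (Finₚ.punchInᵢ≢i i l′)
    ... | inj₁ ((_ , B≡) , j≡ , T≡) with refl ← Finₚ.punchIn-injective i l l′ j≡ =
      trans (sym (Finₚ.combine-remQuot {m} m p)) (trans (cong₂ combine (B! _ _ B≡) (T! (punchIn i l) (Finₚ.punchInᵢ≢i i l) _ _ T≡))
        (Finₚ.combine-remQuot {m} m p′)) , refl

    avoids : Pattern → Vec Bool E → Bool
    avoids π = ifProper (distinct? π) λ _ → noneMatches (patternEdge π) (patternSign π)

    -- The `m * m` pairs are independent trials, each failing with probability `y / 2 ^ k`.
    size-avoids : ∀ {y} → 2 ^ k ≡ suc y → ∀ π → size (avoids π) * (2 ^ k) ^ (m * m) ≤ y ^ (m * m) * 2 ^ E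
    size-avoids eq π = size-ifProper (distinct? π) λ distinct →
      size-noneMatches (patternEdge π) (patternSign π) (patternEdge-injective π distinct) eq

    directedSign-arc : ∀ σ {ω i x j y i≢j} → lookup ω (edge i x j y i≢j) ≡ directedSign σ i j → Directed (ArcS ω) σ i x j y
    directedSign-arc true  = edge-arc
    directedSign-arc false = edge-arc-reverse

    realises : ∀ ω i B T σ → Distinct (i , B , T , σ) → avoids (i , B , T , σ) ω ≡ false →
      ∃₂ λ a b → ∀ j → j ≢ i → Directed (ArcS ω) (lookup σ j) i (lookup B a) j (lookup (lookup T b) j)
    realises ω i B T σ distinct eq
      with _ , eq′ ← ifProper-false (distinct? (i , B , T , σ)) eq distinct
      with p , matched ← noneMatches-false (patternEdge (i , B , T , σ)) (patternSign (i , B , T , σ)) ω eq′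
      = proj₁ (remQuot {m} m p) , proj₂ (remQuot {m} m p) , λ j j≢i → subst
          (λ j → Directed (ArcS ω) (lookup σ j) i (lookup B _) j (lookup (lookup T _) j))
          (Finₚ.punchIn-punchOut (j≢i ∘ sym)) (directedSign-arc (lookup σ (punchIn i (Fin.punchOut (j≢i ∘ sym)))) (matched (Fin.punchOut (j≢i ∘ sym))))

    tabulate-entry : ∀ (T : Fin m → Tuple (suc k) s) a j → lookup (lookup (tabulate (tabulate ∘ T)) a) j ≡ T a j
    tabulate-entry T a j = trans (cong (λ t → lookup t j) (Vecₚ.lookup∘tabulate (tabulate ∘ T) a)) (Vecₚ.lookup∘tabulate (T a) j)

    tabulate-Distinct : ∀ i (B : Fin m → Fin s) (T : Fin m → Tuple (suc k) s) σ →
      (∀ {a b} → B a ≡ B b → a ≡ b) → (∀ {j} → j ≢ i → ∀ {a b} → T a j ≡ T b j → a ≡ b) →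
      Distinct (i , tabulate B , tabulate (tabulate ∘ T) , σ)
    tabulate-Distinct i B T σ B! T! =
      (λ a b eq → B! (trans (sym (Vecₚ.lookup∘tabulate B a)) (trans eq (Vecₚ.lookup∘tabulate B b))))
      , λ j j≢i a b eq → T! j≢i (trans (sym (tabulate-entry T a j)) (trans eq (tabulate-entry T b j)))

    avoidsNone⇒mixing : ∀ ω → anyᵇ (λ π → avoids π ω) (elements patterns) ≡ false → Mixing (ArcS ω) m
    avoidsNone⇒mixing ω none i B T σ B! T!
      with a , b , directed ← realises ω i (tabulate B) (tabulate (tabulate ∘ T)) (tabulate σ)
        (tabulate-Distinct i B T (tabulate σ) B! T!)
        (any-false (λ π → avoids π ω) (elements patterns) none (complete patterns (i , tabulate B , tabulate (tabulate ∘ T) , tabulate σ)))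
      = a , b , λ j j≢i → transport i j (Vecₚ.lookup∘tabulate σ j) (Vecₚ.lookup∘tabulate B a) (tabulate-entry T b j) (directed j j≢i)
      where
      transport : ∀ i j {σ σ′ x x′ y y′} → σ ≡ σ′ → x ≡ x′ → y ≡ y′ → Directed (ArcS ω) σ i x j y → Directed (ArcS ω) σ′ i x′ j y′
      transport _ _ refl refl refl d = d

  module _ {d β : ℕ} (block : Fin d → Fin β → Fin s) (block-injective : ∀ {a b l l′} → block a l ≡ block b l′ → a ≡ b × l ≡ l′) where

    Link : Set
    Link = Fin (suc k) × Fin (suc k) × Fin s × Fin s × Fin d

    links : Listing Link (suc k * (suc k * (s * (s * d))))
    links = pairs (fins (suc k)) (pairs (fins (suc k)) (pairs (fins s) (pairs (fins s) (fins d))))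

    Proper : Link → Set
    Proper (i , j , x , x′ , _) = i ≢ j × x ≢ x′

    proper? : ∀ ℓ → Dec (Proper ℓ)
    proper? (i , j , x , x′ , _) = ¬? (i Finₚ.≟ j) ×-dec ¬? (x Finₚ.≟ x′)

    linkEdge : ∀ ℓ → Proper ℓ → Fin β → Fin 2 → Fin E
    linkEdge (i , j , x , x′ , b) (i≢j , _) l zero       = edge i x j (block b l) i≢j
    linkEdge (i , j , x , x′ , b) (i≢j , _) l (suc zero) = edge j (block b l) i x′ (i≢j ∘ sym)

    linkSign : Link → Fin β → Fin 2 → Bool
    linkSign (i , j , _) l zero       = sign i j
    linkSign (i , j , _) l (suc zero) = sign j i

    -- The edges at `x` differ from those at `x′` because `x ≢ x′`, and within either family the
    -- block vertex determines `l`.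
    linkEdge-injective : ∀ ℓ proper {l c l′ c′} → linkEdge ℓ proper l c ≡ linkEdge ℓ proper l′ c′ → l ≡ l′ × c ≡ c′
    linkEdge-injective ℓ (i≢j , x≢x′) {c = zero} {c′ = zero} eq with edge-injective eq
    ... | inj₁ (_ , _ , y≡)  = proj₂ (block-injective y≡) , refl
    ... | inj₂ ((i≡j , _) , _) = contradiction i≡j i≢j
    linkEdge-injective ℓ (i≢j , x≢x′) {c = zero} {c′ = suc zero} eq with edge-injective eq
    ... | inj₁ ((i≡j , _) , _)  = contradiction i≡j i≢j
    ... | inj₂ ((_ , x≡x′) , _) = contradiction x≡x′ x≢x′
    linkEdge-injective ℓ (i≢j , x≢x′) {c = suc zero} {c′ = zero} eq with edge-injective eq
    ... | inj₁ ((j≡i , _) , _)  = contradiction (sym j≡i) i≢j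
    ... | inj₂ (_ , _ , x′≡x) = contradiction (sym x′≡x) x≢x′
    linkEdge-injective ℓ (i≢j , x≢x′) {c = suc zero} {c′ = suc zero} eq with edge-injective eq
    ... | inj₁ ((_ , y≡) , _)  = proj₂ (block-injective y≡) , refl
    ... | inj₂ ((j≡i , _) , _) = contradiction (sym j≡i) i≢j

    misses : Link → Vec Bool E → Bool
    misses ℓ = ifProper (proper? ℓ) λ proper → noneMatches (linkEdge ℓ proper) (linkSign ℓ)

    -- Each vertex of the block fails with probability `3 / 4`, independently of the others.
    size-misses : ∀ ℓ → size (misses ℓ) * (2 ^ 2) ^ β ≤ 3 ^ β * 2 ^ E
    size-misses ℓ = size-ifProper (proper? ℓ) λ proper →
      size-noneMatches {g = 2} {y = 3} (linkEdge ℓ proper) (linkSign ℓ) (linkEdge-injective ℓ proper) refl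

    missesNone⇒connecting : ∀ ω → anyᵇ (λ ℓ → misses ℓ ω) (elements links) ≡ false → Connecting (ArcS ω) block
    missesNone⇒connecting ω none i j x x′ i≢j x≢x′ b
      with proper , eq ← ifProper-false (proper? (i , j , x , x′ , b))
        (any-false (λ ℓ → misses ℓ ω) (elements links) none (complete links (i , j , x , x′ , b))) (i≢j , x≢x′)
      with l , matched ← noneMatches-false (linkEdge (i , j , x , x′ , b) proper) (linkSign (i , j , x , x′ , b)) ω eq
      = l , edge-arc (matched zero) , edge-arc (matched (suc zero))

-- Turns a union bound over `N` events of probability at most `L / K` into the probability bound
-- `1 / D`.
size-scale : ∀ {m} (p : Vec Bool m → Bool) {K N L D} .{{_ : NonZero K}} →
  size p * K ≤ N * (L * 2 ^ m) → N * L * D ≤ K → size p * D ≤ 2 ^ m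
size-scale {m} p {K} {N} {L} {D} bound small = ℕₚ.*-cancelʳ-≤ (size p * D) (2 ^ m) K (begin
  size p * D * K              ≡⟨ swapLast (size p) D K ⟩
  size p * K * D              ≤⟨ ℕₚ.*-monoˡ-≤ D bound ⟩
  N * (L * 2 ^ m) * D         ≡⟨ shuffle N L (2 ^ m) D ⟩
  2 ^ m * (N * L * D)         ≤⟨ ℕₚ.*-monoʳ-≤ (2 ^ m) small ⟩
  2 ^ m * K                   ∎)
  where
  open ℕₚ.≤-Reasoning
  swapLast : ∀ a b c → a * b * c ≡ a * c * b
  swapLast = solve-∀
  shuffle : ∀ a b c d → a * (b * c) * d ≡ c * (a * b * d)
  shuffle = solve-∀

foldr-⊓-least : ∀ {k} x (f : Fin k → ℕ) {v} → v ≤ x → (∀ i → v ≤ f i) → v ≡ x ⊎ (∃ λ i → v ≡ f i) →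
  foldr ℕ._⊓_ x f ≡ v
foldr-⊓-least x f v≤x v≤f attained = ℕₚ.≤-antisym (upper x f attained) (lower x f v≤x v≤f)
  where
  lower : ∀ {k} x (f : Fin k → ℕ) {v} → v ≤ x → (∀ i → v ≤ f i) → v ≤ foldr ℕ._⊓_ x f
  lower {zero}  x f v≤x v≤f = v≤x
  lower {suc k} x f v≤x v≤f = ℕₚ.⊓-glb (v≤f zero) (lower x (f ∘ suc) v≤x (v≤f ∘ suc))
  upper : ∀ {k} x (f : Fin k → ℕ) {v} → v ≡ x ⊎ (∃ λ i → v ≡ f i) → foldr ℕ._⊓_ x f ≤ v
  upper {zero}  x f (inj₁ refl)           = ℕₚ.≤-refl
  upper {suc k} x f (inj₁ refl)           = ℕₚ.≤-trans (ℕₚ.m⊓n≤n (f zero) _) (upper x (f ∘ suc) (inj₁ refl))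
  upper {suc k} x f (inj₂ (zero , refl))  = ℕₚ.m⊓n≤m (f zero) _
  upper {suc k} x f (inj₂ (suc i , refl)) = ℕₚ.≤-trans (ℕₚ.m⊓n≤n (f zero) _) (upper x (f ∘ suc) (inj₂ (i , refl)))

smallestClassSize-last : ∀ {k} (k≥2 : 2 ≤ suc k) (n : Fin (suc k) → ℕ) → (∀ i → n (fromℕ k) ≤ n i) →
  smallestClassSize k≥2 n ≡ n (fromℕ k)
smallestClassSize-last {zero}  (s≤s ()) _ _
smallestClassSize-last {suc k} k≥2 n least = foldr-⊓-least (n zero) (n ∘ suc) (least zero) (least ∘ suc) (inj₂ (fromℕ k , refl))

module _ {k : ℕ} (n : Fin (suc k) → ℕ) (least : ∀ i → n (fromℕ k) ≤ n i) where

  private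
    s E : ℕ
    s = n (fromℕ k)
    E = length (edges n)

  open Embedding n least
  open TournamentModel n using (edge; edge-injective; edge-Arc; edge-Arc-reverse; Arc-asym; Arc-classes; ∈-vertices)

  embeddedEdge : (i : Fin (suc k)) → Fin s → (j : Fin (suc k)) → Fin s → i ≢ j → Fin E
  embeddedEdge i x j y = edge (embed i x) (embed j y)

  embeddedEdge-injective : ∀ {i x j y i≢j i′ x′ j′ y′ i′≢j′} → embeddedEdge i x j y i≢j ≡ embeddedEdge i′ x′ j′ y′ i′≢j′ →
    ((i ≡ i′ × x ≡ x′) × (j ≡ j′ × y ≡ y′)) ⊎ ((i ≡ j′ × x ≡ y′) × (j ≡ i′ × y ≡ x′))
  embeddedEdge-injective {i≢j = i≢j} {i′≢j′ = i′≢j′} eq with edge-injective {u≢v = i≢j} {u′≢v′ = i′≢j′} eq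
  ... | inj₁ (p , q) = inj₁ (embed-injective p , embed-injective q)
  ... | inj₂ (p , q) = inj₂ (embed-injective p , embed-injective q)

  open Events embeddedEdge (λ {i} {x} {j} {y} {i≢j} → embeddedEdge-injective {i} {x} {j} {y} {i≢j})
    (λ i j → does (i Fin.<? j)) (λ ω → ArcS (tournament n ω))
    (λ {ω} {i} {x} {j} {y} {i≢j} → edge-Arc ω {u≢v = i≢j}) (λ {ω} {i} {x} {j} {y} {i≢j} → edge-Arc-reverse ω {u≢v = i≢j})

  module _ {m δ β : ℕ} (blocks≤s : (δ + δ) * β ≤ s) where

    block : Fin (δ + δ) → Fin β → Fin s
    block b l = inject≤ (combine b l) blocks≤s

    block-injective : ∀ {a b l l′} → block a l ≡ block b l′ → a ≡ b × l ≡ l′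
    block-injective {a} {b} {l} {l′} eq = Finₚ.combine-injective a l b l′ (Finₚ.inject≤-injective _ _ _ _ eq)

    bad-avoids bad-misses bad : Orientation n → Bool
    bad-avoids ω = anyᵇ (λ π → avoids m π ω) (Listing.elements (patterns m))
    bad-misses ω = anyᵇ (λ ℓ → misses block block-injective ℓ ω) (Listing.elements (links block block-injective))
    bad ω        = bad-avoids ω ∨ bad-misses ω

    extremal : ∀ ω → bad ω ≡ false → suc k ≤ s →
      k + (tileGroupSize (suc k) (2 ^ suc k * m) * suc k + (suc k * (2 ^ suc k * m) + cliqueBound (suc k) (2 ^ suc k * m))) ≤ δ → δ ≤ s →
      IsMaximum (EveryFASContains (tournament n ω) (suc k)) (s ∸ k)
    extremal ω good room budget δ≤s =
        LowerBound.lowerBound n least (tournament n ω) (vertices n) ∈-vertices block (proj₁ ∘ block-injective)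
          (avoidsNone⇒mixing m ω (proj₁ both)) (missesNone⇒connecting block block-injective ω (proj₂ both)) zero budget δ≤s
      , λ t → UpperBound.upperBound n room (tournament n ω) (Arc-asym ω) (Arc-classes ω)
      where
      both : bad-avoids ω ≡ false × bad-misses ω ≡ false
      both = ∨-false (bad-avoids ω) good
        where
        ∨-false : ∀ a {b} → a ∨ b ≡ false → a ≡ false × b ≡ false
        ∨-false false eq = refl , eq

    -- Each of the two kinds of failure is allowed probability `1 / (2 * D)`.
    size-bad : ∀ {y D} → 2 ^ k ≡ suc y →
      suc k * (s ^ m * ((s ^ suc k) ^ m * 2 ^ suc k)) * y ^ (m * m) * (2 * D) ≤ (2 ^ k) ^ (m * m) →
      suc k * (suc k * (s * (s * (δ + δ)))) * 3 ^ β * (2 * D) ≤ 4 ^ β →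
      size bad * D ≤ 2 ^ E
    size-bad {y} {D} eq few-patterns few-links = ℕₚ.*-cancelˡ-≤ 2 (begin
      2 * (size bad * D)                                             ≡⟨ shuffle (size bad) D ⟩
      size bad * (2 * D)                                             ≤⟨ ℕₚ.*-monoˡ-≤ (2 * D) (size-∨ bad-avoids bad-misses) ⟩
      (size bad-avoids + size bad-misses) * (2 * D)                  ≡⟨ ℕₚ.*-distribʳ-+ (2 * D) (size bad-avoids) _ ⟩
      size bad-avoids * (2 * D) + size bad-misses * (2 * D)          ≤⟨ ℕₚ.+-mono-≤ avoids-bound misses-bound ⟩
      2 ^ E + 2 ^ E                                                  ≡⟨ cong (2 ^ E +_) (ℕₚ.+-identityʳ _) ⟨
      2 * 2 ^ E                                                      ∎)
      where
      open ℕₚ.≤-Reasoning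
      shuffle : ∀ a b → 2 * (a * b) ≡ a * (2 * b)
      shuffle = solve-∀
      avoids-bound : size bad-avoids * (2 * D) ≤ 2 ^ E
      avoids-bound = size-scale bad-avoids {K = (2 ^ k) ^ (m * m)} {N = suc k * (s ^ m * ((s ^ suc k) ^ m * 2 ^ suc k))} {L = y ^ (m * m)} {{ℕₚ.m^n≢0 (2 ^ k) (m * m) {{ℕₚ.m^n≢0 2 k}}}}
        (subst (λ N → size bad-avoids * (2 ^ k) ^ (m * m) ≤ N * (y ^ (m * m) * 2 ^ E)) (Listing.elements-length (patterns m))
          (size-any (avoids m) (Listing.elements (patterns m)) (size-avoids m eq))) few-patterns
      misses-bound : size bad-misses * (2 * D) ≤ 2 ^ E
      misses-bound = size-scale bad-misses {K = 4 ^ β} {N = suc k * (suc k * (s * (s * (δ + δ))))} {L = 3 ^ β} {{ℕₚ.m^n≢0 4 β}}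
        (subst (λ N → size bad-misses * 4 ^ β ≤ N * (3 ^ β * 2 ^ E)) (Listing.elements-length (links block block-injective))
          (size-any (misses block block-injective) (Listing.elements (links block block-injective)) (size-misses block block-injective))) few-links

-- Choice of the parameters

m<2^m : ∀ m → m < 2 ^ m
m<2^m zero    = s≤s z≤n
m<2^m (suc m) = ℕₚ.≤-trans (ℕₚ.≤-reflexive (ℕₚ.+-comm 1 (suc m)))
  (ℕₚ.+-mono-≤ (m<2^m m) (ℕₚ.≤-trans (ℕₚ.m^n>0 2 m) (ℕₚ.m≤m+n (2 ^ m) 0)))

-- The first two terms of the binomial expansion.
bernoulli : ∀ a p → a ^ suc p + suc p * a ^ p ≤ suc a ^ suc p
bernoulli a zero    = ℕₚ.≤-reflexive (base a)
  where
  base : ∀ a → a * 1 + 1 ≡ suc a * 1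
  base = solve-∀
bernoulli a (suc p) = begin
  a * (a * a ^ p) + suc (suc p) * (a * a ^ p)                                 ≤⟨ ℕₚ.m≤m+n _ (suc p * a ^ p) ⟩
  a * (a * a ^ p) + suc (suc p) * (a * a ^ p) + suc p * a ^ p                 ≡⟨ expand a p (a ^ p) ⟩
  suc a * (a * a ^ p + suc p * a ^ p)                                         ≤⟨ ℕₚ.*-monoʳ-≤ (suc a) (bernoulli a p) ⟩
  suc a * suc a ^ suc p                                                       ∎
  where
  open ℕₚ.≤-Reasoning
  expand : ∀ a p x → a * (a * x) + suc (suc p) * (a * x) + suc p * x ≡ suc a * (a * x + suc p * x)
  expand = solve-∀

^-distribʳ-* : ∀ a b t → (a * b) ^ t ≡ a ^ t * b ^ t
^-distribʳ-* a b zero    = refl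
^-distribʳ-* a b (suc t) = trans (cong (a * b *_) (^-distribʳ-* a b t)) (interchange a b (a ^ t) (b ^ t))
  where
  interchange : ∀ a b c d → a * b * (c * d) ≡ a * c * (b * d)
  interchange = solve-∀

-- By `bernoulli`, `(1 + 1 / y) ^ y` is at least 2: so `y` independent trials with failure
-- probability `y / (y + 1)` all fail with probability at most one half.
halving : ∀ y .{{_ : NonZero y}} t → y ^ (y * t) * 2 ^ t ≤ suc y ^ (y * t)
halving y@(suc p) t = begin
  y ^ (y * t) * 2 ^ t         ≡⟨ cong (_* 2 ^ t) (ℕₚ.^-*-assoc y y t) ⟨
  (y ^ y) ^ t * 2 ^ t         ≡⟨ ^-distribʳ-* (y ^ y) 2 t ⟨
  (y ^ y * 2) ^ t             ≤⟨ ℕₚ.^-monoˡ-≤ t (ℕₚ.≤-trans (ℕₚ.≤-reflexive (double (y ^ y))) (bernoulli y p)) ⟩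
  (suc y ^ y) ^ t             ≡⟨ ℕₚ.^-*-assoc (suc y) y t ⟩
  suc y ^ (y * t)             ∎
  where
  open ℕₚ.≤-Reasoning
  double : ∀ a → a * 2 ≡ a + a
  double = solve-∀

-- The base `2 ^ 4` leaves room for the four factors up to `2 ^ q` in `blocks-fit`.
log₁₆ : ∀ s → 1 ≤ s → ∃ λ q → 16 ^ q ≤ s × s < 16 ^ suc q
log₁₆ (suc zero)    _ = 0 , ℕₚ.≤-refl , s≤s (s≤s z≤n)
log₁₆ (suc (suc s)) _ with q , lower , upper ← log₁₆ (suc s) (s≤s z≤n) with suc (suc s) ℕₚ.<? 16 ^ suc q
... | yes < = q , ℕₚ.m≤n⇒m≤1+n lower , <
... | no ≮  = suc q , ℕₚ.≮⇒≥ ≮ , ℕₚ.<-≤-trans (s≤s upper) (ℕₚ.^-monoʳ-< 16 (s≤s (s≤s z≤n)) (ℕₚ.n<1+n (suc q)))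

log₁₆-≥ : ∀ {C q s} → 16 ^ C ≤ s → s < 16 ^ suc q → C ≤ q
log₁₆-≥ {C} {q} ≤s s< = ℕₚ.≮⇒≥ λ q<C → ℕₚ.<⇒≱ s< (ℕₚ.≤-trans (ℕₚ.^-monoʳ-≤ 16 q<C) ≤s)

^-bound : ∀ {a b} e n → a ≤ 2 ^ e → b ≡ e * n → a ^ n ≤ 2 ^ b
^-bound e n a≤ refl = ℕₚ.≤-trans (ℕₚ.^-monoˡ-≤ n a≤) (ℕₚ.≤-reflexive (ℕₚ.^-*-assoc 2 e n))

*-bound : ∀ {a b} d e → a ≤ 2 ^ d → b ≤ 2 ^ e → a * b ≤ 2 ^ (d + e)
*-bound d e a≤ b≤ = ℕₚ.≤-trans (ℕₚ.*-mono-≤ a≤ b≤) (ℕₚ.≤-reflexive (sym (ℕₚ.^-distribˡ-+-* 2 d e)))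

2*-bound : ∀ D → 2 * D ≤ 2 ^ suc D
2*-bound D = ℕₚ.*-monoʳ-≤ 2 (ℕₚ.<⇒≤ (m<2^m D))

-- The degree demanded by `lowerBound` for `suc k` classes.
reach : ℕ → ℕ → ℕ
reach k M = k + (tileGroupSize (suc k) M * suc k + (suc k * M + cliqueBound (suc k) M))

-- `reach` is a quadratic polynomial in `M`. With `M` logarithmic in `s`, the demanded degree is
-- therefore only polylogarithmic.
reach-scales : ∀ k q M → reach k (suc q * M) ≤ suc q * suc q * reach k M
reach-scales k q M = begin
  reach k (z * M)                                                       ≤⟨ ℕₚ.+-mono-≤ (ℕₚ.m≤n*m k (z * z)) (ℕₚ.+-mono-≤
    (ℕₚ.*-monoˡ-≤ (suc k) (ℕₚ.+-mono-≤ (ℕₚ.*-monoʳ-≤ (z * M) (ℕₚ.+-mono-≤ bound bound)) (ℕₚ.m≤n*m (z * M) z)))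
    (ℕₚ.+-mono-≤ (ℕₚ.m≤n*m (suc k * (z * M)) z) (ℕₚ.≤-trans bound (ℕₚ.m≤n*m (z * Q) z)))) ⟩
  z * z * k + ((z * M * (z * Q + z * Q) + z * (z * M)) * suc k + (z * (suc k * (z * M)) + z * (z * Q)))  ≡⟨ factor z k M Q ⟩
  z * z * reach k M                                                     ∎
  where
  open ℕₚ.≤-Reasoning
  z Q : ℕ
  z = suc q
  Q = cliqueBound (suc k) M
  bound : cliqueBound (suc k) (z * M) ≤ z * Q
  bound = begin
    suc (suc k * (z * M))        ≤⟨ s≤s (ℕₚ.m≤n+m _ q) ⟩
    z + suc k * (z * M)          ≡⟨ collect z k M ⟩
    z * Q                        ∎
    where
    collect : ∀ z k M → z + suc k * (z * M) ≡ z * suc (suc k * M)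
    collect = solve-∀
  factor : ∀ z k M Q → z * z * k + ((z * M * (z * Q + z * Q) + z * (z * M)) * suc k + (z * (suc k * (z * M)) + z * (z * Q)))
    ≡ z * z * (k + ((M * (Q + Q) + M) * suc k + (suc k * M + Q)))
  factor = solve-∀

-- All thresholds in terms of the number z = suc q of hexadecimal digits of s; D is the reciprocal of the error probability.
module Parameters (k D y : ℕ) .{{_ : NonZero y}} (q : ℕ) where

  z P m₁ m δ₁ δ t₁ β : ℕ
  z  = suc q
  -- As exponents of 2, the summands pay for the choices of `B` and `T`, for those of `i` and `σ`,
  -- and for the factor `2 * D`.
  P  = 4 + 4 * suc k + (suc k + suc k) + suc D
  m₁ = y * P
  -- The factor `y` makes `m * m` a multiple of `y`, as `halving` requires.
  m  = y * (z * P)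
  δ₁ = reach k (2 ^ suc k * m₁)
  δ  = z * z * δ₁
  -- This pays for two classes, for three numbers up to `2 ^ (4 * z)`, namely `x`, `x′` and the
  -- block, and for the factor `2 * D`. The 3 in `β` is the `y` of `halving`.
  t₁ = suc k + suc k + 12 + suc D
  β  = 3 * (z * t₁)

  m-positive : 1 ≤ z * m
  m-positive = ℕₚ.*-mono-≤ {1} {z} (s≤s z≤n) (ℕₚ.*-mono-≤ {1} {y} {1} (ℕ.>-nonZero⁻¹ y) (ℕₚ.*-mono-≤ {1} {z} {1} {P} (s≤s z≤n) (s≤s z≤n)))

  reach≤δ : reach k (2 ^ suc k * m) ≤ δ
  reach≤δ = ℕₚ.≤-trans (ℕₚ.≤-reflexive (cong (reach k) (rearrange (2 ^ suc k) y z P))) (reach-scales k q (2 ^ suc k * m₁))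
    where
    rearrange : ∀ a y z P → a * (y * (z * P)) ≡ z * (a * (y * P))
    rearrange = solve-∀

  -- The number of patterns times `2 * D` is at most `2 ^ (z * P * m)`, which is what `halving` wins
  -- from `m * m` trials.
  few-patterns : ∀ {s} → s ≤ 2 ^ (4 * z) →
    suc k * (s ^ m * ((s ^ suc k) ^ m * 2 ^ suc k)) * y ^ (m * m) * (2 * D) ≤ suc y ^ (m * m)
  few-patterns {s} s≤ = begin
    N * y ^ (m * m) * (2 * D)           ≡⟨ swapLast N (y ^ (m * m)) (2 * D) ⟩
    N * (2 * D) * y ^ (m * m)           ≤⟨ ℕₚ.*-monoˡ-≤ (y ^ (m * m)) (ℕₚ.≤-trans (*-bound (K + (4 * z * m + (4 * z * K * m + K))) (suc D)
      (*-bound K (4 * z * m + (4 * z * K * m + K)) (ℕₚ.<⇒≤ (m<2^m K)) (*-bound (4 * z * m) (4 * z * K * m + K) (^-bound (4 * z) m s≤ refl)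
        (*-bound (4 * z * K * m) K (^-bound (4 * z * K) m (^-bound (4 * z) K s≤ refl) refl) ℕₚ.≤-refl))) (2*-bound D))
      (ℕₚ.^-monoʳ-≤ 2 exponent)) ⟩
    2 ^ (z * P * m) * y ^ (m * m)       ≡⟨ cong (λ e → 2 ^ (z * P * m) * y ^ e) (ℕₚ.*-assoc y (z * P) m) ⟩
    2 ^ (z * P * m) * y ^ (y * (z * P * m))   ≡⟨ ℕₚ.*-comm (2 ^ (z * P * m)) _ ⟩
    y ^ (y * (z * P * m)) * 2 ^ (z * P * m)   ≤⟨ halving y (z * P * m) ⟩
    suc y ^ (y * (z * P * m))           ≡⟨ cong (suc y ^_) (ℕₚ.*-assoc y (z * P) m) ⟨
    suc y ^ (m * m)                     ∎
    where
    open ℕₚ.≤-Reasoning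
    K N : ℕ
    K = suc k
    N = K * (s ^ m * ((s ^ K) ^ m * 2 ^ K))
    swapLast : ∀ a b c → a * b * c ≡ a * c * b
    swapLast = solve-∀
    exponent : K + (4 * z * m + (4 * z * K * m + K)) + suc D ≤ z * P * m
    exponent = begin
      K + (4 * z * m + (4 * z * K * m + K)) + suc D                           ≡⟨ collect K z m (suc D) ⟩
      4 * z * m + 4 * z * K * m + (K + K + suc D)                             ≤⟨ ℕₚ.+-monoʳ-≤ (4 * z * m + 4 * z * K * m)
        (ℕₚ.≤-trans (ℕₚ.≤-reflexive (sym (ℕₚ.*-identityˡ _))) (ℕₚ.*-monoˡ-≤ (K + K + suc D) m-positive)) ⟩
      4 * z * m + 4 * z * K * m + z * m * (K + K + suc D)                     ≡⟨ factor K z m (suc D) ⟩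
      z * P * m                                                               ∎
      where
      collect : ∀ K z m d → K + (4 * z * m + (4 * z * K * m + K)) + d ≡ 4 * z * m + 4 * z * K * m + (K + K + d)
      collect = solve-∀
      factor : ∀ K z m d → 4 * z * m + 4 * z * K * m + z * m * (K + K + d) ≡ z * (4 + 4 * K + (K + K) + d) * m
      factor = solve-∀

  few-links : ∀ {s} → s ≤ 2 ^ (4 * z) → δ + δ ≤ s →
    suc k * (suc k * (s * (s * (δ + δ)))) * 3 ^ β * (2 * D) ≤ 4 ^ β
  few-links {s} s≤ 2δ≤s = begin
    N * 3 ^ β * (2 * D)                 ≡⟨ swapLast N (3 ^ β) (2 * D) ⟩
    N * (2 * D) * 3 ^ β                 ≤⟨ ℕₚ.*-monoˡ-≤ (3 ^ β) (ℕₚ.≤-trans (*-bound (K + (K + (4 * z + (4 * z + 4 * z)))) (suc D)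
      (*-bound K _ (ℕₚ.<⇒≤ (m<2^m K)) (*-bound K _ (ℕₚ.<⇒≤ (m<2^m K)) (*-bound (4 * z) _ s≤ (*-bound (4 * z) (4 * z) s≤ (ℕₚ.≤-trans 2δ≤s s≤)))))
      (2*-bound D)) (ℕₚ.^-monoʳ-≤ 2 exponent)) ⟩
    2 ^ (z * t₁) * 3 ^ β                ≡⟨ ℕₚ.*-comm (2 ^ (z * t₁)) (3 ^ β) ⟩
    3 ^ β * 2 ^ (z * t₁)                ≤⟨ halving 3 (z * t₁) ⟩
    4 ^ β                               ∎
    where
    open ℕₚ.≤-Reasoning
    K N : ℕ
    K = suc k
    N = K * (K * (s * (s * (δ + δ))))
    swapLast : ∀ a b c → a * b * c ≡ a * c * b
    swapLast = solve-∀
    exponent : K + (K + (4 * z + (4 * z + 4 * z))) + suc D ≤ z * t₁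
    exponent = begin
      K + (K + (4 * z + (4 * z + 4 * z))) + suc D       ≡⟨ collect K z (suc D) ⟩
      z * 12 + (K + K + suc D)                          ≤⟨ ℕₚ.+-monoʳ-≤ (z * 12) (ℕₚ.m≤n*m (K + K + suc D) z) ⟩
      z * 12 + z * (K + K + suc D)                      ≡⟨ factor K z (suc D) ⟩
      z * t₁                                            ∎
      where
      collect : ∀ K z d → K + (K + (4 * z + (4 * z + 4 * z))) + d ≡ z * 12 + (K + K + d)
      collect = solve-∀
      factor : ∀ K z d → z * 12 + z * (K + K + d) ≡ z * (K + K + 12 + d)
      factor = solve-∀

  -- The product is `z * z * z` times a constant that is at most `q`, and all four factors are at
  -- most `2 ^ q`.
  blocks-fit : 6 * (δ₁ * t₁) ≤ q → (δ + δ) * β ≤ 16 ^ q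
  blocks-fit C≤q = begin
    (δ + δ) * β                                     ≡⟨ collect z δ₁ t₁ ⟩
    z * (z * (z * (6 * (δ₁ * t₁))))                 ≤⟨ *-bound q _ (m<2^m q) (*-bound q _ (m<2^m q) (*-bound q q (m<2^m q) (ℕₚ.≤-trans C≤q (ℕₚ.<⇒≤ (m<2^m q))))) ⟩
    2 ^ (q + (q + (q + q)))                         ≡⟨ cong (2 ^_) (fourfold q) ⟩
    2 ^ (4 * q)                                     ≡⟨ ℕₚ.^-*-assoc 2 4 q ⟨
    16 ^ q                                          ∎
    where
    open ℕₚ.≤-Reasoning
    collect : ∀ z d t → (z * z * d + z * z * d) * (3 * (z * t)) ≡ z * (z * (z * (6 * (d * t))))
    collect = solve-∀
    fourfold : ∀ q → q + (q + (q + q)) ≡ 4 * q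
    fourfold = solve-∀

-- Probabilities

1≤p+q⇒1-q≤p : ∀ {p q} → 1ℚ ℚ.≤ p ℚ.+ q → 1ℚ ℚ.- q ℚ.≤ p
1≤p+q⇒1-q≤p {p} {q} h = begin
  1ℚ ℚ.- q               ≤⟨ ℚₚ.+-monoˡ-≤ (ℚ.- q) h ⟩
  p ℚ.+ q ℚ.- q          ≡⟨ ℚₚ.+-assoc p q (ℚ.- q) ⟩
  p ℚ.+ (q ℚ.- q)        ≡⟨ cong (p ℚ.+_) (ℚₚ.+-inverseʳ q) ⟩
  p ℚ.+ 0ℚ               ≡⟨ ℚₚ.+-identityʳ p ⟩
  p                      ∎
  where open ℚₚ.≤-Reasoning

-- The denominator of `ε` serves as `D`: the numerator is positive, so `1 / D` is at most `ε`.
errorReciprocal : ∀ ε → 0ℚ ℚ.< ε → ∃ λ D → ∀ W c b .{{_ : NonZero W}} → W ≤ c + b → b * D ≤ W → 1ℚ ℚ.- ε ℚ.≤ (ℤ.+ c) ℚ./ W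
errorReciprocal (mkℚ (ℤ.+ 0)       d-1 _) (ℚ.*<* (ℤ.+<+ ()))
errorReciprocal (mkℚ ℤ.-[1+ a ]    d-1 _) (ℚ.*<* ())
errorReciprocal ε@(mkℚ (ℤ.+ suc a) d-1 _) _ = suc d-1 , bound
  where
  bound : ∀ W c b .{{_ : NonZero W}} → W ≤ c + b → b * suc d-1 ≤ W → 1ℚ ℚ.- ε ℚ.≤ (ℤ.+ c) ℚ./ W
  bound W@(suc w) c b W≤ bD≤ = 1≤p+q⇒1-q≤p (ℚₚ.toℚᵘ-cancel-≤ (begin
    ℚ.toℚᵘ 1ℚ                                                ≤⟨ ℚᵘ.*≤* (subst₂ ℤ._≤_ (sym (ℤₚ.*-identityˡ _)) (trans
      (cong₂ ℤ._+_ (ℤₚ.pos-* c D) (ℤₚ.pos-* (suc a) W)) (sym (ℤₚ.*-identityʳ _))) (ℤ.+≤+ numerators)) ⟩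
    mkℚᵘ (ℤ.+ c) w ℚᵘ.+ ℚ.toℚᵘ ε                             ≃⟨ ℚᵘₚ.+-congˡ (ℚ.toℚᵘ ε) (ℚₚ.toℚᵘ-fromℚᵘ (mkℚᵘ (ℤ.+ c) w)) ⟨
    ℚ.toℚᵘ ((ℤ.+ c) ℚ./ W) ℚᵘ.+ ℚ.toℚᵘ ε                     ≃⟨ ℚₚ.toℚᵘ-homo-+ ((ℤ.+ c) ℚ./ W) ε ⟨
    ℚ.toℚᵘ ((ℤ.+ c) ℚ./ W ℚ.+ ε)                             ∎))
    where
    D : ℕ
    D = suc d-1
    numerators : W * D ≤ c * D + suc a * W
    numerators = ℕₚ.≤-trans (ℕₚ.*-monoˡ-≤ D W≤) (ℕₚ.≤-trans (ℕₚ.≤-reflexive (ℕₚ.*-distribʳ-+ D c b))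
      (ℕₚ.+-monoʳ-≤ (c * D) (ℕₚ.≤-trans bD≤ (ℕₚ.m≤m+n W (a * W)))))
    open ℚᵘₚ.≤-Reasoning

value-≡ : ∀ k s → k ≤ s → ℤ.+ (s ∸ k) ≡ ℤ.+ s ℤ.- ℤ.+ suc k ℤ.+ 1ℤ
value-≡ k s k≤s = trans (cancel (ℤ.+ k) (ℤ.+ (s ∸ k))) (cong (λ s → ℤ.+ s ℤ.- ℤ.+ suc k ℤ.+ 1ℤ) (ℕₚ.m+[n∸m]≡n k≤s))
  where
  cancel : ∀ a r → r ≡ (a ℤ.+ r) ℤ.- (1ℤ ℤ.+ a) ℤ.+ 1ℤ
  cancel = ℤ-Solver.solve-∀

-- `halving` asks for a positive `y`; the exponent `suc k` reflects that there are at least two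
-- classes.
predecessor-2^ : ∀ k → ∃ λ y → 2 ^ suc k ≡ suc y × NonZero y
predecessor-2^ k with 2 ^ k | ℕₚ.m^n>0 2 k
... | suc a | _ = a + suc (a + 0) , refl , subst NonZero (sym (ℕₚ.+-suc a (a + 0))) _

Pr-≥ : ∀ ε → 0ℚ ℚ.< ε → ∃ λ D → ∀ {m} {A : Pred (Vec Bool m) 0ℓ} {A? : Decidable A} →
  (∃ λ bad → size bad * D ≤ 2 ^ m × (∀ ω → bad ω ≡ false → A ω)) → 1ℚ ℚ.- ε ℚ.≤ Pr A A?
Pr-≥ ε ε>0 with D , bound ← errorReciprocal ε ε>0 = D , λ {m} {A} {A?} (bad , rare , good) →
  bound (2 ^ m) (length (filter A? (outcomes m))) (size bad) {{ℕₚ.m^n≢0 2 m}} (outcomes-≥ A? bad good) rare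

-- The constants `δ₁` and `t₁` do not involve `q`, so they can be taken at `q = 0`, before `s` and
-- hence `q` are known.
threshold : ∀ k D y .{{_ : NonZero y}} → ℕ
threshold k D y = 16 ^ (6 * (Parameters.δ₁ k D y 0 * Parameters.t₁ k D y 0))

badOrientations : ∀ {k D y} .{{_ : NonZero y}} (k≥2 : 2 ≤ suc k) → 2 ^ k ≡ suc y → (n : Fin (suc k) → ℕ) →
  (∀ i → n (fromℕ k) ≤ n i) → threshold k D y ≤ n (fromℕ k) →
  ∃ λ (bad : Orientation n → Bool) → size bad * D ≤ 2 ^ length (edges n) ×
    (∀ ω → bad ω ≡ false → f[ suc k , tournament n ω ]≡ (ℤ.+ smallestClassSize k≥2 n ℤ.- ℤ.+ suc k ℤ.+ 1ℤ))
badOrientations {k} {D} {y} k≥2 2^k≡ n least large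
  with q , 16^q≤s , s<16^z ← log₁₆ (n (fromℕ k)) (ℕₚ.≤-trans (ℕₚ.m^n>0 16 (6 * (Parameters.δ₁ k D y 0 * Parameters.t₁ k D y 0))) large)
  = bad n least {m} {δ} {β} fit
  , size-bad n least {m} {δ} {β} fit 2^k≡ (subst (λ X → suc k * (s ^ m * ((s ^ suc k) ^ m * 2 ^ suc k)) * y ^ (m * m) * (2 * D) ≤ X ^ (m * m))
      (sym 2^k≡) (few-patterns s≤2^)) (few-links s≤2^ 2δ≤s)
  , λ ω good → s ∸ k , trans (value-≡ k s (ℕₚ.≤-trans (ℕₚ.n≤1+n k) room))
      (cong (λ v → ℤ.+ v ℤ.- ℤ.+ suc k ℤ.+ 1ℤ) (sym (smallestClassSize-last k≥2 n least)))
    , extremal n least {m} {δ} {β} fit ω good room reach≤δ δ≤s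
  where
  open Parameters k D y q
  s : ℕ
  s = n (fromℕ k)
  fit : (δ + δ) * β ≤ s
  fit = ℕₚ.≤-trans (blocks-fit (log₁₆-≥ large s<16^z)) 16^q≤s
  2δ≤s : δ + δ ≤ s
  2δ≤s = ℕₚ.≤-trans (ℕₚ.m≤m*n (δ + δ) β) fit
  δ≤s : δ ≤ s
  δ≤s = ℕₚ.≤-trans (ℕₚ.m≤m+n δ δ) 2δ≤s
  s≤2^ : s ≤ 2 ^ (4 * z)
  s≤2^ = ℕₚ.≤-trans (ℕₚ.<⇒≤ s<16^z) (ℕₚ.≤-reflexive (ℕₚ.^-*-assoc 2 4 z))
  room : suc k ≤ s
  -- `reach` contains the summand `k` and a positive `cliqueBound`.
  room = ℕₚ.≤-trans (ℕₚ.≤-trans (ℕₚ.≤-reflexive (ℕₚ.+-comm 1 k)) (ℕₚ.+-monoʳ-≤ k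
    (ℕₚ.≤-trans (s≤s z≤n) (ℕₚ.m≤n+m (cliqueBound (suc k) (2 ^ suc k * m)) (tileGroupSize (suc k) (2 ^ suc k * m) * suc k + suc k * (2 ^ suc k * m))))))
    (ℕₚ.≤-trans (ℕₚ.≤-reflexive (cong (k +_) (ℕₚ.+-assoc (tileGroupSize (suc k) (2 ^ suc k * m) * suc k) _ _))) (ℕₚ.≤-trans reach≤δ δ≤s))

open import Data.Integer using (+_)

theorem1 : ∀ (k : ℕ) (k≥2 : 2 ≤ k) (ε : ℚ) → 0ℚ ℚ.< ε →
    ∃[ N ] (∀ (n : Fin k → ℕ) →
    (∀ i → 1 ≤ n i) →
    (∀ i → n (lastIndex k≥2) ≤ n i) →
    N ≤ n (lastIndex k≥2) →
    let value = + smallestClassSize k≥2 n ℤ.- + k ℤ.+ 1ℤ in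
    1ℚ ℚ.- ε ℚ.≤ Pr (λ ω → f[ k , tournament n ω ]≡ value) (λ ω → f≡? n ω k value))
theorem1 (suc zero) (s≤s ()) _ _
theorem1 (suc (suc k)) k≥2 ε ε>0 = threshold (suc k) D y {{y≢0}} , λ n _ least large →
    proj₂ (Pr-≥ ε ε>0) (badOrientations {{y≢0}} k≥2 2^k≡ n least large)
  where
  D y : ℕ
  D = proj₁ (Pr-≥ ε ε>0)
  y = proj₁ (predecessor-2^ k)
  2^k≡ : 2 ^ suc k ≡ suc y
  2^k≡ = proj₁ (proj₂ (predecessor-2^ k))
  y≢0 : NonZero y
  y≢0 = proj₂ (proj₂ (predecessor-2^ k))
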